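{- Let $k$ be a fixed positive integer and $\varepsilon>0$ be fixed. There is $p_0(\varepsilon,k)$ such that the following holds for every prime $p>p_0(\varepsilon,k)$. Let $\mathcal{I}$ and $\mathcal{J}$ be nonzero intervals of $\mathbb{F}_p$ such that $$|\mathcal{I}|\cdot|\mathcal{J}|^{2k/(k+1)}>p^{1+\varepsilon}.$$ Then for every $\lambda\in\mathbb{F}_p$ the equation $$\sum_{i=1}^{4k}\frac{x_i}{y_i}=\lambda$$ has a solution with $(x_1,\dots,x_{4k})\in\mathcal{I}^{4k}$ and $(y_1,\dots,y_{4k})\in\mathcal{J}^{4k}$ (with all $y_i\neq0$).
   Context: $\mathbb{F}_p$ is the field of residues modulo the prime $p$. An interval of $\mathbb{F}_p$ is a set of the form $\{a,a+1,\dots,a+N-1\}$ (residues mod $p$) for some $a\in\mathbb{F}_p$ and integer $1\le N\le p$; it is called nonzero if it is not equal to $\{0\}$. $|\mathcal{X}|$ denotes cardinality. The fraction $x/y$ means $x\cdot y^{ -1}$ in $\mathbb{F}_p$, so only $y\neq 0$ is allowed. Here $\varepsilon$ is a small fixed positive constant and $p$ is sufficiently large in terms of $\varepsilon$ (and the fixed constant $k$). -}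

module Defs where

open import Data.Nat using (ℕ; zero; suc; _+_; _*_; _^_; _≤_; _<_; NonZero)
open import Data.Nat.DivMod using (_%_)
open import Data.Fin using (Fin)
open import Data.Vec using (sum; tabulate)
open import Data.Product using (Σ; ∃; _×_; _,_)
open import Relation.Binary.PropositionalEquality using (_≡_; _≢_)
open import Relation.Nullary using (¬_)

-- Elements of 𝔽_p are represented by their canonical residues 0,…,p-1 in ℕ.

-- Parameters (a , N) of an interval {a, a+1, …, a+N-1} of 𝔽_p:
-- a ∈ 𝔽_p and 1 ≤ N ≤ p.  Its cardinality is exactly N (since N ≤ p).
ValidInterval : ℕ → ℕ → ℕ → Set
ValidInterval p a N = (a < p) × (1 ≤ N) × (N ≤ p)

NonzeroInterval : ℕ → ℕ → Set
NonzeroInterval a N = ¬ ((a ≡ 0) × (N ≡ 1))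

InInterval : (p : ℕ) → .{{NonZero p}} → ℕ → ℕ → ℕ → Set
InInterval p a N x = Σ ℕ (λ t → (t < N) × (x ≡ (a + t) % p))

IsInverse : (p : ℕ) → .{{NonZero p}} → ℕ → ℕ → Set
IsInverse p y z = (z < p) × ((y * z) % p ≡ 1)

-- Σ_{i} x_i / y_i = λ in 𝔽_p, with n summands, x_i ∈ I, y_i ∈ J, y_i ≠ 0.
-- The fraction x/y = x·y⁻¹; the inverses z_i are uniquely determined.
HasSolution : (p : ℕ) → .{{NonZero p}} → (n aI NI aJ NJ lam : ℕ) → Set
HasSolution p n aI NI aJ NJ lam =
  Σ (Fin n → ℕ) λ x → Σ (Fin n → ℕ) λ y → Σ (Fin n → ℕ) λ z →
    ((i : Fin n) → InInterval p aI NI (x i)) ×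
    ((i : Fin n) → InInterval p aJ NJ (y i)) ×
    ((i : Fin n) → y i ≢ 0) ×
    ((i : Fin n) → IsInverse p (y i) (z i)) ×
    (sum (tabulate (λ i → x i * z i)) % p ≡ lam)

{-# OPTIONS --safe #-}
module Submission where

-- Write S for a set of k-fold sums of reciprocals 1 / y. If |P| pairs (α, β) of multipliers have pairwise
-- distinct ratios, the forms α s + β t are pairwise independent on 𝔽_p², so by Chebyshev's inequality the
-- values α s + β t with s, t ∈ S cover more than half of 𝔽_p as soon as |P| |S|² > 2 p²; adding two such values
-- then gives everything, with 4 k fractions.
--
-- A large S comes from 1 / (y + u v) = (1 / u) / (ξ + v), ξ = y / u: two k-tuples v have the same sum
-- Σ 1 / (ξ + vᵢ) for at most 2 k values of ξ, so on average over the many distinct ratios ξ (their number is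
-- bounded below through the energy of y / u, a count of solutions of y u′ ≡ y′ u) almost no sums coincide.
-- With u ~ |J|^((k-1)/(k+1)) this yields |S| ≫ |J|^(2k/(k+1)) / log p. The pairs of multipliers are
-- (x / u, (x + d) / u) for a fixed u, with the same energy bound giving about |I|² of them. When |I| is
-- a power of log p, a single ξ = y / u with many representations is used instead, and u varies.
--
-- When |I| ≫ √p a few fractions suffice. Writing y ≡ ± β / α with α, β ≤ √p (Thue), the denominators
-- y ± v become (β + v α) / α, which are pairwise coprime for suitable v, so by the Chinese remainder theorem
-- Σ xᵢ / (y ± vᵢ) takes every value unless α and β are both very small; that excludes few y.

import Data.Integer as ℤ
import Data.Integer.Properties as ℤ
import Data.Nat as ℕ
import Data.Nat.DivMod as ℕ
import Data.Nat.Divisibility as ℕ∣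
import Data.Nat.Properties as ℕ
import Data.Nat.Tactic.RingSolver as ℕ-Solver
open import Data.Bool using (Bool; true; false)
open import Data.Empty using (⊥; ⊥-elim)
open import Data.List using (List; []; _∷_; _++_; _∷ʳ_; length; map; filter; upTo; applyUpTo; cartesianProduct; cartesianProductWith)
open import Data.List.Membership.Propositional using (_∈_)
open import Data.List.Membership.Propositional.Properties
open import Data.List.Properties using (length-++; length-map; length-upTo; length-applyUpTo; upTo-∷ʳ; ≡-dec; ∷-injective)
open import Data.List.Relation.Unary.All as All using (All; []; _∷_)
import Data.List.Relation.Unary.All.Properties as All
open import Data.List.Relation.Unary.AllPairs using (AllPairs; []; _∷_)
import Data.List.Relation.Unary.AllPairs.Properties as AllPairs
open import Data.List.Relation.Unary.Any using (here; there)
open import Data.List.Relation.Unary.Unique.Propositional using (Unique)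
open import Data.List.Relation.Unary.Unique.Propositional.Properties as Unique using (upTo⁺; filter⁺; cartesianProduct⁺; cartesianProductWith⁺)
open import Data.Nat.Primality using (Prime; prime⇒nonTrivial)
open import Data.Product using (Σ; ∃; _×_; _,_; proj₁; proj₂)
open import Data.Sum using (_⊎_; inj₁; inj₂)
open import Data.Unit using (tt)
open import Function using (it)
open import Relation.Binary.Definitions using (DecidableEquality; tri<; tri≈; tri>)
open import Relation.Binary.PropositionalEquality
open import Relation.Nullary hiding (det)
open import Relation.Nullary.Decidable using (¬?; toWitness; _→-dec_; _×-dec_; _⊎-dec_)

-- Origin of the exponent: the shifts y + u v must stay in J, so u V is at most about |J| for
-- entries v of size V. On the other side the averaging needs at least as many ratios ξ as tuples,
-- so u |J| is at least about V^k. Eliminating u leaves V^(k+1) ~ |J|², hence |S| ~ V^k ~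
-- |J|^(2k/(k+1)). Why three ranges of |I|: the energy bound turns congruences between products into
-- equations between integers, which needs products below p. Applied to the pairs (x, x + d), this
-- confines d to below √p, so long I need a different argument. At the other end V^k may not exceed
-- p, and then the lost powers of log p must be won back from the number of multipliers; an I as
-- short as a power of log p offers too few. Every loss is a constant or a power of L, the bit
-- length of p. The factor p^ε of the hypothesis is exchanged once and for all for a factor X(L), a
-- polynomial in L, and the rest is arithmetic with natural numbers: quotients and fractional
-- exponents are multiplied out.

module Summation where

  -- Finite sums and counting by indicators

  open import Data.Nat using (ℕ; zero; suc; _+_; _*_; _≤_; _<_; z≤n; s≤s; _≤?_)
  open import Data.Nat.Properties
  open import Data.Nat.Tactic.RingSolver using (solve-∀)

  private variable
    A B : Set

  ∑ : List A → (A → ℕ) → ℕ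
  ∑ []       f = 0
  ∑ (x ∷ xs) f = f x + ∑ xs f

  𝟙 : {P : Set} → Dec P → ℕ
  𝟙 (yes _) = 1
  𝟙 (no  _) = 0

  𝟙-yes : {P : Set} (d : Dec P) → P → 𝟙 d ≡ 1
  𝟙-yes (yes _) p = refl
  𝟙-yes (no ¬p) p = ⊥-elim (¬p p)

  𝟙-pos : {P : Set} (d : Dec P) → 0 < 𝟙 d → P
  𝟙-pos (yes p) _ = p

  𝟙-≤1 : {P : Set} (d : Dec P) → 𝟙 d ≤ 1
  𝟙-≤1 (yes _) = ≤-refl
  𝟙-≤1 (no  _) = z≤n

  𝟙-mono : {P Q : Set} (d : Dec P) (e : Dec Q) → (P → Q) → 𝟙 d ≤ 𝟙 e
  𝟙-mono (yes p) e P→Q = ≤-reflexive (sym (𝟙-yes e (P→Q p)))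
  𝟙-mono (no  _) e P→Q = z≤n

  𝟙-≤ : {P : Set} (d : Dec P) {n : ℕ} → (P → 1 ≤ n) → 𝟙 d ≤ n
  𝟙-≤ (yes p) h = h p
  𝟙-≤ (no  _) h = z≤n

  ∑-mono∈ : (xs : List A) {f g : A → ℕ} → (∀ {x} → x ∈ xs → f x ≤ g x) → ∑ xs f ≤ ∑ xs g
  ∑-mono∈ []       h = z≤n
  ∑-mono∈ (x ∷ xs) h = +-mono-≤ (h (here refl)) (∑-mono∈ xs (λ i → h (there i)))

  ∑-mono : (xs : List A) {f g : A → ℕ} → (∀ x → f x ≤ g x) → ∑ xs f ≤ ∑ xs g
  ∑-mono xs h = ∑-mono∈ xs (λ {x} _ → h x)

  ∑-cong : (xs : List A) {f g : A → ℕ} → (∀ x → f x ≡ g x) → ∑ xs f ≡ ∑ xs g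
  ∑-cong []       h = refl
  ∑-cong (x ∷ xs) h = cong₂ _+_ (h x) (∑-cong xs h)

  interchange : ∀ a b c d → (a + b) + (c + d) ≡ (a + c) + (b + d)
  interchange = solve-∀

  ∑-+ : (xs : List A) (f g : A → ℕ) → ∑ xs (λ x → f x + g x) ≡ ∑ xs f + ∑ xs g
  ∑-+ []       f g = refl
  ∑-+ (x ∷ xs) f g = trans (cong ((f x + g x) +_) (∑-+ xs f g)) (interchange (f x) (g x) (∑ xs f) (∑ xs g))

  ∑-*ˡ : (xs : List A) (c : ℕ) (f : A → ℕ) → ∑ xs (λ x → c * f x) ≡ c * ∑ xs f
  ∑-*ˡ []       c f = sym (*-zeroʳ c)
  ∑-*ˡ (x ∷ xs) c f = trans (cong (c * f x +_) (∑-*ˡ xs c f)) (sym (*-distribˡ-+ c (f x) (∑ xs f)))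

  ∑-*ʳ : (xs : List A) (c : ℕ) (f : A → ℕ) → ∑ xs (λ x → f x * c) ≡ ∑ xs f * c
  ∑-*ʳ xs c f = trans (∑-cong xs (λ x → *-comm (f x) c)) (trans (∑-*ˡ xs c f) (*-comm c (∑ xs f)))

  ∑-const : (xs : List A) (c : ℕ) → ∑ xs (λ _ → c) ≡ length xs * c
  ∑-const []       c = refl
  ∑-const (x ∷ xs) c = cong (c +_) (∑-const xs c)

  ∑-1 : (xs : List A) → ∑ xs (λ _ → 1) ≡ length xs
  ∑-1 xs = trans (∑-const xs 1) (*-identityʳ _)

  ∑-0 : (xs : List A) → ∑ xs (λ _ → 0) ≡ 0
  ∑-0 xs = trans (∑-const xs 0) (*-zeroʳ (length xs))

  ∑-≤const : (xs : List A) {f : A → ℕ} (c : ℕ) → (∀ {x} → x ∈ xs → f x ≤ c) → ∑ xs f ≤ length xs * c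
  ∑-≤const xs c h = ≤-trans (∑-mono∈ xs h) (≤-reflexive (∑-const xs c))

  ∑-swap : (xs : List A) (ys : List B) (f : A → B → ℕ) →
           ∑ xs (λ x → ∑ ys (f x)) ≡ ∑ ys (λ y → ∑ xs (λ x → f x y))
  ∑-swap []       ys f = sym (∑-0 ys)
  ∑-swap (x ∷ xs) ys f =
    trans (cong (∑ ys (f x) +_) (∑-swap xs ys f)) (sym (∑-+ ys (f x) (λ y → ∑ xs (λ x → f x y))))

  ∑-++ : (xs ys : List A) (f : A → ℕ) → ∑ (xs ++ ys) f ≡ ∑ xs f + ∑ ys f
  ∑-++ []       ys f = refl
  ∑-++ (x ∷ xs) ys f = trans (cong (f x +_) (∑-++ xs ys f)) (sym (+-assoc (f x) (∑ xs f) (∑ ys f)))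

  ∑-map : (xs : List A) (g : A → B) (f : B → ℕ) → ∑ (map g xs) f ≡ ∑ xs (λ x → f (g x))
  ∑-map []       g f = refl
  ∑-map (x ∷ xs) g f = cong (f (g x) +_) (∑-map xs g f)

  ∑-× : (xs : List A) (ys : List B) (f : A × B → ℕ) →
        ∑ (cartesianProduct xs ys) f ≡ ∑ xs (λ x → ∑ ys (λ y → f (x , y)))
  ∑-× []       ys f = refl
  ∑-× (x ∷ xs) ys f = trans (∑-++ (map (x ,_) ys) _ f) (cong₂ _+_ (∑-map ys (x ,_) f) (∑-× xs ys f))

  length-cartesianProductWith : {C : Set} (f : A → B → C) (xs : List A) (ys : List B) →
                                length (cartesianProductWith f xs ys) ≡ length xs * length ys
  length-cartesianProductWith f []       ys = refl
  length-cartesianProductWith f (x ∷ xs) ys = trans (length-++ (map (f x) ys))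
    (cong₂ _+_ (length-map (f x) ys) (length-cartesianProductWith f xs ys))

  ∑-pos : (xs : List A) (f : A → ℕ) → 0 < ∑ xs f → ∃ λ x → x ∈ xs × 0 < f x
  ∑-pos (x ∷ xs) f h with f x in eq
  ... | suc n = x , here refl , subst (0 <_) (sym eq) (s≤s z≤n)
  ... | zero with ∑-pos xs f h
  ...   | y , i , q = y , there i , q

  ∑-term : (xs : List A) (f : A → ℕ) {x : A} → x ∈ xs → f x ≤ ∑ xs f
  ∑-term (x ∷ xs) f (here refl) = m≤m+n (f x) _
  ∑-term (x ∷ xs) f (there i)   = ≤-trans (∑-term xs f i) (m≤n+m _ (f x))

  -- Nearly every count below goes through this. Membership and injectivity are asked only where `f`
  -- is positive, so with an indicator for `f` the set being counted never has to be formed. Each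
  -- target is removed from `ys` once it has been hit.
  ∑-inj : (xs : List A) (ys : List B) {f : A → ℕ} {h : B → ℕ} (g : A → B) → Unique xs →
          (∀ {x} → x ∈ xs → 0 < f x → g x ∈ ys × f x ≤ h (g x)) →
          (∀ {x x′} → x ∈ xs → x′ ∈ xs → 0 < f x → 0 < f x′ → g x ≡ g x′ → x ≡ x′) →
          ∑ xs f ≤ ∑ ys h
  ∑-inj []       ys g u mem inj = z≤n
  ∑-inj (x ∷ xs) ys {f} {h} g (x∉ ∷ u) mem inj with 1 ≤? f x
  ... | no f≯0 rewrite n<1⇒n≡0 (≰⇒> f≯0) =
    ∑-inj xs ys g u (λ i → mem (there i)) (λ i j → inj (there i) (there j))
  ... | yes f>0 with mem (here refl) f>0
  ...   | gx∈ , le with ∈-∃++ gx∈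
  ...     | ys₁ , ys₂ , refl = begin
    f x + ∑ xs f                       ≤⟨ +-mono-≤ le (∑-inj xs (ys₁ ++ ys₂) g u mem′ (λ i j → inj (there i) (there j))) ⟩
    h (g x) + ∑ (ys₁ ++ ys₂) h         ≡⟨ cong (h (g x) +_) (∑-++ ys₁ ys₂ h) ⟩
    h (g x) + (∑ ys₁ h + ∑ ys₂ h)      ≡⟨ rot (h (g x)) (∑ ys₁ h) (∑ ys₂ h) ⟩
    ∑ ys₁ h + (h (g x) + ∑ ys₂ h)      ≡⟨ ∑-++ ys₁ (g x ∷ ys₂) h ⟨
    ∑ (ys₁ ++ g x ∷ ys₂) h             ∎
    where
    open ≤-Reasoning
    rot : ∀ a b c → a + (b + c) ≡ b + (a + c)
    rot = solve-∀
    mem′ : ∀ {z} → z ∈ xs → 0 < f z → g z ∈ ys₁ ++ ys₂ × f z ≤ h (g z)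
    mem′ {z} i q with mem (there i) q
    ... | gz∈ , le′ with ∈-++⁻ ys₁ gz∈
    ...   | inj₁ k             = ∈-++⁺ˡ k , le′
    ...   | inj₂ (there k)     = ∈-++⁺ʳ ys₁ k , le′
    ...   | inj₂ (here gz≡gx)  =
      ⊥-elim (All.lookup x∉ i (inj (here refl) (there i) f>0 q (sym gz≡gx)))

  2ab≤a²+b² : ∀ a b → 2 * (a * b) ≤ a * a + b * b
  2ab≤a²+b² a b with ≤-total a b
  ... | inj₁ a≤b with m≤n⇒∃[o]m+o≡n a≤b
  ...   | c , refl = ≤-trans (m≤m+n _ (c * c)) (≤-reflexive (id₁ a c))
    where id₁ : ∀ a c → 2 * (a * (a + c)) + c * c ≡ a * a + (a + c) * (a + c)
          id₁ = solve-∀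
  2ab≤a²+b² a b | inj₂ b≤a with m≤n⇒∃[o]m+o≡n b≤a
  ...   | c , refl = ≤-trans (m≤m+n _ (c * c)) (≤-reflexive (id₁ b c))
    where id₁ : ∀ b c → 2 * ((b + c) * b) + c * c ≡ (b + c) * (b + c) + b * b
          id₁ = solve-∀

  -- Twice f x f y is bounded by f(x)² + f(y)², and by 0 unless both factors are positive.
  cauchy-support : (xs : List A) (f : A → ℕ) →
                   ∑ xs f * ∑ xs f ≤ ∑ xs (λ x → 𝟙 (1 ≤? f x)) * ∑ xs (λ x → f x * f x)
  cauchy-support xs f = *-cancelˡ-≤ 2 (begin
    2 * (∑ xs f * ∑ xs f)                                             ≡⟨ cong (2 *_) (sym (∑-*ʳ xs (∑ xs f) f)) ⟩
    2 * ∑ xs (λ x → f x * ∑ xs f)                                     ≡⟨ sym (∑-*ˡ xs 2 _) ⟩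
    ∑ xs (λ x → 2 * (f x * ∑ xs f))                                   ≤⟨ ∑-mono xs (λ x → row x) ⟩
    ∑ xs (λ x → f x * f x * s + 𝟙 (1 ≤? f x) * q)                     ≡⟨ ∑-+ xs _ _ ⟩
    ∑ xs (λ x → f x * f x * s) + ∑ xs (λ x → 𝟙 (1 ≤? f x) * q)        ≡⟨ cong₂ _+_ (∑-*ʳ xs s _) (∑-*ʳ xs q _) ⟩
    q * s + s * q                                                     ≡⟨ fin q s ⟩
    2 * (s * q)                                                       ∎)
    where
    open ≤-Reasoning
    s = ∑ xs (λ x → 𝟙 (1 ≤? f x))
    q = ∑ xs (λ x → f x * f x)
    fin : ∀ q s → q * s + s * q ≡ 2 * (s * q)
    fin = solve-∀
    assoc′ : ∀ a b → 2 * (a * b) ≡ 2 * a * b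
    assoc′ = solve-∀
    cell : ∀ x y → 2 * f x * f y ≤ f x * f x * 𝟙 (1 ≤? f y) + 𝟙 (1 ≤? f x) * (f y * f y)
    cell x y with f x | f y
    ... | zero  | _     = z≤n
    ... | suc a | zero  rewrite *-zeroʳ (2 * suc a) = z≤n
    ... | suc a | suc b = subst₂ _≤_ (assoc′ (suc a) (suc b))
          (sym (cong₂ _+_ (*-identityʳ (suc a * suc a)) (*-identityˡ (suc b * suc b)))) (2ab≤a²+b² (suc a) (suc b))
    row : ∀ x → 2 * (f x * ∑ xs f) ≤ f x * f x * s + 𝟙 (1 ≤? f x) * q
    row x = begin
      2 * (f x * ∑ xs f)                    ≡⟨ assoc′ (f x) _ ⟩
      2 * f x * ∑ xs f                      ≡⟨ sym (∑-*ˡ xs (2 * f x) f) ⟩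
      ∑ xs (λ y → 2 * f x * f y)            ≤⟨ ∑-mono xs (cell x) ⟩
      ∑ xs (λ y → f x * f x * 𝟙 (1 ≤? f y) + 𝟙 (1 ≤? f x) * (f y * f y)) ≡⟨ ∑-+ xs _ _ ⟩
      _                                     ≡⟨ cong₂ _+_ (∑-*ˡ xs (f x * f x) _) (∑-*ˡ xs (𝟙 (1 ≤? f x)) _) ⟩
      f x * f x * s + 𝟙 (1 ≤? f x) * q      ∎

  -- Otherwise `b x` times the total weight W is at least X + 1 wherever `w x` is positive, and
  -- summing against `w` gives W X + W ≤ W X. The bound is multiplied out to avoid the quotient X /
  -- W.
  ∑-average : (xs : List A) (w b : A → ℕ) (X : ℕ) → ∑ xs (λ x → w x * b x) ≤ X → 0 < ∑ xs w →
              ∃ λ x → x ∈ xs × 0 < w x × b x * ∑ xs w ≤ X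
  ∑-average {A} xs w b X le pos = go
    where
    W = ∑ xs w
    good : A → ℕ
    good x = w x * 𝟙 (b x * W ≤? X)
    go : ∃ λ x → x ∈ xs × 0 < w x × b x * W ≤ X
    go with 1 ≤? ∑ xs good
    ... | yes q with ∑-pos xs good q
    ...   | x , i , r = x , i , m*n>0ˡ (w x) r , 𝟙-pos (b x * W ≤? X) (m*n>0ʳ (w x) r)
      where
      m*n>0ˡ : ∀ m {n} → 0 < m * n → 0 < m
      m*n>0ˡ (suc m) _ = s≤s z≤n
      m*n>0ʳ : ∀ m {n} → 0 < m * n → 0 < n
      m*n>0ʳ m {zero}  h rewrite *-zeroʳ m = h
      m*n>0ʳ m {suc n} h = s≤s z≤n
    go | no ¬q = ⊥-elim (<-irrefl refl (<-≤-trans (m<m+n (W * X) pos) (begin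
        W * X + W                                ≡⟨ +-comm (W * X) W ⟩
        W + W * X                                ≡⟨ *-suc W X ⟨
        W * suc X                                ≡⟨ ∑-*ʳ xs (suc X) w ⟨
        ∑ xs (λ x → w x * suc X)                 ≤⟨ ∑-mono∈ xs large ⟩
        ∑ xs (λ x → w x * b x * W)               ≡⟨ ∑-*ʳ xs W _ ⟩
        ∑ xs (λ x → w x * b x) * W               ≤⟨ *-monoˡ-≤ W le ⟩
        X * W                                    ≡⟨ *-comm X W ⟩
        W * X                                    ∎)))
      where
      open ≤-Reasoning
      large : ∀ {x} → x ∈ xs → w x * suc X ≤ w x * b x * W
      large {x} i with b x * W ≤? X | ∑-term xs good i
      ... | no  bW≰X | _ = ≤-trans (*-monoʳ-≤ (w x) (≰⇒> bW≰X)) (≤-reflexive (sym (*-assoc (w x) (b x) W)))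
      ... | yes bW≤X | t = subst (λ v → v * suc X ≤ w x * b x * W) (sym wx≡0) z≤n
        where
        wx≡0 : w x ≡ 0
        wx≡0 = n<1⇒n≡0 (≤-<-trans (≤-trans (≤-reflexive (sym (*-identityʳ (w x)))) t) (≰⇒> ¬q))

-- Congruences modulo a prime

module Congruence where
  open import Data.Integer using (ℤ; +_; _+_; _*_; _-_; -_; +0) renaming (∣_∣ to abs)
  open import Data.Integer.DivMod using (_%ℕ_; _/ℕ_; n%ℕd<d; a≡a%ℕn+[a/ℕn]*n)
  open import Data.Integer.Divisibility.Signed
  open import Data.Integer.Properties using (pos-+; pos-*)
  open import Data.Integer.Tactic.RingSolver using (solve-∀)
  open import Data.Nat using (ℕ; zero; suc; NonZero; z≤n; s≤s; _≤_; _<_; nonTrivial⇒n>1)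
  open import Data.Nat.Coprimality using (Coprime; coprime-Bézout; prime⇒coprime)
  open import Data.Nat.GCD using (module Bézout)
  open import Data.Nat.Primality using (euclidsLemma)
  open import Data.Nat.Properties

  ∣-resp : ∀ {m x y : ℤ} → x ≡ y → m ∣ x → m ∣ y
  ∣-resp refl d = d

  ∣-lin₁ : ∀ {m A X : ℤ} (c : ℤ) → m ∣ A → X ≡ c * A → m ∣ X
  ∣-lin₁ c a refl = ∣n⇒∣m*n c a

  ∣-lin₂ : ∀ {m A B X : ℤ} (c d : ℤ) → m ∣ A → m ∣ B → X ≡ c * A + d * B → m ∣ X
  ∣-lin₂ c d a b refl = ∣m∣n⇒∣m+n (∣n⇒∣m*n c a) (∣n⇒∣m*n d b)

  coprime⇒inverse : ∀ {m n} → Coprime m n → ∃ λ x → + n ∣ x * + m - + 1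
  coprime⇒inverse {m} {n} c with coprime-Bézout c
  ... | Bézout.+- x y eq = + x , divides (+ y) (begin
    + x * + m - + 1             ≡⟨ cong (_- + 1) (trans (sym (pos-* x m)) (trans (cong +_ (sym eq)) (trans (pos-+ 1 (y ℕ.* n)) (cong (λ v → + 1 + v) (pos-* y n))))) ⟩
    + 1 + + y * + n - + 1       ≡⟨ e (+ y) (+ n) ⟩
    + y * + n                   ∎)
    where open ≡-Reasoning
          e : ∀ y n → + 1 + y * n - + 1 ≡ y * n
          e = solve-∀
  ... | Bézout.-+ x y eq = - + x , divides (- + y) (begin
    - + x * + m - + 1           ≡⟨ e (+ x) (+ m) ⟩
    - (+ 1 + + x * + m)         ≡⟨ cong -_ (trans (cong (λ v → + 1 + v) (sym (pos-* x m))) (trans (sym (pos-+ 1 (x ℕ.* m))) (trans (cong +_ eq) (pos-* y n)))) ⟩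
    - (+ y * + n)               ≡⟨ e′ (+ y) (+ n) ⟩
    - + y * + n                 ∎)
    where open ≡-Reasoning
          e : ∀ x m → - x * m - + 1 ≡ - (+ 1 + x * m)
          e = solve-∀
          e′ : ∀ x m → - (x * m) ≡ - x * m
          e′ = solve-∀

  -- The bridge from congruences back to equations between integers; size conditions such as 4 U M ≤
  -- p below exist to make it applicable.
  ∣∧<⇒≡0 : ∀ {m x} → + m ∣ x → abs x < m → x ≡ +0
  ∣∧<⇒≡0 {m} {x} d lt with abs x in eq
  ... | zero  = ℤ.∣i∣≡0⇒i≡0 eq
  ... | suc n = ⊥-elim (<⇒≱ lt (ℕ∣.∣⇒≤ (subst (m ℕ∣.∣_) eq (∣⇒∣ᵤ d))))

  module Residues (p : ℕ) .{{_ : NonZero p}} (prime : Prime p) where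

    infix 4 _≈_ _≈?_

    -- A record rather than a synonym for divisibility of x - y, so that unification can recover
    -- both sides from the type.
    record _≈_ (x y : ℤ) : Set where
      constructor ≈⁺
      field ≈⁻ : + p ∣ x - y
    open _≈_ public

    _≈?_ : ∀ x y → Dec (x ≈ y)
    x ≈? y with + p ∣? (x - y)
    ... | yes d = yes (≈⁺ d)
    ... | no ¬d = no (λ h → ¬d (≈⁻ h))

    ≈-reflexive : ∀ {x y} → x ≡ y → x ≈ y
    ≈-reflexive {x} refl = ≈⁺ (∣-resp (sym (ℤ.+-inverseʳ x)) (divides +0 refl))

    ≈-refl : ∀ {x} → x ≈ x
    ≈-refl = ≈-reflexive refl

    -- The standard way of deriving congruences here: x - y is written as a combination of
    -- differences already known to vanish mod p, and what remains is an identity in ℤ for the ring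
    -- solver.
    ≈-lin₁ : ∀ {a b x y} (c : ℤ) → a ≈ b → x - y ≡ c * (a - b) → x ≈ y
    ≈-lin₁ c (≈⁺ h) e = ≈⁺ (∣-lin₁ c h e)

    ≈-lin₂ : ∀ {a b a′ b′ x y} (c d : ℤ) → a ≈ b → a′ ≈ b′ → x - y ≡ c * (a - b) + d * (a′ - b′) → x ≈ y
    ≈-lin₂ c d (≈⁺ h) (≈⁺ k) e = ≈⁺ (∣-lin₂ c d h k e)

    ≈-sym : ∀ {x y} → x ≈ y → y ≈ x
    ≈-sym {x} {y} h = ≈-lin₁ (- + 1) h (e x y)
      where e : ∀ x y → y - x ≡ - + 1 * (x - y)
            e = solve-∀

    ≈-trans : ∀ {x y z} → x ≈ y → y ≈ z → x ≈ z
    ≈-trans {x} {y} {z} h k = ≈-lin₂ (+ 1) (+ 1) h k (e x y z)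
      where e : ∀ x y z → x - z ≡ + 1 * (x - y) + + 1 * (y - z)
            e = solve-∀

    ≈-+ : ∀ {a b c d} → a ≈ b → c ≈ d → a + c ≈ b + d
    ≈-+ {a} {b} {c} {d} h k = ≈-lin₂ (+ 1) (+ 1) h k (e a b c d)
      where e : ∀ a b c d → a + c - (b + d) ≡ + 1 * (a - b) + + 1 * (c - d)
            e = solve-∀

    ≈-* : ∀ {a b c d} → a ≈ b → c ≈ d → a * c ≈ b * d
    ≈-* {a} {b} {c} {d} h k = ≈-lin₂ c b h k (e a b c d)
      where e : ∀ a b c d → a * c - b * d ≡ c * (a - b) + b * (c - d)
            e = solve-∀

    ≈-*ˡ : ∀ {a b} c → a ≈ b → c * a ≈ c * b
    ≈-*ˡ c h = ≈-* (≈-refl {c}) h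

    ≈-minus : ∀ {a b c d} → a ≈ b → c ≈ d → a - c ≈ b - d
    ≈-minus {a} {b} {c} {d} h k = ≈-lin₂ (+ 1) (- + 1) h k (e a b c d)
      where e : ∀ a b c d → a - c - (b - d) ≡ + 1 * (a - b) + - + 1 * (c - d)
            e = solve-∀

    rs : ℤ → ℕ
    rs x = x %ℕ p

    rs<p : ∀ x → rs x < p
    rs<p x = n%ℕd<d x p

    rs-≈ : ∀ x → + rs x ≈ x
    rs-≈ x = ≈⁺ (divides (- (x /ℕ p)) (trans (cong (λ v → + rs x - v) (a≡a%ℕn+[a/ℕn]*n x p)) (e (+ rs x) (x /ℕ p) (+ p))))
      where e : ∀ r q p → r - (r + q * p) ≡ - q * p
            e = solve-∀

    ≈⇒≡ : ∀ {a b} → a < p → b < p → + a ≈ + b → a ≡ b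
    ≈⇒≡ {a} {b} a<p b<p (≈⁺ h) = ℤ.+-injective (ℤ.i-j≡0⇒i≡j (+ a) (+ b) (∣∧<⇒≡0 h (lt (≤-total a b))))
      where
      lt : a ≤ b ⊎ b ≤ a → abs (+ a - + b) < p
      lt (inj₁ a≤b) = subst (_< p) (sym (trans (cong abs (ℤ.m-n≡m⊖n a b)) (ℤ.∣⊖∣-≤ a≤b)))
                        (≤-<-trans (m∸n≤m b a) b<p)
      lt (inj₂ b≤a) = subst (_< p) (sym (trans (cong abs (ℤ.m-n≡m⊖n a b)) (trans (ℤ.∣m⊖n∣≡∣n⊖m∣ a b) (ℤ.∣⊖∣-≤ b≤a))))
                        (≤-<-trans (m∸n≤m a b) a<p)

    rs-cong : ∀ {x y} → x ≈ y → rs x ≡ rs y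
    rs-cong {x} {y} h = ≈⇒≡ (rs<p x) (rs<p y) (≈-trans (rs-≈ x) (≈-trans h (≈-sym (rs-≈ y))))

    rs-inj : ∀ {x y} → rs x ≡ rs y → x ≈ y
    rs-inj {x} {y} h = ≈-trans (≈-sym (rs-≈ x)) (subst (λ v → + v ≈ y) (sym h) (rs-≈ y))

    rs-id : ∀ {a} → a < p → rs (+ a) ≡ a
    rs-id {a} a<p = ≈⇒≡ (rs<p (+ a)) a<p (rs-≈ (+ a))

    Unit : ℤ → Set
    Unit x = ¬ (+ p ∣ x)

    euclid : ∀ x y → + p ∣ x * y → + p ∣ x ⊎ + p ∣ y
    euclid x y h with euclidsLemma (abs x) (abs y) prime (subst (p ℕ∣.∣_) (ℤ.abs-* x y) (∣⇒∣ᵤ h))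
    ... | inj₁ d = inj₁ (∣ᵤ⇒∣ d)
    ... | inj₂ d = inj₂ (∣ᵤ⇒∣ d)

    Unit-* : ∀ {x y} → Unit x → Unit y → Unit (x * y)
    Unit-* {x} {y} ux uy h with euclid x y h
    ... | inj₁ d = ux d
    ... | inj₂ d = uy d

    Unit-resp : ∀ {x y} → x ≈ y → Unit x → Unit y
    Unit-resp {x} {y} (≈⁺ h) u d = u (∣-lin₂ (+ 1) (+ 1) h d (e x y))
      where e : ∀ x y → x ≡ + 1 * (x - y) + + 1 * y
            e = solve-∀

    ≈-cancelˡ : ∀ {c x y} → Unit c → c * x ≈ c * y → x ≈ y
    ≈-cancelˡ {c} {x} {y} u (≈⁺ h) with euclid c (x - y) (∣-resp (e c x y) h)
      where e : ∀ c x y → c * x - c * y ≡ c * (x - y)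
            e = solve-∀
    ... | inj₁ d = ⊥-elim (u d)
    ... | inj₂ d = ≈⁺ d

    Unit-< : ∀ {a} → 1 ≤ a → a < p → Unit (+ a)
    Unit-< {suc a} _ a<p d = <⇒≱ a<p (ℕ∣.∣⇒≤ (∣⇒∣ᵤ d))

    private
      invertible : ∀ x → Unit x → ∃ λ z → z * x ≈ + 1
      invertible x u with coprime⇒inverse {rs x} {p} coprime-rs
        where
        rs-nonzero : NonZero (rs x)
        rs-nonzero with rs x in eq
        ... | suc _ = _
        ... | zero  = ⊥-elim (u (∣-lin₁ (- + 1) (≈⁻ (subst (λ v → + v ≈ x) eq (rs-≈ x))) (e x)))
          where e : ∀ x → x ≡ - + 1 * (+ 0 - x)
                e = solve-∀
        coprime-rs : Coprime (rs x) p
        coprime-rs (d∣r , d∣p) = prime⇒coprime prime {{rs-nonzero}} (rs<p x) (d∣p , d∣r)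
      ... | z , h = z , ≈-trans (≈-*ˡ z (≈-sym (rs-≈ x))) (≈⁺ h)

    -- Total, with the default value 0 at multiples of `p`; its laws ask for a unit.
    inv : ℤ → ℤ
    inv x with + p ∣? x
    ... | yes _ = + 0
    ... | no  u = proj₁ (invertible x u)

    inv-* : ∀ {x} → Unit x → inv x * x ≈ + 1
    inv-* {x} u with + p ∣? x
    ... | yes d = ⊥-elim (u d)
    ... | no  v = proj₂ (invertible x v)

    *-inv : ∀ {x} → Unit x → x * inv x ≈ + 1
    *-inv {x} u = ≈-trans (≈-reflexive (ℤ.*-comm x (inv x))) (inv-* u)

    Unit-1 : Unit (+ 1)
    Unit-1 = Unit-< (s≤s z≤n) (nonTrivial⇒n>1 p {{prime⇒nonTrivial prime}})

    Unit-inv : ∀ {x} → Unit x → Unit (inv x)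
    Unit-inv {x} u d = Unit-1 (∣-lin₂ x (- + 1) d (≈⁻ (inv-* u)) (e x (inv x)))
      where e : ∀ x z → + 1 ≡ x * z + - + 1 * (z * x - + 1)
            e = solve-∀

    inv-unique : ∀ {x z} → Unit x → z * x ≈ + 1 → z ≈ inv x
    inv-unique {x} {z} u h = ≈-cancelˡ u (≈-lin₂ (+ 1) (- + 1) h (inv-* u) (e x z (inv x)))
      where e : ∀ x z w → x * z - x * w ≡ + 1 * (z * x - + 1) + - + 1 * (w * x - + 1)
            e = solve-∀

-- Integer solutions of δ u′ = δ′ u

module CrossRatios where
  open Summation
  open import Data.Nat
  open import Data.Nat.Coprimality using (Coprime; coprime-divisor; coprime-/gcd)
  open import Data.Nat.DivMod
  open import Data.Nat.Divisibility using (_∣_; _∣?_; divides; divides-refl; ∣⇒≤; 0∣⇒≡0)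
  open import Data.Nat.GCD using (gcd; gcd[m,n]∣m; gcd[m,n]∣n; gcd[m,n]≢0)
  open import Data.Nat.Properties
  open import Data.Nat.Tactic.RingSolver using (solve-∀)

  range : ℕ → ℕ → List ℕ
  range a n = map (a +_) (upTo n)

  ∈-range⁺ : ∀ {a n x} → a ≤ x → x < a + n → x ∈ range a n
  ∈-range⁺ {a} {n} {x} a≤x x<a+n with m≤n⇒∃[o]m+o≡n a≤x
  ... | o , refl = ∈-map⁺ (a +_) (∈-upTo⁺ (+-cancelˡ-< a o n x<a+n))

  ∈-range⁻ : ∀ {a n x} → x ∈ range a n → a ≤ x × x < a + n
  ∈-range⁻ {a} i with ∈-map⁻ (a +_) i
  ... | o , j , refl = m≤m+n a o , +-monoʳ-< a (∈-upTo⁻ j)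

  range-unique : ∀ a n → Unique (range a n)
  range-unique a n = Unique.map⁺ (+-cancelˡ-≡ a _ _) (upTo⁺ n)

  length-range : ∀ a n → length (range a n) ≡ n
  length-range a n = trans (length-map (a +_) (upTo n)) (length-upTo n)

  ∑-1-upTo : ∀ n → ∑ (upTo n) (λ _ → 1) ≡ n
  ∑-1-upTo n = trans (∑-1 (upTo n)) (length-upTo n)

  ∑-1-range : ∀ a n → ∑ (range a n) (λ _ → 1) ≡ n
  ∑-1-range a n = trans (∑-1 (range a n)) (length-range a n)

  ∑-upTo-suc : ∀ n (f : ℕ → ℕ) → ∑ (upTo (suc n)) f ≡ ∑ (upTo n) f + f n
  ∑-upTo-suc n f = begin
    ∑ (upTo (suc n)) f            ≡⟨ cong (λ xs → ∑ xs f) (upTo-∷ʳ n) ⟨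
    ∑ (upTo n ∷ʳ n) f             ≡⟨ ∑-++ (upTo n) (n ∷ []) f ⟩
    ∑ (upTo n) f + (f n + 0)      ≡⟨ cong (∑ (upTo n) f +_) (+-identityʳ (f n)) ⟩
    ∑ (upTo n) f + f n            ∎
    where open ≡-Reasoning

  ∑-upTo-+ : ∀ a b (f : ℕ → ℕ) → ∑ (upTo (a + b)) f ≡ ∑ (upTo a) f + ∑ (upTo b) (λ i → f (a + i))
  ∑-upTo-+ a zero    f = trans (cong (λ v → ∑ (upTo v) f) (+-identityʳ a)) (sym (+-identityʳ _))
  ∑-upTo-+ a (suc b) f = begin
    ∑ (upTo (a + suc b)) f                                          ≡⟨ cong (λ v → ∑ (upTo v) f) (+-suc a b) ⟩
    ∑ (upTo (suc (a + b))) f                                        ≡⟨ ∑-upTo-suc (a + b) f ⟩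
    ∑ (upTo (a + b)) f + f (a + b)                                  ≡⟨ cong (_+ f (a + b)) (∑-upTo-+ a b f) ⟩
    ∑ (upTo a) f + ∑ (upTo b) (λ i → f (a + i)) + f (a + b)         ≡⟨ +-assoc (∑ (upTo a) f) _ _ ⟩
    ∑ (upTo a) f + (∑ (upTo b) (λ i → f (a + i)) + f (a + b))       ≡⟨ cong (∑ (upTo a) f +_) (sym (∑-upTo-suc b _)) ⟩
    ∑ (upTo a) f + ∑ (upTo (suc b)) (λ i → f (a + i))               ∎
    where open ≡-Reasoning

  ∑-upTo-* : ∀ r m (f : ℕ → ℕ) → ∑ (upTo (r * m)) f ≡ ∑ (upTo r) (λ j → ∑ (upTo m) (λ s → f (j * m + s)))
  ∑-upTo-* zero    m f = refl
  ∑-upTo-* (suc r) m f = begin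
    ∑ (upTo (m + r * m)) f                                ≡⟨ cong (λ v → ∑ (upTo v) f) (+-comm m (r * m)) ⟩
    ∑ (upTo (r * m + m)) f                                ≡⟨ ∑-upTo-+ (r * m) m f ⟩
    ∑ (upTo (r * m)) f + ∑ (upTo m) (λ s → f (r * m + s)) ≡⟨ cong (_+ ∑ (upTo m) (λ s → f (r * m + s))) (∑-upTo-* r m f) ⟩
    _                                                     ≡⟨ sym (∑-upTo-suc r _) ⟩
    ∑ (upTo (suc r)) (λ j → ∑ (upTo m) (λ s → f (j * m + s))) ∎
    where open ≡-Reasoning

  m*n≤o⇒m≤o/n : ∀ {m n o} .{{_ : NonZero n}} → m * n ≤ o → m ≤ o / n
  m*n≤o⇒m≤o/n {m} {n} {o} h = ≤-trans (≤-reflexive (sym (m*n/n≡m m n))) (/-monoˡ-≤ n h)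

  -- Dyadic decomposition: each block 2^j ≤ i + 1 < 2^(j+1) contributes at most W.
  harmonic-≤ : ∀ L n W → n < 2 ^ L → ∑ (upTo n) (λ i → W / suc i) ≤ L * W
  harmonic-≤ zero    zero    W h = z≤n
  harmonic-≤ zero    (suc n) W (s≤s ())
  harmonic-≤ (suc L) n W h with n <? 2 ^ L
  ... | yes n<2^L = ≤-trans (harmonic-≤ L n W n<2^L) (m≤n+m _ W)
  ... | no  n≮2^L with m≤n⇒∃[o]m+o≡n {suc (pred (2 ^ L))} {suc n} (≤-trans (≤-reflexive (suc-pred (2 ^ L) {{m^n≢0 2 L}})) (≤-trans (≮⇒≥ n≮2^L) (n≤1+n n)))
  ...   | m , refl = begin
    ∑ (upTo (h₀ + m)) (λ i → W / suc i)                                     ≡⟨ ∑-upTo-+ h₀ m _ ⟩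
    ∑ (upTo h₀) (λ i → W / suc i) + ∑ (upTo m) (λ i → W / suc (h₀ + i))     ≤⟨ +-mono-≤ (harmonic-≤ L h₀ W (≤-reflexive 1+h₀)) (∑-≤const (upTo m) (W / suc h₀) (λ _ → /-monoʳ-≤ W (s≤s (m≤m+n h₀ _)))) ⟩
    L * W + length (upTo m) * (W / suc h₀)                                  ≤⟨ +-monoʳ-≤ (L * W) (*-monoˡ-≤ (W / suc h₀) (≤-trans (≤-reflexive (length-upTo m)) m≤)) ⟩
    L * W + suc h₀ * (W / suc h₀)                                           ≤⟨ +-monoʳ-≤ (L * W) (≤-trans (≤-reflexive (*-comm (suc h₀) _)) (m/n*n≤m W (suc h₀))) ⟩
    L * W + W                                                               ≡⟨ +-comm (L * W) W ⟩
    W + L * W                                                               ∎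
    where
    open ≤-Reasoning
    h₀ = pred (2 ^ L)
    1+h₀ : suc h₀ ≡ 2 ^ L
    1+h₀ = suc-pred (2 ^ L) {{m^n≢0 2 L}}
    m≤ : m ≤ suc h₀
    m≤ = +-cancelˡ-≤ (suc h₀) m (suc h₀) (≤-trans h (≤-reflexive (trans (cong (2 ^ L +_) (+-identityʳ (2 ^ L))) (cong₂ _+_ (sym 1+h₀) (sym 1+h₀)))))

  -- A view of a pair of numbers through a common factor: matching on it replaces the pair by
  -- coprime cofactors times c and leaves no quotients in the goals.
  data CoprimeParts (c : ℕ) : ℕ → ℕ → Set where
    parts : ∀ α α′ → Coprime α α′ → CoprimeParts c (α * c) (α′ * c)

  coprimeParts : ∀ m n .{{_ : NonZero m}} → ∃ λ c → CoprimeParts c m n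
  coprimeParts m n = gcd m n , subst₂ (CoprimeParts (gcd m n)) (m/n*n≡m (gcd[m,n]∣m m n)) (m/n*n≡m (gcd[m,n]∣n m n))
                                 (parts (m / gcd m n) (n / gcd m n) (coprime-/gcd m n))
    where instance
      gnz : NonZero (gcd m n)
      gnz = ≢-nonZero (gcd[m,n]≢0 m n (inj₁ (≢-nonZero⁻¹ m)))

  crossEqual : ℕ → ℕ → ℕ → ℕ
  crossEqual M u u′ = ∑ (upTo M) (λ δ → ∑ (upTo M) (λ δ′ → 𝟙 (δ * u′ ≟ δ′ * u)))

  -- With u = α c and u′ = α′ c in lowest terms the solutions are δ = j α, δ′ = j α′. They are
  -- counted by j = δ / α, which is at most M / α ≤ M c / U.
  crossEqual-≤ : ∀ M U u u′ .{{_ : NonZero U}} → U ≤ u → U ≤ u′ →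
                 ∃ λ c → c ∣ u × c ∣ u′ × crossEqual M u u′ ≤ 1 + M * c / U
  crossEqual-≤ M U u u′ U≤u U≤u′ with coprimeParts u u′ {{>-nonZero (<-≤-trans (>-nonZero⁻¹ U) U≤u)}}
  ... | c , parts α α′ coprime = c , divides-refl α , divides-refl α′ , (begin
    crossEqual M u u′                                               ≡⟨ sym (∑-× (upTo M) (upTo M) _) ⟩
    ∑ (cartesianProduct (upTo M) (upTo M)) (λ (δ , δ′) → 𝟙 (δ * u′ ≟ δ′ * u))
        ≤⟨ ∑-inj _ (upTo (1 + M * c / U)) {h = λ _ → 1} (λ (δ , δ′) → δ / α) (cartesianProduct⁺ (upTo⁺ M) (upTo⁺ M)) mem inj ⟩
    ∑ (upTo (1 + M * c / U)) (λ _ → 1)                              ≡⟨ ∑-1-upTo (1 + M * c / U) ⟩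
    1 + M * c / U                                                   ∎)
    where
    open ≤-Reasoning
    0<αc : 0 < α * c
    0<αc = <-≤-trans (>-nonZero⁻¹ U) U≤u
    instance
      αnz : NonZero α
      αnz = m*n≢0⇒m≢0 α {{>-nonZero 0<αc}}
      cnz : NonZero c
      cnz = m*n≢0⇒n≢0 α {{>-nonZero 0<αc}}
      αcnz : NonZero (α * c)
      αcnz = >-nonZero 0<αc
    α∣ : ∀ {δ δ′} → δ * (α′ * c) ≡ δ′ * (α * c) → α ∣ δ
    α∣ {δ} {δ′} h = coprime-divisor coprime (divides δ′ (*-cancelʳ-≡ (α′ * δ) (δ′ * α) c
      (trans (e₁ α′ δ c) (trans h (e₂ δ′ α c)))))
      where e₁ : ∀ α′ δ c → α′ * δ * c ≡ δ * (α′ * c)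
            e₁ = solve-∀
            e₂ : ∀ δ′ α c → δ′ * (α * c) ≡ δ′ * α * c
            e₂ = solve-∀
    mem : ∀ {x} → x ∈ cartesianProduct (upTo M) (upTo M) → 0 < 𝟙 (proj₁ x * (α′ * c) ≟ proj₂ x * (α * c)) →
          proj₁ x / α ∈ upTo (1 + M * c / U) × 𝟙 (proj₁ x * (α′ * c) ≟ proj₂ x * (α * c)) ≤ 1
    mem {δ , δ′} i q with ∈-cartesianProduct⁻ (upTo M) (upTo M) i
    ... | δ∈ , _ = ∈-upTo⁺ (s≤s (m*n≤o⇒m≤o/n (begin
        δ / α * U          ≤⟨ *-monoʳ-≤ (δ / α) U≤u ⟩
        δ / α * (α * c)    ≡⟨ *-assoc (δ / α) α c ⟨
        δ / α * α * c      ≤⟨ *-monoˡ-≤ c (m/n*n≤m δ α) ⟩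
        δ * c              ≤⟨ *-monoˡ-≤ c (<⇒≤ (∈-upTo⁻ δ∈)) ⟩
        M * c              ∎))) , 𝟙-≤1 (δ * (α′ * c) ≟ δ′ * (α * c))
    inj : ∀ {x x′} → x ∈ cartesianProduct (upTo M) (upTo M) → x′ ∈ cartesianProduct (upTo M) (upTo M) →
          0 < 𝟙 (proj₁ x * (α′ * c) ≟ proj₂ x * (α * c)) → 0 < 𝟙 (proj₁ x′ * (α′ * c) ≟ proj₂ x′ * (α * c)) →
          proj₁ x / α ≡ proj₁ x′ / α → x ≡ x′
    inj {δ , δ′} {η , η′} _ _ q q′ e = cong₂ _,_ δ≡η (*-cancelʳ-≡ δ′ η′ (α * c) (trans (sym eδ) (trans (cong (_* (α′ * c)) δ≡η) eη)))
      where
      eδ : δ * (α′ * c) ≡ δ′ * (α * c)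
      eδ = 𝟙-pos (δ * (α′ * c) ≟ δ′ * (α * c)) q
      eη : η * (α′ * c) ≡ η′ * (α * c)
      eη = 𝟙-pos (η * (α′ * c) ≟ η′ * (α * c)) q′
      δ≡η : δ ≡ η
      δ≡η = trans (sym (m/n*n≡m (α∣ {δ} {δ′} eδ))) (trans (cong (_* α) e) (m/n*n≡m (α∣ {η} {η′} eη)))

  multiples-≤ : ∀ U c .{{_ : NonZero c}} .{{_ : NonZero U}} → ∑ (range U U) (λ u → 𝟙 (c ∣? u)) ≤ (U + U) / c
  multiples-≤ U c = ≤-trans
    (∑-inj (range U U) (range 1 ((U + U) / c)) {h = λ _ → 1} (_/ c) (range-unique U U) mem inj)
    (≤-reflexive (∑-1-range 1 ((U + U) / c)))
    where
    mem : ∀ {u} → u ∈ range U U → 0 < 𝟙 (c ∣? u) → u / c ∈ range 1 ((U + U) / c) × 𝟙 (c ∣? u) ≤ 1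
    mem {u} i q with ∈-range⁻ i
    ... | U≤u , u<2U = ∈-range⁺ (m*n≤o⇒m≤o/n (≤-trans (≤-reflexive (*-identityˡ c)) (∣⇒≤ {{>-nonZero (<-≤-trans (>-nonZero⁻¹ U) U≤u)}} (𝟙-pos (c ∣? u) q))))
                                (s≤s (/-monoˡ-≤ c (<⇒≤ u<2U))) , 𝟙-≤1 (c ∣? u)
    inj : ∀ {u v} → u ∈ range U U → v ∈ range U U → 0 < 𝟙 (c ∣? u) → 0 < 𝟙 (c ∣? v) → u / c ≡ v / c → u ≡ v
    inj {u} {v} _ _ q q′ e = trans (sym (m/n*n≡m (𝟙-pos (c ∣? u) q))) (trans (cong (_* c) e) (m/n*n≡m (𝟙-pos (c ∣? v) q′)))

  -- The terms 1 of `crossEqual-≤` give U². In the other term the common divisor c is replaced by a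
  -- sum over all c ≤ 2 U: at most (2 U / c)² pairs are divisible by c and each costs M c / U, which
  -- makes 4 U M / c. The harmonic sum over c then brings in the factor L.
  crossEqual-sum : ∀ M U L .{{_ : NonZero U}} → U + U < 2 ^ L →
    ∑ (range U U) (λ u → ∑ (range U U) (crossEqual M u)) ≤ U * U + 4 * (U * M * L)
  crossEqual-sum M U L 2U<2^L = begin
    ∑ R (λ u → ∑ R (crossEqual M u))
      ≤⟨ ∑-mono∈ R (λ i → ∑-mono∈ R (λ j → cell i j)) ⟩
    ∑ R (λ u → ∑ R (λ u′ → 1 + ∑ D (λ i → w u i * w u′ i * (M * suc i / U))))
      ≡⟨ ∑-cong R (λ u → trans (∑-+ R _ _) (cong₂ _+_ (trans (∑-1 R) (length-range U U)) (∑-swap R D _))) ⟩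
    ∑ R (λ u → U + ∑ D (λ i → ∑ R (λ u′ → w u i * w u′ i * (M * suc i / U))))
      ≡⟨ trans (∑-+ R _ _) (cong₂ _+_ (trans (∑-const R U) (cong (_* U) (length-range U U))) (∑-swap R D _)) ⟩
    U * U + ∑ D (λ i → ∑ R (λ u → ∑ R (λ u′ → w u i * w u′ i * (M * suc i / U))))
      ≡⟨ cong (U * U +_) (∑-cong D factor) ⟩
    U * U + ∑ D (λ i → ∑ R (λ u → w u i) * ∑ R (λ u → w u i) * (M * suc i / U))
      ≤⟨ +-monoʳ-≤ (U * U) (∑-mono D bound) ⟩
    U * U + ∑ D (λ i → (M + M) * ((U + U) / suc i))
      ≡⟨ cong (U * U +_) (∑-*ˡ D (M + M) _) ⟩
    U * U + (M + M) * ∑ D (λ i → (U + U) / suc i)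
      ≤⟨ +-monoʳ-≤ (U * U) (*-monoʳ-≤ (M + M) (harmonic-≤ L (U + U) (U + U) 2U<2^L)) ⟩
    U * U + (M + M) * (L * (U + U))
      ≡⟨ cong (U * U +_) (e M L U) ⟩
    U * U + 4 * (U * M * L) ∎
    where
    open ≤-Reasoning
    R = range U U
    D = upTo (U + U)
    w : ℕ → ℕ → ℕ
    w u i = 𝟙 (suc i ∣? u)
    e : ∀ M L U → (M + M) * (L * (U + U)) ≡ 4 * (U * M * L)
    e = solve-∀
    cell : ∀ {u u′} → u ∈ R → u′ ∈ R → crossEqual M u u′ ≤ 1 + ∑ D (λ i → w u i * w u′ i * (M * suc i / U))
    cell {u} {u′} i j with ∈-range⁻ i | ∈-range⁻ j
    ... | U≤u , u<2U | U≤u′ , _ with crossEqual-≤ M U u u′ U≤u U≤u′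
    ...   | zero  , c∣u , _    , _  = ⊥-elim (<⇒≱ (<-≤-trans (>-nonZero⁻¹ U) U≤u) (≤-reflexive (0∣⇒≡0 c∣u)))
    ...   | suc c , c∣u , c∣u′ , le = ≤-trans le (s≤s (≤-trans (≤-reflexive (sym
              (trans (cong₂ (λ a b → a * b * (M * suc c / U)) (𝟙-yes (suc c ∣? u) c∣u) (𝟙-yes (suc c ∣? u′) c∣u′)) (*-identityˡ _))))
              (∑-term D (λ i → w u i * w u′ i * (M * suc i / U)) (∈-upTo⁺ (≤-<-trans (n≤1+n c) (≤-<-trans (∣⇒≤ {{>-nonZero (<-≤-trans (>-nonZero⁻¹ U) U≤u)}} c∣u) u<2U))))))
    factor : ∀ i → ∑ R (λ u → ∑ R (λ u′ → w u i * w u′ i * (M * suc i / U))) ≡ ∑ R (λ u → w u i) * ∑ R (λ u → w u i) * (M * suc i / U)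
    factor i = trans (∑-cong R (λ u → trans (∑-*ʳ R _ _) (cong (_* (M * suc i / U)) (∑-*ˡ R (w u i) _))))
               (trans (∑-*ʳ R _ _) (cong (_* (M * suc i / U)) (∑-*ʳ R _ _)))
    bound : ∀ i → ∑ R (λ u → w u i) * ∑ R (λ u → w u i) * (M * suc i / U) ≤ (M + M) * ((U + U) / suc i)
    bound i = begin
      S * S * B         ≤⟨ *-monoˡ-≤ B (*-mono-≤ S≤A S≤A) ⟩
      A * A * B         ≡⟨ e₁ A B ⟩
      B * A * A         ≤⟨ *-monoˡ-≤ A BA≤2M ⟩
      (M + M) * A       ∎
      where
      S = ∑ R (λ u → w u i)
      A = (U + U) / suc i
      B = M * suc i / U
      S≤A : S ≤ A
      S≤A = multiples-≤ U (suc i)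
      e₁ : ∀ A B → A * A * B ≡ B * A * A
      e₁ = solve-∀
      BA≤2M : B * A ≤ M + M
      BA≤2M = *-cancelʳ-≤ (B * A) (M + M) (U * suc i) {{m*n≢0 U (suc i)}} (begin
        B * A * (U * suc i)           ≡⟨ e₂ B A U (suc i) ⟩
        B * U * (A * suc i)           ≤⟨ *-mono-≤ (m/n*n≤m (M * suc i) U) (m/n*n≤m (U + U) (suc i)) ⟩
        M * suc i * (U + U)           ≡⟨ e₃ M (suc i) U ⟩
        (M + M) * (U * suc i)         ∎)
        where
        e₂ : ∀ B A U c → B * A * (U * c) ≡ B * U * (A * c)
        e₂ = solve-∀
        e₃ : ∀ M c U → M * c * (U + U) ≡ (M + M) * (U * c)
        e₃ = solve-∀

-- Energy of the ratios y / u modulo p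

module RatioEnergy where
  open Summation
  open Congruence
  open CrossRatios
  open import Data.Integer using (ℤ; +_; _+_; _*_; _-_; -_) renaming (∣_∣ to abs)
  open import Data.Integer.Properties using (pos-+; pos-*)
  open import Data.Integer.Tactic.RingSolver using (solve-∀)
  open import Data.Nat using (ℕ; NonZero; z≤n; _∸_; _^_; _≤?_; _≟_; _≤_; _<_; >-nonZero; >-nonZero⁻¹)
  open import Data.Nat.Properties

  minus-cancelʳ : ∀ o a b → a - o ≡ b - o → a ≡ b
  minus-cancelʳ o a b h = trans (e a o) (trans (cong (_+ o) h) (sym (e b o)))
    where e : ∀ a o → a ≡ a - o + o
          e = solve-∀

  absdiff-≤ : ∀ {a b} → a ≤ b → abs (+ a - + b) ≡ b ∸ a
  absdiff-≤ {a} {b} a≤b = trans (cong abs (ℤ.m-n≡m⊖n a b)) (ℤ.∣⊖∣-≤ a≤b)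

  absdiff-≥ : ∀ {a b} → b ≤ a → abs (+ a - + b) ≡ a ∸ b
  absdiff-≥ {a} {b} b≤a = trans (ℤ.∣i-j∣≡∣j-i∣ (+ a) (+ b)) (absdiff-≤ b≤a)

  absdiff-< : ∀ {a b M} → a < M → b < M → abs (+ a - + b) < M
  absdiff-< {a} {b} a<M b<M with ≤-total a b
  ... | inj₁ a≤b = subst (_< _) (sym (absdiff-≤ a≤b)) (≤-<-trans (m∸n≤m b a) b<M)
  ... | inj₂ b≤a = subst (_< _) (sym (absdiff-≥ b≤a)) (≤-<-trans (m∸n≤m a b) a<M)

  absdiff-injective : ∀ {a b o} → does (o ≤? a) ≡ does (o ≤? b) → abs (+ a - + o) ≡ abs (+ b - + o) → a ≡ b
  absdiff-injective {a} {b} {o} = cases (o ≤? a) (o ≤? b)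
    where
    cases : (d : Dec (o ≤ a)) (e : Dec (o ≤ b)) → does d ≡ does e → abs (+ a - + o) ≡ abs (+ b - + o) → a ≡ b
    cases (yes o≤a) (yes o≤b) _ h = ∸-cancelʳ-≡ o≤a o≤b (trans (sym (absdiff-≥ o≤a)) (trans h (absdiff-≥ o≤b)))
    cases (no  o≰a) (no  o≰b) _ h = ∸-cancelˡ-≡ (≰⇒≥ o≰a) (≰⇒≥ o≰b) (trans (sym (absdiff-≤ (≰⇒≥ o≰a))) (trans h (absdiff-≤ (≰⇒≥ o≰b))))

  module Energy (p : ℕ) .{{_ : NonZero p}} (prime : Prime p) where
    open Residues p prime

    sameRatio : (y u y′ u′ : ℕ) → Dec (+ (y ℕ.* u′) ≈ + (y′ ℕ.* u))
    sameRatio y u y′ u′ = + (y ℕ.* u′) ≈? + (y′ ℕ.* u)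

    -- Two solutions (t , t′) of (b + t) u′ ≡ (b′ + t′) u differ by a pair (δ , δ′) with δ u′ ≡ δ′ u
    -- mod p, hence, by size, with δ u′ = δ′ u.
    piece-≤ : ∀ b b′ M U u u′ → 4 ℕ.* (U ℕ.* M) ≤ p → u < U ℕ.+ U → u′ < U ℕ.+ U → 1 ≤ u →
              ∑ (upTo M) (λ t → ∑ (upTo M) (λ t′ → 𝟙 (sameRatio (b ℕ.+ t) u (b′ ℕ.+ t′) u′))) ≤ 2 ℕ.* crossEqual M u u′
    piece-≤ b b′ M U u u′ 4UM≤p u< u′< 1≤u with 1 ≤? ∑ (upTo M) (λ t → ∑ (upTo M) (λ t′ → 𝟙 (sameRatio (b ℕ.+ t) u (b′ ℕ.+ t′) u′)))
    ... | no  q = subst (_≤ _) (sym (n<1⇒n≡0 (≰⇒> q))) z≤n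
    ... | yes q with ∑-pos (upTo M) _ q
    ...   | t₀ , t₀∈ , q₁ with ∑-pos (upTo M) _ q₁
    ...     | t₀′ , t₀′∈ , q₂ = begin
      ∑ (upTo M) (λ t → ∑ (upTo M) (λ t′ → 𝟙 (sol t t′)))                    ≡⟨ ∑-× (upTo M) (upTo M) _ ⟨
      ∑ pairs (λ (t , t′) → 𝟙 (sol t t′))
        ≤⟨ ∑-inj pairs (cartesianProduct bools pairs) {h = λ (_ , δ , δ′) → 𝟙 (δ ℕ.* u′ ≟ δ′ ℕ.* u)} g (cartesianProduct⁺ (upTo⁺ M) (upTo⁺ M)) mem inj ⟩
      ∑ (cartesianProduct bools pairs) (λ (_ , δ , δ′) → 𝟙 (δ ℕ.* u′ ≟ δ′ ℕ.* u)) ≡⟨ ∑-× bools pairs _ ⟩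
      ∑ bools (λ _ → ∑ pairs (λ (δ , δ′) → 𝟙 (δ ℕ.* u′ ≟ δ′ ℕ.* u)))          ≡⟨ ∑-const bools (∑ pairs (λ (δ , δ′) → 𝟙 (δ ℕ.* u′ ≟ δ′ ℕ.* u))) ⟩
      2 ℕ.* ∑ pairs (λ (δ , δ′) → 𝟙 (δ ℕ.* u′ ≟ δ′ ℕ.* u))                    ≡⟨ cong (2 ℕ.*_) (∑-× (upTo M) (upTo M) _) ⟩
      2 ℕ.* crossEqual M u u′                                                 ∎
      where
      open ≤-Reasoning
      pairs = cartesianProduct (upTo M) (upTo M)
      bools = true ∷ false ∷ []
      sol : (t t′ : ℕ) → Dec _
      sol t t′ = sameRatio (b ℕ.+ t) u (b′ ℕ.+ t′) u′
      -- The bit is the sign of t - t₀ lost in the absolute value, and the source of the factor 2.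
      -- No second bit is needed: once t is known, the exact equation determines t′.
      g : ℕ × ℕ → Bool × ℕ × ℕ
      g (t , t′) = does (t₀ ≤? t) , abs (+ t - + t₀) , abs (+ t′ - + t₀′)
      cast : ∀ b t u → + ((b ℕ.+ t) ℕ.* u) ≡ (+ b + + t) * + u
      cast b t u = trans (pos-* (b ℕ.+ t) u) (cong (_* + u) (pos-+ b t))
      exact : ∀ {t t′} → t ∈ upTo M → t′ ∈ upTo M → 0 < 𝟙 (sol t t′) → (+ t - + t₀) * + u′ ≡ (+ t′ - + t₀′) * + u
      exact {t} {t′} i j s = ℤ.i-j≡0⇒i≡j _ _ (∣∧<⇒≡0 (∣-lin₂ (+ 1) (- + 1) (≈⁻ (𝟙-pos (sol t t′) s)) (≈⁻ (𝟙-pos (sol t₀ t₀′) q₂)) eq) small)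
        where
        e : ∀ b b′ t t′ t₀ t₀′ u u′ → (t - t₀) * u′ - (t′ - t₀′) * u ≡
            + 1 * ((b + t) * u′ - (b′ + t′) * u) + - + 1 * ((b + t₀) * u′ - (b′ + t₀′) * u)
        e = solve-∀
        eq : _
        eq = trans (e (+ b) (+ b′) (+ t) (+ t′) (+ t₀) (+ t₀′) (+ u) (+ u′))
               (cong₂ (λ v w → + 1 * v + - + 1 * w) (cong₂ _-_ (sym (cast b t u′)) (sym (cast b′ t′ u)))
                                                     (cong₂ _-_ (sym (cast b t₀ u′)) (sym (cast b′ t₀′ u))))
        small : abs ((+ t - + t₀) * + u′ - (+ t′ - + t₀′) * + u) < p
        small = begin-strict
          abs ((+ t - + t₀) * + u′ - (+ t′ - + t₀′) * + u)            ≤⟨ ℤ.∣i-j∣≤∣i∣+∣j∣ ((+ t - + t₀) * + u′) ((+ t′ - + t₀′) * + u) ⟩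
          abs ((+ t - + t₀) * + u′) ℕ.+ abs ((+ t′ - + t₀′) * + u)    ≡⟨ cong₂ ℕ._+_ (ℤ.abs-* (+ t - + t₀) (+ u′)) (ℤ.abs-* (+ t′ - + t₀′) (+ u)) ⟩
          abs (+ t - + t₀) ℕ.* u′ ℕ.+ abs (+ t′ - + t₀′) ℕ.* u        ≤⟨ +-mono-≤ (*-monoˡ-≤ u′ (<⇒≤ (absdiff-< (∈-upTo⁻ i) (∈-upTo⁻ t₀∈)))) (*-monoˡ-≤ u (<⇒≤ (absdiff-< (∈-upTo⁻ j) (∈-upTo⁻ t₀′∈)))) ⟩
          M ℕ.* u′ ℕ.+ M ℕ.* u                                        <⟨ +-mono-< (*-monoʳ-< M {{>-nonZero M>0}} u′<) (*-monoʳ-< M {{>-nonZero M>0}} u<) ⟩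
          M ℕ.* (U ℕ.+ U) ℕ.+ M ℕ.* (U ℕ.+ U)                         ≡⟨ e₄ M U ⟩
          4 ℕ.* (U ℕ.* M)                                             ≤⟨ 4UM≤p ⟩
          p                                                           ∎
          where
          M>0 : 0 < M
          M>0 = ≤-<-trans z≤n (∈-upTo⁻ i)
          e₄ : ∀ M U → M ℕ.* (U ℕ.+ U) ℕ.+ M ℕ.* (U ℕ.+ U) ≡ 4 ℕ.* (U ℕ.* M)
          e₄ = ℕ-Solver.solve-∀
      mem : ∀ {x} → x ∈ pairs → 0 < 𝟙 (sol (proj₁ x) (proj₂ x)) → g x ∈ cartesianProduct bools pairs ×
            𝟙 (sol (proj₁ x) (proj₂ x)) ≤ 𝟙 (abs (+ proj₁ x - + t₀) ℕ.* u′ ≟ abs (+ proj₂ x - + t₀′) ℕ.* u)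
      mem {t , t′} k s with ∈-cartesianProduct⁻ (upTo M) (upTo M) k
      ... | i , j = ∈-cartesianProduct⁺ (bool∈ _) (∈-cartesianProduct⁺ (∈-upTo⁺ (absdiff-< (∈-upTo⁻ i) (∈-upTo⁻ t₀∈))) (∈-upTo⁺ (absdiff-< (∈-upTo⁻ j) (∈-upTo⁻ t₀′∈)))) ,
                    ≤-trans (𝟙-≤1 (sol t t′)) (≤-reflexive (sym (𝟙-yes (_ ≟ _)
                      (trans (sym (ℤ.abs-* (+ t - + t₀) (+ u′))) (trans (cong abs (exact i j s)) (ℤ.abs-* (+ t′ - + t₀′) (+ u)))))))
        where
        bool∈ : ∀ x → x ∈ bools
        bool∈ true  = here refl
        bool∈ false = there (here refl)
      inj : ∀ {x x′} → x ∈ pairs → x′ ∈ pairs → 0 < 𝟙 (sol (proj₁ x) (proj₂ x)) → 0 < 𝟙 (sol (proj₁ x′) (proj₂ x′)) → g x ≡ g x′ → x ≡ x′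
      inj {t , t′} {s , s′} k k′ r r′ eq with ∈-cartesianProduct⁻ (upTo M) (upTo M) k | ∈-cartesianProduct⁻ (upTo M) (upTo M) k′
      ... | i , j | i′ , j′ = cong₂ _,_ t≡s (ℤ.+-injective (minus-cancelʳ (+ t₀′) (+ t′) (+ s′)
            (ℤ.*-cancelʳ-≡ (+ t′ - + t₀′) (+ s′ - + t₀′) (+ u) {{>-nonZero 1≤u}}
              (trans (sym (exact i j r)) (trans (cong (λ v → (+ v - + t₀) * + u′) t≡s) (exact i′ j′ r′))))))
        where
        t≡s : t ≡ s
        t≡s = absdiff-injective {t} {s} {t₀} (cong proj₁ eq) (cong (λ v → proj₁ (proj₂ v)) eq)

    -- The interval of length r M is cut into r blocks of length M, each short enough for `piece-≤`;
    -- every one of the r² pairs of blocks costs at most twice `crossEqual`.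
    energy-≤ : ∀ b M U r L .{{_ : NonZero U}} → 4 ℕ.* (U ℕ.* M) ≤ p → U ℕ.+ U < 2 ^ L →
      ∑ (cartesianProduct (range U U) (upTo (r ℕ.* M))) (λ (u , t) → ∑ (cartesianProduct (range U U) (upTo (r ℕ.* M))) (λ (u′ , t′) →
        𝟙 (sameRatio (b ℕ.+ t) u (b ℕ.+ t′) u′)))
      ≤ r ℕ.* r ℕ.* (2 ℕ.* (U ℕ.* U ℕ.+ 4 ℕ.* (U ℕ.* M ℕ.* L)))
    energy-≤ b M U r L 4UM≤p 2U<2^L = begin
      ∑ (cartesianProduct R T) (λ (u , t) → ∑ (cartesianProduct R T) (λ (u′ , t′) → e u t u′ t′))
        ≡⟨ ∑-× R T _ ⟩
      ∑ R (λ u → ∑ T (λ t → ∑ (cartesianProduct R T) (λ (u′ , t′) → e u t u′ t′)))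
        ≡⟨ ∑-cong R (λ u → trans (∑-cong T (λ t → ∑-× R T _)) (∑-swap T R _)) ⟩
      ∑ R (λ u → ∑ R (λ u′ → ∑ T (λ t → ∑ T (λ t′ → e u t u′ t′))))
        ≤⟨ ∑-mono∈ R (λ i → ∑-mono∈ R (λ j → cell i j)) ⟩
      ∑ R (λ u → ∑ R (λ u′ → r ℕ.* r ℕ.* 2 ℕ.* crossEqual M u u′))
        ≡⟨ trans (∑-cong R (λ u → ∑-*ˡ R (r ℕ.* r ℕ.* 2) (crossEqual M u))) (∑-*ˡ R (r ℕ.* r ℕ.* 2) _) ⟩
      r ℕ.* r ℕ.* 2 ℕ.* ∑ R (λ u → ∑ R (crossEqual M u))
        ≤⟨ *-monoʳ-≤ (r ℕ.* r ℕ.* 2) (crossEqual-sum M U L 2U<2^L) ⟩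
      r ℕ.* r ℕ.* 2 ℕ.* (U ℕ.* U ℕ.+ 4 ℕ.* (U ℕ.* M ℕ.* L))
        ≡⟨ *-assoc (r ℕ.* r) 2 _ ⟩
      r ℕ.* r ℕ.* (2 ℕ.* (U ℕ.* U ℕ.+ 4 ℕ.* (U ℕ.* M ℕ.* L))) ∎
      where
      open ≤-Reasoning
      R = range U U
      T = upTo (r ℕ.* M)
      e : ℕ → ℕ → ℕ → ℕ → ℕ
      e u t u′ t′ = 𝟙 (sameRatio (b ℕ.+ t) u (b ℕ.+ t′) u′)
      cell : ∀ {u u′} → u ∈ R → u′ ∈ R → ∑ T (λ t → ∑ T (λ t′ → e u t u′ t′)) ≤ r ℕ.* r ℕ.* 2 ℕ.* crossEqual M u u′
      cell {u} {u′} i j with ∈-range⁻ i | ∈-range⁻ j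
      ... | U≤u , u<2U | _ , u′<2U = begin
        ∑ T (λ t → ∑ T (λ t′ → e u t u′ t′))
          ≡⟨ trans (∑-upTo-* r M _) (∑-cong (upTo r) (λ k → trans (∑-cong (upTo M) (λ s → ∑-upTo-* r M _)) (∑-swap (upTo M) (upTo r) _))) ⟩
        ∑ (upTo r) (λ k → ∑ (upTo r) (λ k′ → ∑ (upTo M) (λ s → ∑ (upTo M) (λ s′ → e u (k ℕ.* M ℕ.+ s) u′ (k′ ℕ.* M ℕ.+ s′)))))
          ≤⟨ ∑-mono (upTo r) (λ k → ∑-mono (upTo r) (λ k′ → block k k′)) ⟩
        ∑ (upTo r) (λ k → ∑ (upTo r) (λ k′ → 2 ℕ.* crossEqual M u u′))
          ≡⟨ trans (∑-cong (upTo r) (λ _ → ∑-const-upTo r _)) (∑-const-upTo r _) ⟩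
        r ℕ.* (r ℕ.* (2 ℕ.* crossEqual M u u′))
          ≡⟨ a r (crossEqual M u u′) ⟩
        r ℕ.* r ℕ.* 2 ℕ.* crossEqual M u u′ ∎
        where
        ∑-const-upTo : ∀ r c → ∑ (upTo r) (λ _ → c) ≡ r ℕ.* c
        ∑-const-upTo r c = trans (∑-const (upTo r) c) (cong (ℕ._* c) (length-upTo r))
        a : ∀ r c → r ℕ.* (r ℕ.* (2 ℕ.* c)) ≡ r ℕ.* r ℕ.* 2 ℕ.* c
        a = ℕ-Solver.solve-∀
        block : ∀ k k′ → ∑ (upTo M) (λ s → ∑ (upTo M) (λ s′ → e u (k ℕ.* M ℕ.+ s) u′ (k′ ℕ.* M ℕ.+ s′))) ≤ 2 ℕ.* crossEqual M u u′
        block k k′ = ≤-trans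
          (≤-reflexive (∑-cong (upTo M) (λ s → ∑-cong (upTo M) (λ s′ →
            cong₂ (λ v w → 𝟙 (sameRatio v u w u′)) (sym (+-assoc b (k ℕ.* M) s)) (sym (+-assoc b (k′ ℕ.* M) s′))))))
          (piece-≤ (b ℕ.+ k ℕ.* M) (b ℕ.+ k′ ℕ.* M) M U u u′ 4UM≤p u<2U u′<2U (≤-trans (>-nonZero⁻¹ U) U≤u))

-- Popular values of a map

module Popularity where
  open Summation
  open import Data.Nat
  open import Data.Nat.Properties
  open import Data.Nat.Tactic.RingSolver using (solve-∀)

  ∑-single : {A : Set} (_≟′_ : DecidableEquality A) (xs : List A) (r : A) → Unique xs → ∑ xs (λ x → 𝟙 (x ≟′ r)) ≤ 1
  ∑-single _≟′_ xs r u = ∑-inj xs (tt ∷ []) {h = λ _ → 1} (λ _ → tt) u (λ {x} _ _ → here refl , 𝟙-≤1 (x ≟′ r))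
    (λ {x} {y} _ _ p q _ → trans (𝟙-pos (x ≟′ r) p) (sym (𝟙-pos (y ≟′ r) q)))

  module Fibres {A : Set} (xs : List A) (key : A → ℕ) (p : ℕ) (key<p : ∀ x → key x < p) where

    fibre : ℕ → ℕ
    fibre ξ = ∑ xs (λ x → 𝟙 (key x ≟ ξ))

    collisions : ℕ
    collisions = ∑ xs (λ x → ∑ xs (λ y → 𝟙 (key x ≟ key y)))

    ∑-fibre : length xs ≤ ∑ (upTo p) fibre
    ∑-fibre = begin
      length xs                                        ≡⟨ ∑-1 xs ⟨
      ∑ xs (λ _ → 1)                                   ≤⟨ ∑-mono xs (λ x → ≤-trans (≤-reflexive (sym (𝟙-yes (key x ≟ key x) refl))) (∑-term (upTo p) (λ ξ → 𝟙 (key x ≟ ξ)) (∈-upTo⁺ (key<p x)))) ⟩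
      ∑ xs (λ x → ∑ (upTo p) (λ ξ → 𝟙 (key x ≟ ξ)))    ≡⟨ ∑-swap xs (upTo p) _ ⟩
      ∑ (upTo p) fibre                                 ∎
      where open ≤-Reasoning

    ∑-fibre² : ∑ (upTo p) (λ ξ → fibre ξ * fibre ξ) ≤ collisions
    ∑-fibre² = begin
      ∑ (upTo p) (λ ξ → fibre ξ * fibre ξ)
        ≡⟨ ∑-cong (upTo p) (λ ξ → trans (sym (∑-*ʳ xs (fibre ξ) _)) (∑-cong xs (λ x → sym (∑-*ˡ xs (𝟙 (key x ≟ ξ)) _)))) ⟩
      ∑ (upTo p) (λ ξ → ∑ xs (λ x → ∑ xs (λ y → 𝟙 (key x ≟ ξ) * 𝟙 (key y ≟ ξ))))
        ≡⟨ trans (∑-swap (upTo p) xs _) (∑-cong xs (λ x → ∑-swap (upTo p) xs _)) ⟩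
      ∑ xs (λ x → ∑ xs (λ y → ∑ (upTo p) (λ ξ → 𝟙 (key x ≟ ξ) * 𝟙 (key y ≟ ξ))))
        ≤⟨ ∑-mono xs (λ x → ∑-mono xs (λ y → cell x y)) ⟩
      collisions ∎
      where
      open ≤-Reasoning
      cell : ∀ x y → ∑ (upTo p) (λ ξ → 𝟙 (key x ≟ ξ) * 𝟙 (key y ≟ ξ)) ≤ 𝟙 (key x ≟ key y)
      cell x y = ≤-trans (∑-mono (upTo p) (λ ξ → step ξ (key x ≟ ξ) (key y ≟ ξ)))
        (≤-trans (≤-reflexive (∑-*ˡ (upTo p) (𝟙 (key x ≟ key y)) (λ ξ → 𝟙 (ξ ≟ key x))))
        (≤-trans (*-monoʳ-≤ (𝟙 (key x ≟ key y)) (∑-single _≟_ (upTo p) (key x) (upTo⁺ p))) (≤-reflexive (*-identityʳ _))))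
        where
        step : ∀ ξ (d : Dec (key x ≡ ξ)) (e : Dec (key y ≡ ξ)) → 𝟙 d * 𝟙 e ≤ 𝟙 (key x ≟ key y) * 𝟙 (ξ ≟ key x)
        step ξ (no _)  e       = z≤n
        step ξ (yes _) (no _)  = z≤n
        step ξ (yes a) (yes b) = ≤-reflexive (sym (cong₂ _*_ (𝟙-yes (key x ≟ key y) (trans a (sym b))) (𝟙-yes (ξ ≟ key x) (sym a))))

    -- Fibres with at most g elements hold at most p g elements together, half of the list at most.
    -- So the larger fibres hold the other half, and Cauchy-Schwarz over their values bounds the
    -- number of these values from below.
    popular : ∀ g → 2 * (p * g) ≤ length xs →
              length xs * length xs ≤ 4 * (∑ (upTo p) (λ ξ → 𝟙 (suc g ≤? fibre ξ)) * collisions)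
    popular g h = begin
      n * n                       ≤⟨ *-mono-≤ n≤2F n≤2F ⟩
      (2 * F) * (2 * F)           ≡⟨ e F ⟩
      4 * (F * F)                 ≤⟨ *-monoʳ-≤ 4 (cauchy-support (upTo p) f) ⟩
      4 * (∑ (upTo p) (λ ξ → 𝟙 (1 ≤? f ξ)) * ∑ (upTo p) (λ ξ → f ξ * f ξ))
        ≤⟨ *-monoʳ-≤ 4 (*-mono-≤ (∑-mono (upTo p) supp) (≤-trans (∑-mono (upTo p) (λ ξ → *-mono-≤ (f≤ ξ) (f≤ ξ))) ∑-fibre²)) ⟩
      4 * (∑ (upTo p) (λ ξ → 𝟙 (suc g ≤? fibre ξ)) * collisions) ∎
      where
      open ≤-Reasoning
      n = length xs
      f : ℕ → ℕ
      f ξ = 𝟙 (suc g ≤? fibre ξ) * fibre ξ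
      F = ∑ (upTo p) f
      e : ∀ F → (2 * F) * (2 * F) ≡ 4 * (F * F)
      e = solve-∀
      f≤ : ∀ ξ → f ξ ≤ fibre ξ
      f≤ ξ = ≤-trans (*-monoˡ-≤ (fibre ξ) (𝟙-≤1 (suc g ≤? fibre ξ))) (≤-reflexive (*-identityˡ _))
      supp : ∀ ξ → 𝟙 (1 ≤? f ξ) ≤ 𝟙 (suc g ≤? fibre ξ)
      supp ξ = 𝟙-mono (1 ≤? f ξ) (suc g ≤? fibre ξ) (pos (suc g ≤? fibre ξ))
        where pos : ∀ (d : Dec (suc g ≤ fibre ξ)) → 1 ≤ 𝟙 d * fibre ξ → suc g ≤ fibre ξ
              pos (yes q) _ = q
      split : ∀ ξ → fibre ξ ≤ f ξ + g
      split ξ = cases (suc g ≤? fibre ξ)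
        where cases : ∀ (d : Dec (suc g ≤ fibre ξ)) → fibre ξ ≤ 𝟙 d * fibre ξ + g
              cases (yes _) = ≤-trans (≤-reflexive (sym (*-identityˡ _))) (m≤m+n _ g)
              cases (no  q) = s≤s⁻¹ (≰⇒> q)
      n≤F+pg : n ≤ F + p * g
      n≤F+pg = begin
        n                              ≤⟨ ∑-fibre ⟩
        ∑ (upTo p) fibre               ≤⟨ ∑-mono (upTo p) split ⟩
        ∑ (upTo p) (λ ξ → f ξ + g)     ≡⟨ ∑-+ (upTo p) f (λ _ → g) ⟩
        F + ∑ (upTo p) (λ _ → g)       ≡⟨ cong (F +_) (trans (∑-const (upTo p) g) (cong (_* g) (length-upTo p))) ⟩
        F + p * g                      ∎
      n≤2F : n ≤ 2 * F
      n≤2F = +-cancelʳ-≤ n n (2 * F) (begin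
        n + n                          ≤⟨ +-mono-≤ n≤F+pg n≤F+pg ⟩
        F + p * g + (F + p * g)        ≡⟨ e₂ F (p * g) ⟩
        2 * F + 2 * (p * g)            ≤⟨ +-monoʳ-≤ (2 * F) h ⟩
        2 * F + n                      ∎)
        where e₂ : ∀ F q → F + q + (F + q) ≡ 2 * F + 2 * q
              e₂ = solve-∀

-- Coincidences between sums of reciprocals

module ReciprocalSums where
  open Summation
  open Congruence
  open CrossRatios
  open Popularity
  open import Data.Integer using (ℤ; +_; _+_; _*_; _-_; -_; +0)
  open import Data.Integer.Divisibility.Signed
  open import Data.Integer.Properties using (pos-+)
  open import Data.Integer.Tactic.RingSolver using (solve-∀)
  open import Data.Nat using (ℕ; zero; suc; NonZero; z≤n; s≤s; _^_; _≤?_; _≟_; _≤_; _<_)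
  open import Data.Nat.Properties

  -- The coordinates run through consecutive disjoint blocks of length V. Hence different tuples are
  -- never permutations of one another, which would make their sums of reciprocals agree for every
  -- ξ.
  tuples : ℕ → ℕ → ℕ → List (List ℕ)
  tuples V zero    o = [] ∷ []
  tuples V (suc k) o = cartesianProductWith _∷_ (range o V) (tuples V k (o ℕ.+ V))

  data Blocks (V : ℕ) : ℕ → ℕ → List ℕ → Set where
    []  : ∀ {o} → Blocks V zero o []
    _∷_ : ∀ {k o v vs} → o ≤ v × v < o ℕ.+ V → Blocks V k (o ℕ.+ V) vs → Blocks V (suc k) o (v ∷ vs)

  ∈-tuples⁻ : ∀ V k o {vs} → vs ∈ tuples V k o → Blocks V k o vs
  ∈-tuples⁻ V zero    o (here refl) = []
  ∈-tuples⁻ V (suc k) o i with ∈-cartesianProductWith⁻ _∷_ (range o V) (tuples V k (o ℕ.+ V)) i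
  ... | v , vs , v∈ , vs∈ , refl = ∈-range⁻ v∈ ∷ ∈-tuples⁻ V k (o ℕ.+ V) vs∈

  length-tuples : ∀ V k o → length (tuples V k o) ≡ V ^ k
  length-tuples V zero    o = refl
  length-tuples V (suc k) o = trans (length-cartesianProductWith _∷_ (range o V) (tuples V k (o ℕ.+ V)))
    (cong₂ ℕ._*_ (length-range o V) (length-tuples V k (o ℕ.+ V)))

  tuples-unique : ∀ V k o → Unique (tuples V k o)
  tuples-unique V zero    o = [] ∷ []
  tuples-unique V (suc k) o = cartesianProductWith⁺ _∷_ ∷-injective (range-unique o V) (tuples-unique V k (o ℕ.+ V))

  -- Polynomial functions of degree at most d, described by the factor theorem.
  Poly : ℕ → (ℤ → ℤ) → Set
  Poly zero    f = ∀ x y → f x ≡ f y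
  Poly (suc d) f = ∀ r → Σ (ℤ → ℤ) λ g → Poly d g × (∀ x → f x ≡ f r + (x - r) * g x)

  poly-lift : ∀ d {f} → Poly d f → Poly (suc d) f
  poly-lift zero    {f} h r = (λ _ → +0) , (λ _ _ → refl) , λ x → trans (h x r) (e (f r) (x - r))
    where e : ∀ a b → a ≡ a + b * + 0
          e = solve-∀
  poly-lift (suc d) h r with h r
  ... | g , Pg , eq = g , poly-lift d Pg , eq

  poly-+ : ∀ d {f g} → Poly d f → Poly d g → Poly d (λ x → f x + g x)
  poly-+ zero    hf hg x y = cong₂ _+_ (hf x y) (hg x y)
  poly-+ (suc d) {f} {g} hf hg r with hf r | hg r
  ... | f′ , Pf′ , ef | g′ , Pg′ , eg = (λ x → f′ x + g′ x) , poly-+ d Pf′ Pg′ , λ x →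
      trans (cong₂ _+_ (ef x) (eg x)) (e (f r) (g r) (x - r) (f′ x) (g′ x))
    where e : ∀ a b c u v → a + c * u + (b + c * v) ≡ a + b + c * (u + v)
          e = solve-∀

  poly-scale : ∀ d c {f} → Poly d f → Poly d (λ x → c * f x)
  poly-scale zero    c h x y = cong (c *_) (h x y)
  poly-scale (suc d) c {f} h r with h r
  ... | f′ , Pf′ , ef = (λ x → c * f′ x) , poly-scale d c Pf′ , λ x → trans (cong (c *_) (ef x)) (e c (f r) (x - r) (f′ x))
    where e : ∀ c a b u → c * (a + b * u) ≡ c * a + b * (c * u)
          e = solve-∀

  poly-linear : ∀ d w {f} → Poly d f → Poly (suc d) (λ x → (x + w) * f x)
  poly-linear zero    w {f} h r = f , h , λ x → trans (e x w r (f x)) (cong (λ v → (r + w) * v + (x - r) * f x) (h x r))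
    where e : ∀ x w r a → (x + w) * a ≡ (r + w) * a + (x - r) * a
          e = solve-∀
  poly-linear (suc d) w {f} h r with h r
  ... | g , Pg , ef = (λ x → f x + (r + w) * g x) , poly-+ (suc d) h (poly-lift d (poly-scale d (r + w) Pg)) , λ x →
      trans (e₁ x w r (f x)) (trans (cong (λ v → (x - r) * f x + (r + w) * v) (ef x)) (e₂ x w r (f x) (f r) (g x)))
    where e₁ : ∀ x w r a → (x + w) * a ≡ (x - r) * a + (r + w) * a
          e₁ = solve-∀
          e₂ : ∀ x w r a b c → (x - r) * a + (r + w) * (b + (x - r) * c) ≡ (r + w) * b + (x - r) * (a + (r + w) * c)
          e₂ = solve-∀

  -- F(vs) - F(vs′) = numerator / denominator, where F(vs)(x) = Σ 1 / (x + v).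
  denominator : List ℕ → List ℕ → ℤ → ℤ
  denominator (v ∷ vs) (v′ ∷ vs′) x = (x + + v) * ((x + + v′) * denominator vs vs′ x)
  denominator _        _          x = + 1

  numerator : List ℕ → List ℕ → ℤ → ℤ
  numerator (v ∷ vs) (v′ ∷ vs′) x = (+ v′ - + v) * denominator vs vs′ x + (x + + v) * ((x + + v′) * numerator vs vs′ x)
  numerator _        _          x = +0

  poly-denominator : ∀ {V k o vs vs′} → Blocks V k o vs → Blocks V k o vs′ → Poly (k ℕ.* 2) (denominator vs vs′)
  poly-denominator []       []       = λ _ _ → refl
  poly-denominator {k = suc k} {vs = v ∷ vs} {v′ ∷ vs′} (_ ∷ bs) (_ ∷ cs) =
    poly-linear (suc (k ℕ.* 2)) (+ v) (poly-linear (k ℕ.* 2) (+ v′) (poly-denominator bs cs))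

  poly-numerator : ∀ {V k o vs vs′} → Blocks V k o vs → Blocks V k o vs′ → Poly (k ℕ.* 2) (numerator vs vs′)
  poly-numerator []       []       = λ _ _ → refl
  poly-numerator {k = suc k} {vs = v ∷ vs} {v′ ∷ vs′} (_ ∷ bs) (_ ∷ cs) =
    poly-+ d (poly-lift (suc (k ℕ.* 2)) (poly-lift (k ℕ.* 2) (poly-scale (k ℕ.* 2) (+ v′ - + v) (poly-denominator bs cs))))
             (poly-linear (suc (k ℕ.* 2)) (+ v) {λ x → (x + + v′) * numerator vs vs′ x} (poly-linear (k ℕ.* 2) (+ v′) (poly-numerator bs cs)))
    where d = suc (suc (k ℕ.* 2))


  module Reciprocals (p : ℕ) .{{_ : NonZero p}} (prime : Prime p) where
    open Residues p prime

    -- A point `x₀` with a unit value takes the place of a coefficient that is nonzero mod p. It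
    -- survives the induction: at a root r, f x₀ is (x₀ - r) g x₀ plus a multiple of p, so g x₀ is a
    -- unit too.
    roots-≤ : ∀ d {f} → Poly d f → ∀ x₀ → Unit (f x₀) → ∑ (upTo p) (λ s → 𝟙 (+ p ∣? f (+ s))) ≤ d
    roots-≤ zero {f} h x₀ u = ≤-reflexive (trans (∑-cong (upTo p) (λ s → zero-at s (+ p ∣? f (+ s)))) (∑-0 (upTo p)))
      where zero-at : ∀ s (d : Dec (+ p ∣ f (+ s))) → 𝟙 d ≡ 0
            zero-at s (yes d) = ⊥-elim (u (∣-resp (h (+ s) x₀) d))
            zero-at s (no  _) = refl
    roots-≤ (suc d) {f} h x₀ u with 1 ≤? ∑ (upTo p) (λ s → 𝟙 (+ p ∣? f (+ s)))
    ... | no  q = subst (_≤ suc d) (sym (n<1⇒n≡0 (≰⇒> q))) z≤n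
    ... | yes q with ∑-pos (upTo p) _ q
    ...   | r , r∈ , q′ with h (+ r)
    ...     | g , Pg , eq = begin
      ∑ (upTo p) (λ s → 𝟙 (+ p ∣? f (+ s)))                                     ≤⟨ ∑-mono∈ (upTo p) cell ⟩
      ∑ (upTo p) (λ s → 𝟙 (s ≟ r) ℕ.+ 𝟙 (+ p ∣? g (+ s)))                       ≡⟨ ∑-+ (upTo p) _ _ ⟩
      ∑ (upTo p) (λ s → 𝟙 (s ≟ r)) ℕ.+ ∑ (upTo p) (λ s → 𝟙 (+ p ∣? g (+ s)))    ≤⟨ +-mono-≤ (∑-single _≟_ (upTo p) r (upTo⁺ p)) (roots-≤ d Pg x₀ ug) ⟩
      1 ℕ.+ d                                                                   ∎
      where
      open ≤-Reasoning
      root : + p ∣ f (+ r)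
      root = 𝟙-pos (+ p ∣? f (+ r)) q′
      ug : Unit (g x₀)
      ug d′ = u (∣-resp (sym (eq x₀)) (∣m∣n⇒∣m+n root (∣n⇒∣m*n (x₀ - + r) d′)))
      e : ∀ a b → b ≡ + 1 * (a + b) + - + 1 * a
      e = solve-∀
      cell : ∀ {s} → s ∈ upTo p → 𝟙 (+ p ∣? f (+ s)) ≤ 𝟙 (s ≟ r) ℕ.+ 𝟙 (+ p ∣? g (+ s))
      cell {s} i = 𝟙-≤ (+ p ∣? f (+ s)) λ d′ → case-split
        (euclid (+ s - + r) (g (+ s)) (∣-lin₂ (+ 1) (- + 1) (∣-resp (eq (+ s)) d′) root (e (f (+ r)) ((+ s - + r) * g (+ s)))))
        where
        case-split : + p ∣ (+ s - + r) ⊎ (+ p ∣ g (+ s)) → 1 ≤ 𝟙 (s ≟ r) ℕ.+ 𝟙 (+ p ∣? g (+ s))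
        case-split (inj₁ d₁) = ≤-trans (≤-reflexive (sym (𝟙-yes (s ≟ r) (≈⇒≡ (∈-upTo⁻ i) (∈-upTo⁻ r∈) (≈⁺ d₁))))) (m≤m+n _ _)
        case-split (inj₂ d₂) = ≤-trans (≤-reflexive (sym (𝟙-yes (+ p ∣? g (+ s)) d₂))) (m≤n+m _ _)

    recip : ℤ → List ℕ → ℤ
    recip x []       = +0
    recip x (v ∷ vs) = inv (x + + v) + recip x vs

    Units : ℤ → List ℕ → Set
    Units x = All (λ v → Unit (x + + v))

    recip-difference : ∀ {V k o vs vs′} → Blocks V k o vs → Blocks V k o vs′ → ∀ x → Units x vs → Units x vs′ →
                       (recip x vs - recip x vs′) * denominator vs vs′ x ≈ numerator vs vs′ x
    recip-difference [] [] x [] [] = ≈-refl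
    recip-difference {vs = v ∷ vs} {v′ ∷ vs′} (_ ∷ bs) (_ ∷ cs) x (u ∷ us) (u′ ∷ us′) =
      ≈-trans (≈-lin₂ ((x + + v′) * D) (- ((x + + v) * D)) (inv-* u) (inv-* u′)
        (e₁ (inv (x + + v)) (inv (x + + v′)) (recip x vs - recip x vs′) x (+ v) (+ v′) D (recip x vs) (recip x vs′)))
        (≈-+ (≈-refl {(+ v′ - + v) * D}) (≈-trans (≈-reflexive (e₂ (x + + v) (x + + v′) (recip x vs - recip x vs′) D))
          (≈-*ˡ (x + + v) (≈-*ˡ (x + + v′) (recip-difference bs cs x us us′)))))
      where
      D = denominator vs vs′ x
      e₁ : ∀ i j δ x v v′ D R R′ → (i + R - (j + R′)) * ((x + v) * ((x + v′) * D)) - ((v′ - v) * D + (x + v) * (x + v′) * ((R - R′) * D))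
           ≡ (x + v′) * D * (i * (x + v) - + 1) + - ((x + v) * D) * (j * (x + v′) - + 1)
      e₁ = solve-∀
      e₂ : ∀ a b δ D → a * b * (δ * D) ≡ a * (b * (δ * D))
      e₂ = solve-∀

    Unit-diff : ∀ {v w} → w < v → v < p → Unit (- + w + + v)
    Unit-diff {v} {w} w<v v<p with m≤n⇒∃[o]m+o≡n w<v
    ... | o , refl = λ d → Unit-< {suc o} (s≤s z≤n) (≤-<-trans (s≤s (m≤n+m o w)) v<p)
                     (∣-resp (trans (cong (λ a → - + w + a) (trans (cong +_ (sym (+-suc w o))) (pos-+ w (suc o)))) (e (+ w) (+ suc o))) d)
      where e : ∀ w o → - w + (w + o) ≡ o
            e = solve-∀

    Unit-diff′ : ∀ {v w} → w < v → v < p → Unit (+ w - + v)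
    Unit-diff′ {v} {w} w<v v<p d = Unit-diff w<v v<p (∣-lin₁ (- + 1) d (e (+ w) (+ v)))
      where e : ∀ w v → - w + v ≡ - + 1 * (w - v)
            e = solve-∀

    -- The factors at -w are the differences v - w, where w < o ≤ v < p.
    denominator-unit : ∀ {V k o vs vs′} → Blocks V k o vs → Blocks V k o vs′ → o ℕ.+ k ℕ.* V ≤ p →
                       ∀ {w} → w < o → Unit (denominator vs vs′ (- + w))
    denominator-unit [] [] _ _ = Unit-1
    denominator-unit {V} {suc k} {o} ((o≤v , v<) ∷ bs) ((o≤v′ , v′<) ∷ cs) ≤p w<o =
      Unit-* (Unit-diff (<-≤-trans w<o o≤v) (<-≤-trans v< o+V≤p))
        (Unit-* (Unit-diff (<-≤-trans w<o o≤v′) (<-≤-trans v′< o+V≤p))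
          (denominator-unit bs cs (subst (_≤ p) (sym (+-assoc o V (k ℕ.* V))) ≤p) (<-≤-trans w<o (m≤m+n o V))))
      where o+V≤p = ≤-trans (+-monoʳ-≤ o (m≤m+n V (k ℕ.* V))) ≤p

    -- At the pole of a reciprocal occurring on one side only.
    numerator-unit : ∀ {V k o vs vs′} → Blocks V k o vs → Blocks V k o vs′ → o ℕ.+ k ℕ.* V ≤ p → vs ≢ vs′ →
                     ∃ λ w → o ≤ w × w < p × Unit (numerator vs vs′ (- + w))
    numerator-unit [] [] _ vs≢ = ⊥-elim (vs≢ refl)
    numerator-unit {V} {suc k} {o} {v ∷ vs} {v′ ∷ vs′} ((o≤v , v<) ∷ bs) ((o≤v′ , v′<) ∷ cs) ≤p vs≢ with v ≟ v′
    ... | no v≢v′ = v , o≤v , v<p , λ d → Unit-* uδ (denominator-unit bs cs ≤p′ v<)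
            (∣-resp (e (+ v) (+ v′ - + v) (denominator vs vs′ (- + v)) ((- + v + + v′) * numerator vs vs′ (- + v))) d)
      where
      o+V≤p = ≤-trans (+-monoʳ-≤ o (m≤m+n V (k ℕ.* V))) ≤p
      ≤p′ = subst (_≤ p) (sym (+-assoc o V (k ℕ.* V))) ≤p
      v<p = <-≤-trans v< o+V≤p
      uδ : Unit (+ v′ - + v)
      uδ with <-cmp v v′
      ... | tri< v<v′ _ _ = λ d → Unit-diff v<v′ (<-≤-trans v′< o+V≤p) (∣-resp (ℤ.+-comm (+ v′) (- + v)) d)
      ... | tri≈ _ v≡v′ _ = ⊥-elim (v≢v′ v≡v′)
      ... | tri> _ _ v′<v = Unit-diff′ v′<v v<p
      e : ∀ v δ D N → δ * D + (- v + v) * N ≡ δ * D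
      e = solve-∀
    ... | yes refl with numerator-unit bs cs (subst (_≤ p) (sym (+-assoc o V (k ℕ.* V))) ≤p) (λ eq → vs≢ (cong (v ∷_) eq))
    ...   | w , o+V≤w , w<p , uw = w , ≤-trans (m≤m+n o V) o+V≤w , w<p , λ d →
            Unit-* u₁ (Unit-* u₁ uw) (∣-resp (e (+ v) (denominator vs vs′ (- + w)) ((- + w + + v) * ((- + w + + v) * numerator vs vs′ (- + w)))) d)
      where
      u₁ : Unit (- + w + + v)
      u₁ d = Unit-diff′ (<-≤-trans v< o+V≤w) w<p (∣-resp (ℤ.+-comm (- + w) (+ v)) d)
      e : ∀ v D N → (v - v) * D + N ≡ N
      e = solve-∀

-- Ratios ξ with many different reciprocal sums

module RichRatios where
  open Summation
  open Congruence
  open CrossRatios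
  open RatioEnergy
  open Popularity
  open ReciprocalSums
  open import Data.Integer using (+_; _+_; _*_; _-_; -_)
  open import Data.Integer.Divisibility.Signed
  open import Data.Integer.Properties using (pos-+; pos-*)
  open import Data.Integer.Tactic.RingSolver using (solve-∀)
  open import Data.Nat using (ℕ; suc; NonZero; z≤n; s≤s; _^_; _≤?_; _≟_; _≤_; _<_; >-nonZero; >-nonZero⁻¹)
  open import Data.Nat.Properties

  module Ratios (p : ℕ) .{{_ : NonZero p}} (prime : Prime p) where
    open Residues p prime
    open Energy p prime
    open Reciprocals p prime

    fractions : (U T : ℕ) → List (ℕ × ℕ)
    fractions U T = cartesianProduct (range U U) (upTo T)

    ratio : ℕ → ℕ × ℕ → ℕ
    ratio b (u , t) = rs (+ (b ℕ.+ t) * inv (+ u))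

    length-fractions : ∀ U T → length (fractions U T) ≡ U ℕ.* T
    length-fractions U T = trans (length-cartesianProductWith _,_ (range U U) (upTo T)) (cong₂ ℕ._*_ (length-range U U) (length-upTo T))

    module RatioFibres (b U T : ℕ) = Fibres (fractions U T) (ratio b) p (λ (u , t) → rs<p (+ (b ℕ.+ t) * inv (+ u)))
    module ImageFibres (V k ξ : ℕ) = Fibres (tuples V k 0) (λ vs → rs (recip (+ ξ) vs)) p (λ vs → rs<p (recip (+ ξ) vs))

    ratio⇒cross : ∀ {u u′} y y′ → Unit (+ u) → Unit (+ u′) → + y * inv (+ u) ≈ + y′ * inv (+ u′) → + (y ℕ.* u′) ≈ + (y′ ℕ.* u)
    ratio⇒cross {u} {u′} y y′ cu cu′ h = subst₂ _≈_ (sym (pos-* y u′)) (sym (pos-* y′ u))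
      (≈-trans (≈-sym (≈-lin₁ (+ y * + u′) (inv-* cu) (e₁ (+ y) (+ u) (inv (+ u)) (+ u′))))
      (≈-trans (≈-* h (≈-refl {+ u * + u′})) (≈-lin₁ (+ y′ * + u) (inv-* cu′) (e₂ (+ y′) (+ u) (inv (+ u′)) (+ u′)))))
      where
      e₁ : ∀ y u i u′ → y * i * (u * u′) - y * u′ ≡ y * u′ * (i * u - + 1)
      e₁ = solve-∀
      e₂ : ∀ y u i u′ → y * i * (u * u′) - y * u ≡ y * u * (i * u′ - + 1)
      e₂ = solve-∀

    fraction-∈ : ∀ {U T u t} → (u , t) ∈ fractions U T → U ≤ u × u < U ℕ.+ U × t < T
    fraction-∈ {U} {T} i with ∈-cartesianProduct⁻ (range U U) (upTo T) i
    ... | u∈ , t∈ with ∈-range⁻ u∈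
    ...   | U≤u , u< = U≤u , u< , ∈-upTo⁻ t∈

    -- The off-diagonal collisions at ξ, expressed through the numerator instead of the sums
    -- themselves: in this form the bound on the number of roots applies to all ξ, poles included,
    -- and the sum over all residues needs no exceptions.
    distinctRoots : ℕ → ℕ → ℕ → ℕ
    distinctRoots V k ξ = ∑ (tuples V k 0) (λ vs → ∑ (tuples V k 0) (λ vs′ →
      𝟙 (¬? (≡-dec _≟_ vs vs′)) ℕ.* 𝟙 (+ p ∣? numerator vs vs′ (+ ξ))))

    ∑-distinctRoots : ∀ V k → k ℕ.* V ≤ p → ∑ (upTo p) (distinctRoots V k) ≤ V ^ k ℕ.* (V ^ k ℕ.* (k ℕ.* 2))
    ∑-distinctRoots V k kV≤p = begin
      ∑ (upTo p) (distinctRoots V k)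
        ≡⟨ trans (∑-swap (upTo p) W _) (∑-cong W (λ vs → ∑-swap (upTo p) W _)) ⟩
      ∑ W (λ vs → ∑ W (λ vs′ → ∑ (upTo p) (λ ξ → 𝟙 (¬? (≡-dec _≟_ vs vs′)) ℕ.* 𝟙 (+ p ∣? numerator vs vs′ (+ ξ)))))
        ≤⟨ ∑-mono∈ W (λ i → ∑-mono∈ W (λ j → cell i j)) ⟩
      ∑ W (λ vs → ∑ W (λ vs′ → k ℕ.* 2))
        ≡⟨ trans (∑-cong W (λ _ → trans (∑-const W (k ℕ.* 2)) (cong (ℕ._* (k ℕ.* 2)) (length-tuples V k 0))))
                 (trans (∑-const W _) (cong (ℕ._* (V ^ k ℕ.* (k ℕ.* 2))) (length-tuples V k 0))) ⟩
      V ^ k ℕ.* (V ^ k ℕ.* (k ℕ.* 2)) ∎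
      where
      open ≤-Reasoning
      W = tuples V k 0
      cell : ∀ {vs vs′} → vs ∈ W → vs′ ∈ W →
             ∑ (upTo p) (λ ξ → 𝟙 (¬? (≡-dec _≟_ vs vs′)) ℕ.* 𝟙 (+ p ∣? numerator vs vs′ (+ ξ))) ≤ k ℕ.* 2
      cell {vs} {vs′} i j = ≤-trans (≤-reflexive (∑-*ˡ (upTo p) (𝟙 (¬? (≡-dec _≟_ vs vs′))) _)) (cases (¬? (≡-dec _≟_ vs vs′)))
        where
        cases : (d : Dec (vs ≢ vs′)) → 𝟙 d ℕ.* ∑ (upTo p) (λ ξ → 𝟙 (+ p ∣? numerator vs vs′ (+ ξ))) ≤ k ℕ.* 2
        cases (no  _)   = z≤n
        cases (yes vs≢) with numerator-unit (∈-tuples⁻ V k 0 i) (∈-tuples⁻ V k 0 j) kV≤p vs≢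
        ... | w , _ , _ , uw = ≤-trans (≤-reflexive (*-identityˡ _))
                (roots-≤ (k ℕ.* 2) (poly-numerator (∈-tuples⁻ V k 0 i) (∈-tuples⁻ V k 0 j)) (- + w) uw)

    Blocks-units : ∀ {V k o vs} x N → Blocks V k o vs → (∀ {v} → v < N → Unit (x + + v)) → o ℕ.+ k ℕ.* V ≤ N → Units x vs
    Blocks-units x N [] u ≤N = []
    Blocks-units {V} {suc k} {o} x N ((_ , v<) ∷ bs) u ≤N =
      u (<-≤-trans v< (≤-trans (+-monoʳ-≤ o (m≤m+n V (k ℕ.* V))) ≤N)) ∷
      Blocks-units x N bs u (subst (_≤ N) (sym (+-assoc o V (k ℕ.* V))) ≤N)

    imageCollisions-≤ : ∀ V k ξ → (∀ {v} → v < k ℕ.* V → Unit (+ ξ + + v)) →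
                        ImageFibres.collisions V k ξ ≤ V ^ k ℕ.+ distinctRoots V k ξ
    imageCollisions-≤ V k ξ units = begin
      ImageFibres.collisions V k ξ
        ≤⟨ ∑-mono∈ W (λ i → ∑-mono∈ W (λ j → cell i j)) ⟩
      ∑ W (λ vs → ∑ W (λ vs′ → 𝟙 (≡-dec _≟_ vs′ vs) ℕ.+ 𝟙 (¬? (≡-dec _≟_ vs vs′)) ℕ.* 𝟙 (+ p ∣? numerator vs vs′ (+ ξ))))
        ≡⟨ trans (∑-cong W (λ vs → ∑-+ W _ _)) (∑-+ W _ _) ⟩
      ∑ W (λ vs → ∑ W (λ vs′ → 𝟙 (≡-dec _≟_ vs′ vs))) ℕ.+ distinctRoots V k ξ
        ≤⟨ +-monoˡ-≤ _ (∑-≤const W 1 (λ {vs} _ → ∑-single (≡-dec _≟_) W vs (tuples-unique V k 0))) ⟩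
      length W ℕ.* 1 ℕ.+ distinctRoots V k ξ
        ≡⟨ cong (ℕ._+ distinctRoots V k ξ) (trans (*-identityʳ _) (length-tuples V k 0)) ⟩
      V ^ k ℕ.+ distinctRoots V k ξ ∎
      where
      open ≤-Reasoning
      W = tuples V k 0
      cell : ∀ {vs vs′} → vs ∈ W → vs′ ∈ W → 𝟙 (rs (recip (+ ξ) vs) ≟ rs (recip (+ ξ) vs′)) ≤
             𝟙 (≡-dec _≟_ vs′ vs) ℕ.+ 𝟙 (¬? (≡-dec _≟_ vs vs′)) ℕ.* 𝟙 (+ p ∣? numerator vs vs′ (+ ξ))
      cell {vs} {vs′} i j = 𝟙-≤ (_ ≟ _) λ eq → cases eq (≡-dec _≟_ vs vs′)
        where
        cases : rs (recip (+ ξ) vs) ≡ rs (recip (+ ξ) vs′) → Dec (vs ≡ vs′) →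
                1 ≤ 𝟙 (≡-dec _≟_ vs′ vs) ℕ.+ 𝟙 (¬? (≡-dec _≟_ vs vs′)) ℕ.* 𝟙 (+ p ∣? numerator vs vs′ (+ ξ))
        cases eq (yes vs≡) = ≤-trans (≤-reflexive (sym (𝟙-yes (≡-dec _≟_ vs′ vs) (sym vs≡)))) (m≤m+n _ _)
        cases eq (no vs≢) = ≤-trans (≤-reflexive (sym (cong₂ ℕ._*_ (𝟙-yes (¬? (≡-dec _≟_ vs vs′)) vs≢) (𝟙-yes (+ p ∣? numerator vs vs′ (+ ξ)) root)))) (m≤n+m _ (𝟙 (≡-dec _≟_ vs′ vs)))
          where
          bs = ∈-tuples⁻ V k 0 i
          cs = ∈-tuples⁻ V k 0 j
          D = denominator vs vs′ (+ ξ)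
          e₁ : ∀ R R′ D N → N ≡ D * (R - R′) + - + 1 * ((R - R′) * D - N)
          e₁ = solve-∀
          root : + p ∣ numerator vs vs′ (+ ξ)
          root = ∣-lin₂ D (- + 1) (≈⁻ (rs-inj {recip (+ ξ) vs} {recip (+ ξ) vs′} eq))
            (≈⁻ (recip-difference bs cs (+ ξ) (Blocks-units (+ ξ) (k ℕ.* V) bs units ≤-refl) (Blocks-units (+ ξ) (k ℕ.* V) cs units ≤-refl)))
            (e₁ (recip (+ ξ) vs) (recip (+ ξ) vs′) D (numerator vs vs′ (+ ξ)))

    module _ (b U M r L : ℕ) .{{_ : NonZero U}} .{{_ : NonZero L}} (4UM≤p : 4 ℕ.* (U ℕ.* M) ≤ p) (2U<2^L : U ℕ.+ U < 2 ^ L) (U≤M : U ≤ M)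
             (2U≤p : U ℕ.+ U ≤ p) where

      crossEnergy-≤ : ∑ (fractions U (r ℕ.* M)) (λ (u , t) → ∑ (fractions U (r ℕ.* M)) (λ (u′ , t′) → 𝟙 (sameRatio (b ℕ.+ t) u (b ℕ.+ t′) u′)))
                      ≤ r ℕ.* r ℕ.* (10 ℕ.* (U ℕ.* M ℕ.* L))
      crossEnergy-≤ = ≤-trans (energy-≤ b M U r L 4UM≤p 2U<2^L) (*-monoʳ-≤ (r ℕ.* r) (begin
        2 ℕ.* (U ℕ.* U ℕ.+ 4 ℕ.* (U ℕ.* M ℕ.* L))               ≤⟨ *-monoʳ-≤ 2 (+-monoˡ-≤ _ (≤-trans (*-monoʳ-≤ U U≤M) (m≤m*n (U ℕ.* M) L))) ⟩
        2 ℕ.* (U ℕ.* M ℕ.* L ℕ.+ 4 ℕ.* (U ℕ.* M ℕ.* L))         ≡⟨ e (U ℕ.* M ℕ.* L) ⟩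
        10 ℕ.* (U ℕ.* M ℕ.* L)                                  ∎))
        where
        open ≤-Reasoning
        e : ∀ x → 2 ℕ.* (x ℕ.+ 4 ℕ.* x) ≡ 10 ℕ.* x
        e = ℕ-Solver.solve-∀

      fraction-unit : ∀ {u t} → (u , t) ∈ fractions U (r ℕ.* M) → Unit (+ u)
      fraction-unit i with fraction-∈ {U} {r ℕ.* M} i
      ... | U≤u , u<2U , _ = Unit-< (≤-trans (>-nonZero⁻¹ U) U≤u) (<-≤-trans u<2U 2U≤p)

      ratioCollisions-≤ : RatioFibres.collisions b U (r ℕ.* M) ≤ r ℕ.* r ℕ.* (10 ℕ.* (U ℕ.* M ℕ.* L))
      ratioCollisions-≤ = ≤-trans
        (∑-mono∈ (fractions U (r ℕ.* M)) (λ {(u , t)} i → ∑-mono∈ (fractions U (r ℕ.* M)) (λ {(u′ , t′)} j →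
          𝟙-mono (ratio b (u , t) ≟ ratio b (u′ , t′)) (sameRatio (b ℕ.+ t) u (b ℕ.+ t′) u′) (λ eq →
            ratio⇒cross (b ℕ.+ t) (b ℕ.+ t′) (fraction-unit i) (fraction-unit j) (rs-inj eq)))))
        crossEnergy-≤

      -- The r² of the energy cancels against the r² in the squared number of fractions. A longer
      -- interval of y therefore leaves the lower bound for the number of popular ratios intact,
      -- while it raises the popularity g that can be demanded.
      popularRatios : .{{_ : NonZero r}} → ∀ g → 2 ℕ.* (p ℕ.* g) ≤ U ℕ.* (r ℕ.* M) →
                      U ℕ.* M ≤ 40 ℕ.* L ℕ.* ∑ (upTo p) (λ ξ → 𝟙 (suc g ≤? RatioFibres.fibre b U (r ℕ.* M) ξ))
      popularRatios g h = *-cancelʳ-≤ (U ℕ.* M) (40 ℕ.* L ℕ.* P) (r ℕ.* r ℕ.* (U ℕ.* M)) {{nz}} (begin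
        U ℕ.* M ℕ.* (r ℕ.* r ℕ.* (U ℕ.* M))                      ≡⟨ e₁ U M r ⟩
        U ℕ.* (r ℕ.* M) ℕ.* (U ℕ.* (r ℕ.* M))                    ≡⟨ cong₂ ℕ._*_ (length-fractions U (r ℕ.* M)) (length-fractions U (r ℕ.* M)) ⟨
        length (fractions U (r ℕ.* M)) ℕ.* length (fractions U (r ℕ.* M)) ≤⟨ RatioFibres.popular b U (r ℕ.* M) g (≤-trans h (≤-reflexive (sym (length-fractions U (r ℕ.* M))))) ⟩
        4 ℕ.* (P ℕ.* RatioFibres.collisions b U (r ℕ.* M))       ≤⟨ *-monoʳ-≤ 4 (*-monoʳ-≤ P ratioCollisions-≤) ⟩
        4 ℕ.* (P ℕ.* (r ℕ.* r ℕ.* (10 ℕ.* (U ℕ.* M ℕ.* L))))     ≡⟨ e₂ P r U M L ⟩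
        40 ℕ.* L ℕ.* P ℕ.* (r ℕ.* r ℕ.* (U ℕ.* M))               ∎)
        where
        open ≤-Reasoning
        P = ∑ (upTo p) (λ ξ → 𝟙 (suc g ≤? RatioFibres.fibre b U (r ℕ.* M) ξ))
        nz : NonZero (r ℕ.* r ℕ.* (U ℕ.* M))
        nz = m*n≢0 (r ℕ.* r) (U ℕ.* M) {{m*n≢0 r r}} {{m*n≢0 U M {{it}} {{>-nonZero (<-≤-trans (>-nonZero⁻¹ U) U≤M)}}}}
        e₁ : ∀ U M r → U ℕ.* M ℕ.* (r ℕ.* r ℕ.* (U ℕ.* M)) ≡ U ℕ.* (r ℕ.* M) ℕ.* (U ℕ.* (r ℕ.* M))
        e₁ = ℕ-Solver.solve-∀
        e₂ : ∀ P r U M L → 4 ℕ.* (P ℕ.* (r ℕ.* r ℕ.* (10 ℕ.* (U ℕ.* M ℕ.* L)))) ≡ 40 ℕ.* L ℕ.* P ℕ.* (r ℕ.* r ℕ.* (U ℕ.* M))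
        e₂ = ℕ-Solver.solve-∀

    fibre-member : ∀ {b U T ξ} → 1 ≤ RatioFibres.fibre b U T ξ → ∃ λ x → x ∈ fractions U T × ratio b x ≡ ξ
    fibre-member {b} {U} {T} {ξ} pos with ∑-pos (fractions U T) _ pos
    ... | x , i , q = x , i , 𝟙-pos (ratio b x ≟ ξ) q

    shifted : ∀ {y u ξ} → Unit (+ u) → rs (+ y * inv (+ u)) ≡ ξ → ∀ v → + u * (+ ξ + + v) ≈ + (y ℕ.+ u ℕ.* v)
    shifted {y} {u} u≢0 refl v = ≈-trans (≈-*ˡ (+ u) (≈-+ (rs-≈ (+ y * inv (+ u))) (≈-refl {+ v})))
      (≈-lin₁ (+ y) (inv-* u≢0) (trans (cong (λ w → + u * (+ y * inv (+ u) + + v) - w) (trans (pos-+ y (u ℕ.* v)) (cong (λ w → + y + w) (pos-* u v)))) (e (+ y) (+ u) (inv (+ u)) (+ v))))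
      where e : ∀ y u i v → u * (y * i + v) - (y + u * v) ≡ y * (i * u - + 1)
            e = solve-∀

    -- All residues together have at most 2 k V^(2k) off-diagonal collisions, and there are at least
    -- U M / (40 L) ≥ V^k / (640 L) popular ratios. So one of these has at most 1280 k L V^k such
    -- collisions; the diagonal raises 1280 to 1281, and the factor 4 of `popular` gives 5124.
    richRatio : ∀ b U M r L V k g .{{_ : NonZero U}} .{{_ : NonZero L}} .{{_ : NonZero V}} .{{_ : NonZero k}} .{{_ : NonZero r}} →
      4 ℕ.* (U ℕ.* M) ≤ p → U ℕ.+ U < 2 ^ L → U ≤ M → 1 ≤ b → b ℕ.+ r ℕ.* M ℕ.+ (U ℕ.+ U) ℕ.* (k ℕ.* V) ≤ p →
      2 ℕ.* (p ℕ.* g) ≤ U ℕ.* (r ℕ.* M) → V ^ k ≤ 16 ℕ.* (U ℕ.* M) →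
      ∃ λ ξ → ξ < p × suc g ≤ RatioFibres.fibre b U (r ℕ.* M) ξ ×
              V ^ k ≤ 5124 ℕ.* (k ℕ.* L) ℕ.* ∑ (upTo p) (λ s → 𝟙 (1 ≤? ImageFibres.fibre V k ξ s))
    richRatio b U M r L V k g 4UM≤p 2U<2^L U≤M 1≤b ≤p popularity V^k≤16UM = conclude (∑-average (upTo p) w B X weighted P>0)
      where
      open ≤-Reasoning
      w = λ ξ → 𝟙 (suc g ≤? RatioFibres.fibre b U (r ℕ.* M) ξ)
      B = distinctRoots V k
      X = V ^ k ℕ.* (V ^ k ℕ.* (k ℕ.* 2))
      P = ∑ (upTo p) w
      instance
        kVnz : NonZero (k ℕ.* V)
        kVnz = m*n≢0 k V
        Mnz : NonZero M
        Mnz = >-nonZero (<-≤-trans (>-nonZero⁻¹ U) U≤M)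
        Vknz : NonZero (V ^ k)
        Vknz = m^n≢0 V k
        2Unz : NonZero (U ℕ.+ U)
        2Unz = >-nonZero (<-≤-trans (>-nonZero⁻¹ U) (m≤m+n U U))
      2UkV≤p : (U ℕ.+ U) ℕ.* (k ℕ.* V) ≤ p
      2UkV≤p = ≤-trans (m≤n+m _ (b ℕ.+ r ℕ.* M)) ≤p
      2U≤p : U ℕ.+ U ≤ p
      2U≤p = ≤-trans (m≤m*n (U ℕ.+ U) (k ℕ.* V)) 2UkV≤p
      kV≤p : k ℕ.* V ≤ p
      kV≤p = ≤-trans (m≤n*m (k ℕ.* V) (U ℕ.+ U)) 2UkV≤p
      UM≤40LP : U ℕ.* M ≤ 40 ℕ.* L ℕ.* P
      UM≤40LP = popularRatios b U M r L 4UM≤p 2U<2^L U≤M 2U≤p g popularity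
      P>0 : 0 < P
      P>0 = n≢0⇒n>0 λ P≡0 → <⇒≱ (>-nonZero⁻¹ (U ℕ.* M) {{m*n≢0 U M}})
              (≤-trans UM≤40LP (≤-reflexive (trans (cong (40 ℕ.* L ℕ.*_) P≡0) (*-zeroʳ (40 ℕ.* L)))))
      weighted : ∑ (upTo p) (λ ξ → w ξ ℕ.* B ξ) ≤ X
      weighted = ≤-trans (∑-mono (upTo p) (λ ξ → ≤-trans (*-monoˡ-≤ (B ξ) (𝟙-≤1 (suc g ≤? RatioFibres.fibre b U (r ℕ.* M) ξ))) (≤-reflexive (*-identityˡ (B ξ)))))
                   (∑-distinctRoots V k kV≤p)
      conclude : (∃ λ ξ → ξ ∈ upTo p × 0 < w ξ × B ξ ℕ.* P ≤ X) → _
      conclude (ξ , ξ∈ , wξ , BP≤X) = ξ , ∈-upTo⁻ ξ∈ , rich , *-cancelʳ-≤ (V ^ k) _ (V ^ k) (begin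
        V ^ k ℕ.* V ^ k                                ≡⟨ cong₂ ℕ._*_ (length-tuples V k 0) (length-tuples V k 0) ⟨
        length (tuples V k 0) ℕ.* length (tuples V k 0) ≤⟨ ImageFibres.popular V k ξ 0 (subst (_≤ length (tuples V k 0)) (sym (cong (2 ℕ.*_) (*-zeroʳ p))) z≤n) ⟩
        4 ℕ.* (S ℕ.* ImageFibres.collisions V k ξ)     ≤⟨ *-monoʳ-≤ 4 (*-monoʳ-≤ S coll) ⟩
        4 ℕ.* (S ℕ.* (1281 ℕ.* (k ℕ.* L) ℕ.* V ^ k))   ≡⟨ e₃ S (k ℕ.* L) (V ^ k) ⟩
        5124 ℕ.* (k ℕ.* L) ℕ.* S ℕ.* V ^ k             ∎)
        where
        S = ∑ (upTo p) (λ s → 𝟙 (1 ≤? ImageFibres.fibre V k ξ s))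
        e₃ : ∀ S c v → 4 ℕ.* (S ℕ.* (1281 ℕ.* c ℕ.* v)) ≡ 5124 ℕ.* c ℕ.* S ℕ.* v
        e₃ = ℕ-Solver.solve-∀
        rich : suc g ≤ RatioFibres.fibre b U (r ℕ.* M) ξ
        rich = 𝟙-pos (suc g ≤? RatioFibres.fibre b U (r ℕ.* M) ξ) wξ
        -- No pole is met: u (ξ + v) ≡ y + u v, which lies strictly between 0 and p.
        units : ∀ {v} → v < k ℕ.* V → Unit (+ ξ + + v)
        units {v} v<kV with fibre-member {b} {U} {r ℕ.* M} {ξ} (≤-trans (s≤s z≤n) rich)
        ... | (u , t) , i , eq with fraction-∈ {U} {r ℕ.* M} i
        ...   | U≤u , u<2U , t<T = λ d →
                Unit-resp (≈-sym (shifted {b ℕ.+ t} {u} (fraction-unit b U M r L 4UM≤p 2U<2^L U≤M 2U≤p i) eq v))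
                  (Unit-< (≤-trans 1≤b (≤-trans (m≤m+n b t) (m≤m+n (b ℕ.+ t) _)))
                    (<-≤-trans (+-mono-<-≤ (+-monoʳ-< b t<T) (*-mono-≤ (<⇒≤ u<2U) (<⇒≤ v<kV))) ≤p))
                  (∣n⇒∣m*n (+ u) d)
        Bbound : B ξ ≤ 1280 ℕ.* (k ℕ.* L) ℕ.* V ^ k
        Bbound = *-cancelʳ-≤ (B ξ) _ (V ^ k) (begin
          B ξ ℕ.* V ^ k                                ≤⟨ *-monoʳ-≤ (B ξ) (≤-trans V^k≤16UM (*-monoʳ-≤ 16 UM≤40LP)) ⟩
          B ξ ℕ.* (16 ℕ.* (40 ℕ.* L ℕ.* P))            ≡⟨ e₄ (B ξ) L P ⟩
          640 ℕ.* L ℕ.* (B ξ ℕ.* P)                    ≤⟨ *-monoʳ-≤ (640 ℕ.* L) BP≤X ⟩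
          640 ℕ.* L ℕ.* X                              ≡⟨ e₅ L (V ^ k) k ⟩
          1280 ℕ.* (k ℕ.* L) ℕ.* V ^ k ℕ.* V ^ k       ∎)
          where
          e₄ : ∀ B L P → B ℕ.* (16 ℕ.* (40 ℕ.* L ℕ.* P)) ≡ 640 ℕ.* L ℕ.* (B ℕ.* P)
          e₄ = ℕ-Solver.solve-∀
          e₅ : ∀ L v k → 640 ℕ.* L ℕ.* (v ℕ.* (v ℕ.* (k ℕ.* 2))) ≡ 1280 ℕ.* (k ℕ.* L) ℕ.* v ℕ.* v
          e₅ = ℕ-Solver.solve-∀
        coll : ImageFibres.collisions V k ξ ≤ 1281 ℕ.* (k ℕ.* L) ℕ.* V ^ k
        coll = begin
          ImageFibres.collisions V k ξ                       ≤⟨ imageCollisions-≤ V k ξ units ⟩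
          V ^ k ℕ.+ B ξ                                      ≤⟨ +-mono-≤ (m≤n*m (V ^ k) (k ℕ.* L) {{m*n≢0 k L}}) Bbound ⟩
          k ℕ.* L ℕ.* V ^ k ℕ.+ 1280 ℕ.* (k ℕ.* L) ℕ.* V ^ k ≡⟨ e₆ (k ℕ.* L) (V ^ k) ⟩
          1281 ℕ.* (k ℕ.* L) ℕ.* V ^ k                       ∎
          where
          e₆ : ∀ c v → c ℕ.* v ℕ.+ 1280 ℕ.* c ℕ.* v ≡ 1281 ℕ.* c ℕ.* v
          e₆ = ℕ-Solver.solve-∀

-- Covering residues by linear forms: a second moment argument

module LinearFormCover where
  open Summation
  open Congruence
  open import Data.Integer using (ℤ; +_; _+_; _*_; _-_; -_)
  open import Data.Integer.Tactic.RingSolver using (solve-∀)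
  open import Data.Nat using (ℕ; zero; suc; NonZero; z≤n; s≤s; _≤?_; _≟_; _≤_; _<_; s≤s⁻¹; >-nonZero⁻¹; ≢-nonZero)
  open import Data.Nat.Properties

  ∑-zero : {A : Set} (xs : List A) (f : A → ℕ) → ∑ xs f < length xs → ∃ λ x → x ∈ xs × f x ≡ 0
  ∑-zero (x ∷ xs) f lt with f x in eq
  ... | zero  = x , here refl , eq
  ... | suc n with ∑-zero xs f (≤-<-trans (m≤n+m _ n) (s≤s⁻¹ lt))
  ...   | y , i , e = y , there i , e

  ∑-square : {A : Set} (xs : List A) (f : A → ℕ) → ∑ xs f ℕ.* ∑ xs f ≡ ∑ xs (λ x → ∑ xs (λ y → f x ℕ.* f y))
  ∑-square xs f = trans (sym (∑-*ʳ xs (∑ xs f) f)) (∑-cong xs (λ x → sym (∑-*ˡ xs (f x) f)))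

  module LinearForms (p : ℕ) .{{_ : NonZero p}} (prime : Prime p)
                     {P : ℕ → Set} (S? : ∀ s → Dec (P s)) {A : Set} (xs : List A) (α β : A → ℤ) where
    open Residues p prime

    F = upTo p
    grid = cartesianProduct F F

    form : A → ℕ × ℕ → ℤ
    form x (s , t) = α x * + s + β x * + t

    dependent : ∀ x y → Dec (α x * β y ≈ α y * β x)
    dependent x y = α x * β y ≈? α y * β x

    size energy : ℕ
    size = ∑ F (λ s → 𝟙 (S? s))
    energy = ∑ xs (λ x → ∑ xs (λ y → 𝟙 (dependent x y)))

    -- For pairwise independent forms `energy` is just their number. In general it counts
    -- proportional pairs, so that a few coincidences among the ratios of the multipliers are
    -- tolerated.
    record Dense : Set where
      constructor dense
      field bound : 2 ℕ.* (p ℕ.* p) ℕ.* energy < size ℕ.* size ℕ.* (length xs ℕ.* length xs)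

  -- `missed` is left abstract: a function bounded by 1 that vanishes at all values α s + β t with
  -- s, t in S. It becomes the indicator of the residues that are not represented.
  module Chebyshev (p : ℕ) .{{_ : NonZero p}} (prime : Prime p) {P : ℕ → Set} (S? : ∀ s → Dec (P s))
                   {A : Set} (xs : List A) (α β : A → ℤ) (α-unit : ∀ {x} → x ∈ xs → Residues.Unit p prime (α x))
                   (missed : ℕ → ℕ) (missed≤1 : ∀ n → missed n ≤ 1)
                   (vanish : ∀ {x s t} → x ∈ xs → s ∈ upTo p → t ∈ upTo p → P s → P t →
                             missed (Residues.rs p prime (LinearForms.form p prime S? xs α β x (s , t))) ≡ 0) where
    open Residues p prime
    open LinearForms p prime S? xs α β

    c : ℕ
    c = ∑ F missed

    φ : ℕ × ℕ → ℕ
    φ st = ∑ xs (λ x → missed (rs (form x st)))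

    private
      open ≤-Reasoning

      φ-zero : ∀ {s t} → s ∈ F → t ∈ F → P s → P t → φ (s , t) ≡ 0
      φ-zero s∈ t∈ ps pt = n≤0⇒n≡0 (≤-trans (∑-mono∈ xs (λ i → ≤-reflexive (vanish i s∈ t∈ ps pt))) (≤-reflexive (∑-0 xs)))

      -- `φ` vanishes on S × S. The deviation from the mean is exploited through Cauchy-Schwarz on
      -- the support of `φ`, which is smaller than the grid by |S|²; this form of the variance
      -- argument needs neither subtraction nor division.
      support-φ : ∑ grid (λ st → 𝟙 (1 ≤? φ st)) ℕ.+ size ℕ.* size ≤ p ℕ.* p
      support-φ = begin
        ∑ grid (λ st → 𝟙 (1 ≤? φ st)) ℕ.+ size ℕ.* size
          ≡⟨ cong (∑ grid (λ st → 𝟙 (1 ≤? φ st)) ℕ.+_) (trans (∑-square F (λ s → 𝟙 (S? s))) (sym (∑-× F F _))) ⟩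
        ∑ grid (λ st → 𝟙 (1 ≤? φ st)) ℕ.+ ∑ grid (λ st → 𝟙 (S? (proj₁ st)) ℕ.* 𝟙 (S? (proj₂ st)))
          ≡⟨ ∑-+ grid _ _ ⟨
        ∑ grid (λ st → 𝟙 (1 ≤? φ st) ℕ.+ 𝟙 (S? (proj₁ st)) ℕ.* 𝟙 (S? (proj₂ st)))
          ≤⟨ ∑-≤const grid 1 (λ i → cell i) ⟩
        length grid ℕ.* 1
          ≡⟨ trans (*-identityʳ _) (trans (length-cartesianProductWith _,_ F F) (cong₂ ℕ._*_ (length-upTo p) (length-upTo p))) ⟩
        p ℕ.* p ∎
        where
        cell : ∀ {st} → st ∈ grid → 𝟙 (1 ≤? φ st) ℕ.+ 𝟙 (S? (proj₁ st)) ℕ.* 𝟙 (S? (proj₂ st)) ≤ 1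
        cell {s , t} i = cases (1 ≤? φ (s , t)) (S? s) (S? t)
          where
          cases : (d : Dec (1 ≤ φ (s , t))) (e : Dec (P s)) (e′ : Dec (P t)) → 𝟙 d ℕ.+ 𝟙 e ℕ.* 𝟙 e′ ≤ 1
          cases (yes q) (yes a) (yes b) with ∈-cartesianProduct⁻ F F i
          ... | s∈ , t∈ = ⊥-elim (<⇒≱ q (≤-reflexive (φ-zero s∈ t∈ a b)))
          cases (yes q) (yes _) (no _)  = ≤-refl
          cases (yes q) (no _)  e′      = ≤-refl
          cases (no _)  e       e′      = *-mono-≤ (𝟙-≤1 e) (𝟙-≤1 e′)

      -- For fixed t the map s ↦ α s + β t permutes the residues, because α is a unit. Together with
      -- `row-≥`, every row of the grid meets the missed residues exactly `c` times.
      row-≤ : ∀ {x} → x ∈ xs → ∀ t → ∑ F (λ s → missed (rs (form x (s , t)))) ≤ c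
      row-≤ {x} i t = ∑-inj F F (λ s → rs (form x (s , t))) (upTo⁺ p) (λ {s} _ _ → ∈-upTo⁺ (rs<p (form x (s , t))) , ≤-refl)
        λ {s} {s′} s∈ s′∈ _ _ eq → ≈⇒≡ (∈-upTo⁻ s∈) (∈-upTo⁻ s′∈) (≈-cancelˡ (α-unit i)
          (≈-lin₁ (+ 1) (rs-inj {form x (s , t)} {form x (s′ , t)} eq) (e (α x) (+ s) (+ s′) (β x * + t))))
        where e : ∀ a s s′ b → a * s - a * s′ ≡ + 1 * (a * s + b - (a * s′ + b))
              e = solve-∀

      row-≥ : ∀ {x} → x ∈ xs → ∀ t → c ≤ ∑ F (λ s → missed (rs (form x (s , t))))
      row-≥ {x} i t = ∑-inj F F g (upTo⁺ p)
        (λ {n} n∈ _ → ∈-upTo⁺ (rs<p (inv (α x) * (+ n - β x * + t))) , ≤-reflexive (cong missed (sym (trans (rs-cong (form-g n)) (rs-id (∈-upTo⁻ n∈))))))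
        λ {n} {n′} n∈ n′∈ _ _ eq → ≈⇒≡ (∈-upTo⁻ n∈) (∈-upTo⁻ n′∈)
          (≈-trans (≈-sym (form-g n)) (≈-trans (≈-reflexive (cong (λ s → form x (s , t)) eq)) (form-g n′)))
        where
        g : ℕ → ℕ
        g n = rs (inv (α x) * (+ n - β x * + t))
        form-g : ∀ n → form x (g n , t) ≈ + n
        form-g n = ≈-lin₂ (α x) (+ n - β x * + t) (rs-≈ (inv (α x) * (+ n - β x * + t))) (inv-* (α-unit i))
                     (e (α x) (inv (α x)) (+ g n) (β x * + t) (+ n))
          where e : ∀ a i g b n → a * g + b - n ≡ a * (g - i * (n - b)) + (n - b) * (i * a - + 1)
                e = solve-∀

      total-φ : length xs ℕ.* (p ℕ.* c) ≤ ∑ grid φ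
      total-φ = begin
        length xs ℕ.* (p ℕ.* c)                                            ≡⟨ ∑-const xs (p ℕ.* c) ⟨
        ∑ xs (λ _ → p ℕ.* c)                                               ≤⟨ ∑-mono∈ xs (λ {x} i → begin
          p ℕ.* c                                                          ≡⟨ trans (∑-const F c) (cong (ℕ._* c) (length-upTo p)) ⟨
          ∑ F (λ _ → c)                                                    ≤⟨ ∑-mono F (row-≥ i) ⟩
          ∑ F (λ t → ∑ F (λ s → missed (rs (form x (s , t)))))             ≡⟨ trans (∑-swap F F _) (sym (∑-× F F _)) ⟩
          ∑ grid (λ st → missed (rs (form x st)))                          ∎) ⟩
        ∑ xs (λ x → ∑ grid (λ st → missed (rs (form x st))))               ≡⟨ ∑-swap xs grid _ ⟩
        ∑ grid φ                                                           ∎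

      -- Two independent linear forms are jointly equidistributed on the grid.
      pair-≤ : ∀ {x y} → x ∈ xs → y ∈ xs → ∑ grid (λ st → missed (rs (form x st)) ℕ.* missed (rs (form y st))) ≤
               𝟙 (dependent x y) ℕ.* (p ℕ.* c) ℕ.+ c ℕ.* c
      pair-≤ {x} {y} i j = cases (dependent x y)
        where
        cases : (d : Dec (α x * β y ≈ α y * β x)) → ∑ grid (λ st → missed (rs (form x st)) ℕ.* missed (rs (form y st))) ≤ 𝟙 d ℕ.* (p ℕ.* c) ℕ.+ c ℕ.* c
        cases (yes _) = ≤-trans (begin
          ∑ grid (λ st → missed (rs (form x st)) ℕ.* missed (rs (form y st)))   ≤⟨ ∑-mono grid (λ st → ≤-trans (*-monoʳ-≤ (missed (rs (form x st))) (missed≤1 (rs (form y st)))) (≤-reflexive (*-identityʳ (missed (rs (form x st)))))) ⟩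
          ∑ grid (λ st → missed (rs (form x st)))                               ≡⟨ trans (∑-× F F _) (∑-swap F F _) ⟩
          ∑ F (λ t → ∑ F (λ s → missed (rs (form x (s , t)))))                  ≤⟨ ∑-mono F (row-≤ i) ⟩
          ∑ F (λ _ → c)                                                         ≡⟨ trans (∑-const F c) (cong (ℕ._* c) (length-upTo p)) ⟩
          p ℕ.* c                                                               ≡⟨ *-identityˡ (p ℕ.* c) ⟨
          1 ℕ.* (p ℕ.* c)                                                       ∎) (m≤m+n _ (c ℕ.* c))
        cases (no indep) = begin
          ∑ grid (λ st → missed (rs (form x st)) ℕ.* missed (rs (form y st)))
            ≤⟨ ∑-inj grid grid {h = λ ab → missed (proj₁ ab) ℕ.* missed (proj₂ ab)} (λ st → rs (form x st) , rs (form y st)) (cartesianProduct⁺ (upTo⁺ p) (upTo⁺ p))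
                 (λ {st} _ _ → ∈-cartesianProduct⁺ (∈-upTo⁺ (rs<p (form x st))) (∈-upTo⁺ (rs<p (form y st))) , ≤-refl) inj ⟩
          ∑ grid (λ ab → missed (proj₁ ab) ℕ.* missed (proj₂ ab))  ≡⟨ trans (∑-× F F _) (sym (∑-square F missed)) ⟩
          c ℕ.* c ∎
          where
          det : ℤ
          det = α x * β y - α y * β x
          det-unit : Unit det
          det-unit d = indep (≈⁺ d)
          inj : ∀ {st st′} → st ∈ grid → st′ ∈ grid → 0 < missed (rs (form x st)) ℕ.* missed (rs (form y st)) →
                0 < missed (rs (form x st′)) ℕ.* missed (rs (form y st′)) →
                (rs (form x st) , rs (form y st)) ≡ (rs (form x st′) , rs (form y st′)) → st ≡ st′
          inj {s , t} {s′ , t′} k k′ _ _ eq with ∈-cartesianProduct⁻ F F k | ∈-cartesianProduct⁻ F F k′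
          ... | s∈ , t∈ | s′∈ , t′∈ = cong₂ _,_
            (≈⇒≡ (∈-upTo⁻ s∈) (∈-upTo⁻ s′∈) (≈-cancelˡ det-unit (≈-lin₂ (β y) (- β x) hx hy (e₁ (α x) (β x) (α y) (β y) (+ s) (+ t) (+ s′) (+ t′)))))
            (≈⇒≡ (∈-upTo⁻ t∈) (∈-upTo⁻ t′∈) (≈-cancelˡ det-unit (≈-lin₂ (- α y) (α x) hx hy (e₂ (α x) (β x) (α y) (β y) (+ s) (+ t) (+ s′) (+ t′)))))
            where
            hx : form x (s , t) ≈ form x (s′ , t′)
            hx = rs-inj {form x (s , t)} {form x (s′ , t′)} (cong proj₁ eq)
            hy : form y (s , t) ≈ form y (s′ , t′)
            hy = rs-inj {form y (s , t)} {form y (s′ , t′)} (cong proj₂ eq)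
            e₁ : ∀ a b a′ b′ s t s′ t′ → (a * b′ - a′ * b) * s - (a * b′ - a′ * b) * s′ ≡
                 b′ * (a * s + b * t - (a * s′ + b * t′)) + - b * (a′ * s + b′ * t - (a′ * s′ + b′ * t′))
            e₁ = solve-∀
            e₂ : ∀ a b a′ b′ s t s′ t′ → (a * b′ - a′ * b) * t - (a * b′ - a′ * b) * t′ ≡
                 - a′ * (a * s + b * t - (a * s′ + b * t′)) + a * (a′ * s + b′ * t - (a′ * s′ + b′ * t′))
            e₂ = solve-∀

      n = length xs

      total-φ² : ∑ grid (λ st → φ st ℕ.* φ st) ≤ energy ℕ.* (p ℕ.* c) ℕ.+ n ℕ.* (n ℕ.* (c ℕ.* c))
      total-φ² = begin
        ∑ grid (λ st → φ st ℕ.* φ st)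
          ≡⟨ ∑-cong grid (λ st → ∑-square xs _) ⟩
        ∑ grid (λ st → ∑ xs (λ x → ∑ xs (λ y → missed (rs (form x st)) ℕ.* missed (rs (form y st)))))
          ≡⟨ trans (∑-swap grid xs _) (∑-cong xs (λ x → ∑-swap grid xs _)) ⟩
        ∑ xs (λ x → ∑ xs (λ y → ∑ grid (λ st → missed (rs (form x st)) ℕ.* missed (rs (form y st)))))
          ≤⟨ ∑-mono∈ xs (λ i → ∑-mono∈ xs (λ j → pair-≤ i j)) ⟩
        ∑ xs (λ x → ∑ xs (λ y → 𝟙 (dependent x y) ℕ.* (p ℕ.* c) ℕ.+ c ℕ.* c))
          ≡⟨ trans (∑-cong xs (λ x → trans (∑-+ xs _ _) (cong₂ ℕ._+_ (∑-*ʳ xs (p ℕ.* c) _) (∑-const xs (c ℕ.* c))))) (trans (∑-+ xs _ _) (cong₂ ℕ._+_ (∑-*ʳ xs (p ℕ.* c) _) (∑-const xs _))) ⟩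
        energy ℕ.* (p ℕ.* c) ℕ.+ n ℕ.* (n ℕ.* (c ℕ.* c)) ∎

      -- Chebyshev's inequality: φ vanishes on S × S, whereas its mean over the grid is n c / p.
      chebyshev : size ℕ.* size ℕ.* (n ℕ.* (n ℕ.* (c ℕ.* c))) ≤ p ℕ.* p ℕ.* (energy ℕ.* (p ℕ.* c))
      chebyshev = ≤-trans (*-monoʳ-≤ (size ℕ.* size) (m≤n+m N Q)) (+-cancelˡ-≤ (p ℕ.* p ℕ.* N) _ _ (begin
        p ℕ.* p ℕ.* N ℕ.+ size ℕ.* size ℕ.* T        ≡⟨ cong (ℕ._+ size ℕ.* size ℕ.* T) (e₁ n p c) ⟩
        n ℕ.* (p ℕ.* c) ℕ.* (n ℕ.* (p ℕ.* c)) ℕ.+ size ℕ.* size ℕ.* T  ≤⟨ +-monoˡ-≤ _ (*-mono-≤ total-φ total-φ) ⟩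
        ∑ grid φ ℕ.* ∑ grid φ ℕ.+ size ℕ.* size ℕ.* T ≤⟨ +-monoˡ-≤ _ (≤-trans (cauchy-support grid φ) (*-monoʳ-≤ Z total-φ²)) ⟩
        Z ℕ.* T ℕ.+ size ℕ.* size ℕ.* T               ≡⟨ *-distribʳ-+ T Z (size ℕ.* size) ⟨
        (Z ℕ.+ size ℕ.* size) ℕ.* T                   ≤⟨ *-monoˡ-≤ T support-φ ⟩
        p ℕ.* p ℕ.* T                                 ≡⟨ trans (*-distribˡ-+ (p ℕ.* p) Q N) (+-comm (p ℕ.* p ℕ.* Q) (p ℕ.* p ℕ.* N)) ⟩
        p ℕ.* p ℕ.* N ℕ.+ p ℕ.* p ℕ.* Q               ∎))
        where
        Z = ∑ grid (λ st → 𝟙 (1 ≤? φ st))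
        Q = energy ℕ.* (p ℕ.* c)
        N = n ℕ.* (n ℕ.* (c ℕ.* c))
        T = Q ℕ.+ N
        e₁ : ∀ n p c → p ℕ.* p ℕ.* (n ℕ.* (n ℕ.* (c ℕ.* c))) ≡ n ℕ.* (p ℕ.* c) ℕ.* (n ℕ.* (p ℕ.* c))
        e₁ = ℕ-Solver.solve-∀

    -- If p ≤ 2 c, one factor c on the left of `chebyshev` may be replaced by p / 2; cancelling p c
    -- then contradicts the density.
    missed-few : 2 ℕ.* (p ℕ.* p) ℕ.* energy < size ℕ.* size ℕ.* (n ℕ.* n) → c ℕ.+ c < p
    missed-few big = ≰⇒> λ p≤2c → <⇒≱ (*-monoˡ-< (p ℕ.* c) {{nz p≤2c}} big) (begin
      size ℕ.* size ℕ.* (n ℕ.* n) ℕ.* (p ℕ.* c)                 ≤⟨ *-monoʳ-≤ (size ℕ.* size ℕ.* (n ℕ.* n)) (*-monoˡ-≤ c p≤2c) ⟩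
      size ℕ.* size ℕ.* (n ℕ.* n) ℕ.* ((c ℕ.+ c) ℕ.* c)         ≡⟨ e₁ size n c ⟩
      2 ℕ.* (size ℕ.* size ℕ.* (n ℕ.* (n ℕ.* (c ℕ.* c))))       ≤⟨ *-monoʳ-≤ 2 chebyshev ⟩
      2 ℕ.* (p ℕ.* p ℕ.* (energy ℕ.* (p ℕ.* c)))                ≡⟨ e₂ p energy c ⟩
      2 ℕ.* (p ℕ.* p) ℕ.* energy ℕ.* (p ℕ.* c)                  ∎)
      where
      nz : p ≤ c ℕ.+ c → NonZero (p ℕ.* c)
      nz p≤2c = m*n≢0 p c {{it}} {{≢-nonZero λ c≡0 → <⇒≱ (>-nonZero⁻¹ p) (≤-trans p≤2c (≤-reflexive (cong₂ ℕ._+_ c≡0 c≡0)))}}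
      e₁ : ∀ s n c → s ℕ.* s ℕ.* (n ℕ.* n) ℕ.* ((c ℕ.+ c) ℕ.* c) ≡ 2 ℕ.* (s ℕ.* s ℕ.* (n ℕ.* (n ℕ.* (c ℕ.* c))))
      e₁ = ℕ-Solver.solve-∀
      e₂ : ∀ p e c → 2 ℕ.* (p ℕ.* p ℕ.* (e ℕ.* (p ℕ.* c))) ≡ 2 ℕ.* (p ℕ.* p) ℕ.* e ℕ.* (p ℕ.* c)
      e₂ = ℕ-Solver.solve-∀

    -- The map t ↦ a - t is injective on residues, so at most 2 c < p residues t have t or a - t
    -- missed.
    both-hit : Dense → ∀ a →
               ∃ λ t → missed (rs (+ t)) ≡ 0 × missed (rs (a - + t)) ≡ 0
    both-hit (dense big) a = conclude (∑-zero F (λ t → missed t ℕ.+ missed (rs (a - + t))) few)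
      where
      open ≤-Reasoning
      reflect : ∑ F (λ t → missed (rs (a - + t))) ≤ c
      reflect = ∑-inj F F (λ t → rs (a - + t)) (upTo⁺ p) (λ {t} _ _ → ∈-upTo⁺ (rs<p (a - + t)) , ≤-refl)
        λ {t} {t′} t∈ t′∈ _ _ eq → ≈⇒≡ (∈-upTo⁻ t∈) (∈-upTo⁻ t′∈) (≈-lin₁ (- + 1) (rs-inj {a - + t} {a - + t′} eq) (e a (+ t) (+ t′)))
        where e : ∀ a t t′ → t - t′ ≡ - + 1 * (a - t - (a - t′))
              e = solve-∀
      few : ∑ F (λ t → missed t ℕ.+ missed (rs (a - + t))) < length F
      few = begin-strict
        ∑ F (λ t → missed t ℕ.+ missed (rs (a - + t)))        ≡⟨ ∑-+ F _ _ ⟩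
        c ℕ.+ ∑ F (λ t → missed (rs (a - + t)))               ≤⟨ +-monoʳ-≤ c reflect ⟩
        c ℕ.+ c                                               <⟨ missed-few big ⟩
        p                                                     ≡⟨ length-upTo p ⟨
        length F                                              ∎
      conclude : (∃ λ t → t ∈ F × missed t ℕ.+ missed (rs (a - + t)) ≡ 0) → ∃ λ t → missed (rs (+ t)) ≡ 0 × missed (rs (a - + t)) ≡ 0
      conclude (t , t∈ , eq) = t , trans (cong missed (rs-id (∈-upTo⁻ t∈))) (m+n≡0⇒m≡0 (missed t) eq) ,
                               m+n≡0⇒n≡0 (missed t) eq

  module Cover (p : ℕ) .{{_ : NonZero p}} (prime : Prime p)
               {P : ℕ → Set} (S? : ∀ s → Dec (P s))
               {A : Set} (xs : List A) (α β : A → ℤ) (α-unit : ∀ {x} → x ∈ xs → Residues.Unit p prime (α x)) where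
    open Residues p prime
    open LinearForms p prime S? xs α β public

    Represented : ℤ → Set
    Represented a = ∃ λ x → x ∈ xs × ∃ λ s → ∃ λ t → P s × P t × form x (s , t) ≈ a

    abstract
      -- Counting the witnesses of `Represented` makes it decidable, which the indicator `missed`
      -- requires. The count is abstract so that type checking never unfolds a sum over the whole
      -- grid.
      hits : ℕ → ℕ
      hits n = ∑ grid (λ st → ∑ xs (λ x → 𝟙 (S? (proj₁ st)) ℕ.* 𝟙 (S? (proj₂ st)) ℕ.* 𝟙 (rs (form x st) ≟ n)))

      hits-pos : ∀ {x s t} → x ∈ xs → s ∈ upTo p → t ∈ upTo p → P s → P t → ∀ n → rs (form x (s , t)) ≡ n → 1 ≤ hits n
      hits-pos {x} {s} {t} i s∈ t∈ ps pt n eq = begin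
        1 ≡⟨ sym (cong₂ ℕ._*_ (cong₂ ℕ._*_ (𝟙-yes (S? s) ps) (𝟙-yes (S? t) pt)) (𝟙-yes (rs (form x (s , t)) ≟ n) eq)) ⟩
        𝟙 (S? s) ℕ.* 𝟙 (S? t) ℕ.* 𝟙 (rs (form x (s , t)) ≟ n) ≤⟨ ∑-term xs (λ x → 𝟙 (S? s) ℕ.* 𝟙 (S? t) ℕ.* 𝟙 (rs (form x (s , t)) ≟ n)) i ⟩
        ∑ xs (λ x → 𝟙 (S? s) ℕ.* 𝟙 (S? t) ℕ.* 𝟙 (rs (form x (s , t)) ≟ n)) ≤⟨ ∑-term grid (λ st → ∑ xs (λ x → 𝟙 (S? (proj₁ st)) ℕ.* 𝟙 (S? (proj₂ st)) ℕ.* 𝟙 (rs (form x st) ≟ n))) (∈-cartesianProduct⁺ s∈ t∈) ⟩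
        hits n ∎
        where open ≤-Reasoning

      hits⁻ : ∀ a → 0 < hits (rs a) → Represented a
      hits⁻ a pos with ∑-pos grid _ pos
      ... | (s , t) , _ , q with ∑-pos xs _ q
      ...   | x , i , q′ = x , i , s , t , 𝟙-pos (S? s) (left (𝟙 (S? s)) (left (𝟙 (S? s) ℕ.* 𝟙 (S? t)) q′)) ,
                𝟙-pos (S? t) (right (𝟙 (S? s)) (left (𝟙 (S? s) ℕ.* 𝟙 (S? t)) q′)) ,
                rs-inj {form x (s , t)} {a} (𝟙-pos (rs (form x (s , t)) ≟ rs a) (right (𝟙 (S? s) ℕ.* 𝟙 (S? t)) q′))
        where
        left : ∀ m {n} → 0 < m ℕ.* n → 0 < m
        left (suc m) _ = s≤s z≤n
        right : ∀ m {n} → 0 < m ℕ.* n → 0 < n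
        right m {zero}  h rewrite *-zeroʳ m = h
        right m {suc n} h = s≤s z≤n

    missed : ℕ → ℕ
    missed n = 𝟙 (hits n ≟ 0)

    𝟙-zero : ∀ {m} (d : Dec (m ≡ 0)) → 1 ≤ m → 𝟙 d ≡ 0
    𝟙-zero (no _)     _ = refl
    𝟙-zero (yes refl) ()

    private
      module C = Chebyshev p prime S? xs α β α-unit missed (λ n → 𝟙-≤1 (hits n ≟ 0))
        (λ {x} {s} {t} i s∈ t∈ ps pt → 𝟙-zero (hits (rs (form x (s , t))) ≟ 0) (hits-pos i s∈ t∈ ps pt (rs (form x (s , t))) refl))

    hit⇒Represented : ∀ a → missed (rs a) ≡ 0 → Represented a
    hit⇒Represented a m≡0 = hits⁻ a (positive (hits (rs a) ≟ 0) m≡0)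
      where positive : (d : Dec (hits (rs a) ≡ 0)) → 𝟙 d ≡ 0 → 0 < hits (rs a)
            positive (no h) _ = n≢0⇒n>0 h

    cover : Dense → ∀ a → ∃ λ b → Represented b × Represented (a - b)
    cover big a = conclude (C.both-hit big a)
      where
      conclude : (∃ λ t → missed (rs (+ t)) ≡ 0 × missed (rs (a - + t)) ≡ 0) → ∃ λ b → Represented b × Represented (a - b)
      conclude (t , h , h′) = + t , hit⇒Represented (+ t) h , hit⇒Represented (a - + t) h′

-- Sums of fractions over intervals of integers

module FractionSums where
  open Summation
  open Congruence
  open ReciprocalSums
  open RichRatios
  open LinearFormCover
  open import Defs
  open import Data.Fin using (Fin; zero; suc)
  open import Data.Integer using (ℤ; +_; _+_; _*_; _-_; -_; +0)
  open import Data.Integer.Divisibility.Signed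
  open import Data.Integer.Properties using (pos-+; pos-*)
  open import Data.Integer.Tactic.RingSolver using (solve-∀)
  open import Data.Nat using (ℕ; zero; suc; NonZero; z≤n; s≤s; _≤?_; _≟_; _≤_; _<_; >-nonZero; >-nonZero⁻¹; nonTrivial⇒n>1)
  open import Data.Nat.Properties
  open import Data.Vec using (sum; tabulate)

  ∑-≤1 : {A : Set} (xs : List A) (f : A → ℕ) → Unique xs → (∀ x → f x ≤ 1) →
         (∀ {x y} → x ∈ xs → y ∈ xs → 0 < f x → 0 < f y → x ≡ y) → ∑ xs f ≤ 1
  ∑-≤1 xs f u f≤1 same = ∑-inj xs (tt ∷ []) {h = λ _ → 1} (λ _ → tt) u (λ {x} _ _ → here refl , f≤1 x) (λ i j p q _ → same i j p q)

  length-filter-∑ : {A : Set} {P : A → Set} (P? : ∀ x → Dec (P x)) (xs : List A) → length (filter P? xs) ≡ ∑ xs (λ x → 𝟙 (P? x))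
  length-filter-∑ P? []       = refl
  length-filter-∑ P? (x ∷ xs) with P? x
  ... | yes _ = cong suc (length-filter-∑ P? xs)
  ... | no  _ = length-filter-∑ P? xs

  infix 4 _∈[_,+_⟩
  _∈[_,+_⟩ : ℕ → ℕ → ℕ → Set
  x ∈[ a ,+ n ⟩ = a ≤ x × x < a ℕ.+ n

  -- The interval is cut at the residue 0, and a piece with at least a third of its elements is kept.
  integerInterval : ∀ p .{{_ : NonZero p}} a N → ValidInterval p a N → NonzeroInterval a N →
                    ∃ λ a′ → ∃ λ n → 1 ≤ a′ × a′ ℕ.+ n ≤ p × N ≤ 3 ℕ.* n × (∀ {x} → x ∈[ a′ ,+ n ⟩ → InInterval p a N x)
  integerInterval p zero (suc zero) _ nz = ⊥-elim (nz (refl , refl))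
  integerInterval p zero (suc (suc n)) (_ , _ , N≤p) nz = 1 , suc n , ≤-refl , N≤p , 2+n≤ n , λ {x} (_ , x<) → x , x< , sym (ℕ.m<n⇒m%n≡m (<-≤-trans x< N≤p))
    where
    2+n≤ : ∀ n → suc (suc n) ≤ 3 ℕ.* suc n
    2+n≤ n = ≤-trans (m≤m+n (suc (suc n)) (suc (n ℕ.+ n))) (≤-reflexive (e n))
      where e : ∀ n → suc (suc n) ℕ.+ suc (n ℕ.+ n) ≡ 3 ℕ.* suc n
            e = ℕ-Solver.solve-∀
  integerInterval p (suc a) N (a<p , 1≤N , N≤p) nz with m≤n⇒∃[o]m+o≡n a<p
  ... | s′ , refl = go
    where
    A = suc a
    s = suc s′
    P = suc (suc a ℕ.+ s′)
    A+s : A ℕ.+ s ≡ P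
    A+s = +-suc A s′
    first : ∀ n → n ≤ N → n ≤ s → ∀ {x} → x ∈[ A ,+ n ⟩ → InInterval P A N x
    first n n≤N n≤s {x} (A≤x , x<) with m≤n⇒∃[o]m+o≡n A≤x
    ... | t , refl = t , <-≤-trans (+-cancelˡ-< A t n x<) n≤N ,
                     sym (ℕ.m<n⇒m%n≡m (<-≤-trans x< (≤-trans (+-monoʳ-≤ A n≤s) (≤-reflexive A+s))))
    go : _
    go with N ≤? s
    ... | yes N≤s = A , N , s≤s z≤n , ≤-trans (+-monoʳ-≤ A N≤s) (≤-reflexive A+s) , m≤n*m N 3 , (λ {x} → first N ≤-refl N≤s {x})
    ... | no  N≰s with N ≤? 3 ℕ.* s
    ...   | yes N≤3s = A , s , s≤s z≤n , ≤-reflexive A+s , N≤3s , (λ {x} → first s (≰⇒≥ N≰s) ≤-refl {x})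
    ...   | no  N≰3s with m≤n⇒∃[o]m+o≡n (≰⇒> N≰s)
    ...     | m , refl = 1 , m , ≤-refl , ≤-trans (s≤s (m≤n+m m s)) N≤p , N≤3m , (λ {x} → second {x})
      where
      N≤3m : suc s ℕ.+ m ≤ 3 ℕ.* m
      N≤3m = ≤-trans (+-monoˡ-≤ m 1+s≤2m) (≤-reflexive (e₃ m))
        where
        e₃ : ∀ m → 2 ℕ.* m ℕ.+ m ≡ 3 ℕ.* m
        e₃ = ℕ-Solver.solve-∀
        2s≤m : 2 ℕ.* s ≤ m
        2s≤m = +-cancelˡ-≤ (suc s) (2 ℕ.* s) m (≤-trans (≤-reflexive (e₄ s)) (≰⇒> N≰3s))
          where e₄ : ∀ s → suc s ℕ.+ 2 ℕ.* s ≡ suc (3 ℕ.* s)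
                e₄ = ℕ-Solver.solve-∀
        1+s≤2m : suc s ≤ 2 ℕ.* m
        1+s≤2m = ≤-trans (≤-trans (≤-trans (s≤s (m≤n+m s s′)) (≤-reflexive (cong (s ℕ.+_) (sym (+-identityʳ s))))) 2s≤m) (m≤n*m m 2)
      second : ∀ {x} → x ∈[ 1 ,+ m ⟩ → InInterval P A (suc s ℕ.+ m) x
      second {x} (_ , x<1+m) = s ℕ.+ x , ≤-trans (+-monoʳ-< s x<1+m) (≤-reflexive (+-suc s m)) ,
        sym (trans (cong (ℕ._% P) (trans (sym (+-assoc A s x)) (trans (cong (ℕ._+ x) A+s) (+-comm P x))))
            (trans (ℕ.[m+n]%n≡m%n x P) (ℕ.m<n⇒m%n≡m (<-≤-trans x<1+m (≤-trans (s≤s (m≤n+m m s)) N≤p)))))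

  module Sums (p : ℕ) .{{_ : NonZero p}} (prime : Prime p) (i₀ W b Q : ℕ) (1≤b : 1 ≤ b) (b+Q≤p : b ℕ.+ Q ≤ p) where
    open Residues p prime
    open Reciprocals p prime
    open Ratios p prime

    -- Fractions are peeled off by subtraction, so that concatenating two sums is a plain induction;
    -- functions on `Fin n` appear only in the final translation.
    Rep : ℕ → ℤ → Set
    Rep zero    a = a ≈ +0
    Rep (suc n) a = ∃ λ x → ∃ λ y → x ∈[ i₀ ,+ W ⟩ × y ∈[ b ,+ Q ⟩ × Rep n (a - + x * inv (+ y))

    Rep-resp : ∀ n {a a′} → a ≈ a′ → Rep n a → Rep n a′
    Rep-resp zero    h r = ≈-trans (≈-sym h) r
    Rep-resp (suc n) h (x , y , x∈ , y∈ , r) = x , y , x∈ , y∈ , Rep-resp n (≈-minus h (≈-refl {+ x * inv (+ y)})) r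

    Rep-+ : ∀ m n {a c} → Rep m a → Rep n c → Rep (m ℕ.+ n) (a + c)
    Rep-+ zero    n {a} {c} r s = Rep-resp n (≈-lin₁ (- + 1) r (e a c)) s
      where e : ∀ a c → c - (a + c) ≡ - + 1 * (a - +0)
            e = solve-∀
    Rep-+ (suc m) n {a} {c} (x , y , x∈ , y∈ , r) s = x , y , x∈ , y∈ ,
      Rep-resp (m ℕ.+ n) (≈-reflexive (e a c (+ x * inv (+ y)))) (Rep-+ m n r s)
      where e : ∀ a c q → a - q + c ≡ a + c - q
            e = solve-∀

    y-unit : ∀ {y} → y ∈[ b ,+ Q ⟩ → Unit (+ y)
    y-unit (b≤y , y<) = Unit-< (≤-trans 1≤b b≤y) (<-≤-trans y< b+Q≤p)

    1<p : 1 < p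
    1<p = nonTrivial⇒n>1 p {{prime⇒nonTrivial prime}}

    toFunctions : ∀ n {a} → Rep n a →
      Σ (Fin n → ℕ) λ x → Σ (Fin n → ℕ) λ y → (∀ i → x i ∈[ i₀ ,+ W ⟩) × (∀ i → y i ∈[ b ,+ Q ⟩) ×
      + sum (tabulate (λ i → x i ℕ.* rs (inv (+ y i)))) ≈ a
    toFunctions zero    r = (λ ()) , (λ ()) , (λ ()) , (λ ()) , ≈-sym r
    toFunctions (suc n) {a} (x , y , x∈ , y∈ , r) with toFunctions n r
    ... | xs , ys , xs∈ , ys∈ , h = cons x xs , cons y ys , (λ { zero → x∈ ; (suc i) → xs∈ i }) , (λ { zero → y∈ ; (suc i) → ys∈ i }) ,
      ≈-trans (≈-reflexive (trans (pos-+ (x ℕ.* rs (inv (+ y))) S) (cong (_+ + S) (pos-* x (rs (inv (+ y)))))))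
              (≈-lin₂ (+ x) (+ 1) (rs-≈ (inv (+ y))) h (e (+ x) (+ rs (inv (+ y))) (inv (+ y)) (+ S) a))
      where
      cons : ℕ → (Fin n → ℕ) → Fin (suc n) → ℕ
      cons v f zero    = v
      cons v f (suc i) = f i
      S = sum (tabulate (λ i → xs i ℕ.* rs (inv (+ ys i))))
      e : ∀ x z i S a → x * z + S - a ≡ x * (z - i) + + 1 * (S - (a - x * i))
      e = solve-∀

    Rep⇒HasSolution : ∀ {aI NI aJ NJ} → (∀ {x} → x ∈[ i₀ ,+ W ⟩ → InInterval p aI NI x) → (∀ {y} → y ∈[ b ,+ Q ⟩ → InInterval p aJ NJ y) →
                      ∀ n lam → lam < p → Rep n (+ lam) → HasSolution p n aI NI aJ NJ lam
    Rep⇒HasSolution I⊆ J⊆ n lam lam<p r with toFunctions n r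
    ... | x , y , x∈ , y∈ , h = x , y , (λ i → rs (inv (+ y i))) , (λ i → I⊆ (x∈ i)) , (λ i → J⊆ (y∈ i)) ,
      (λ i y≡0 → <⇒≱ 1≤b (≤-trans (proj₁ (y∈ i)) (≤-reflexive y≡0))) ,
      (λ i → rs<p (inv (+ y i)) , trans (rs-cong (≈-trans (≈-reflexive (pos-* (y i) _)) (≈-trans (≈-*ˡ (+ y i) (rs-≈ (inv (+ y i)))) (*-inv (y-unit (y∈ i))))))
                                        (rs-id 1<p)) ,
      trans (rs-cong h) (rs-id lam<p)

    -- Σᵢ x / (y + u vᵢ) = (x / u) Σᵢ 1 / (ξ + vᵢ) for ξ = y / u.
    blocks-Rep : ∀ {V k o vs x y u ξ} → Blocks V k o vs → x ∈[ i₀ ,+ W ⟩ → Unit (+ u) → rs (+ y * inv (+ u)) ≡ ξ →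
                 b ≤ y → y ℕ.+ u ℕ.* (o ℕ.+ k ℕ.* V) ≤ b ℕ.+ Q → .{{NonZero u}} → Rep k (+ x * inv (+ u) * recip (+ ξ) vs)
    blocks-Rep {x = x} {y} {u} [] x∈ uu eq b≤y ≤Q = ≈-reflexive (ℤ.*-zeroʳ (+ x * inv (+ u)))
    blocks-Rep {V} {suc k} {o} {v ∷ vs} {x} {y} {u} {ξ} ((_ , v<) ∷ bs) x∈ uu eq b≤y ≤Q =
      x , y ℕ.+ u ℕ.* v , x∈ , y∈ ,
      Rep-resp k step (blocks-Rep bs x∈ uu eq b≤y (≤-trans (≤-reflexive (cong (λ w → y ℕ.+ u ℕ.* w) (+-assoc o V (k ℕ.* V)))) ≤Q))
      where
      y∈ : (y ℕ.+ u ℕ.* v) ∈[ b ,+ Q ⟩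
      y∈ = ≤-trans b≤y (m≤m+n y _) ,
           <-≤-trans (+-monoʳ-< y (*-monoʳ-< u (<-≤-trans v< (+-monoʳ-≤ o (m≤m+n V (k ℕ.* V)))))) ≤Q
      shift : + u * (+ ξ + + v) ≈ + (y ℕ.+ u ℕ.* v)
      shift = shifted {y} {u} uu eq v
      ξ+v-unit : Unit (+ ξ + + v)
      ξ+v-unit d = Unit-resp (≈-sym shift) (y-unit y∈) (∣n⇒∣m*n (+ u) d)
      inverse : inv (+ u) * inv (+ ξ + + v) ≈ inv (+ (y ℕ.+ u ℕ.* v))
      inverse = inv-unique (y-unit y∈) (≈-trans (≈-*ˡ (inv (+ u) * inv (+ ξ + + v)) (≈-sym shift))
        (≈-lin₂ (inv (+ ξ + + v) * (+ ξ + + v)) (+ 1) (inv-* uu) (inv-* ξ+v-unit) (e (inv (+ u)) (inv (+ ξ + + v)) (+ u) (+ ξ + + v))))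
        where e : ∀ i j u w → i * j * (u * w) - + 1 ≡ j * w * (i * u - + 1) + + 1 * (j * w - + 1)
              e = solve-∀
      step : + x * inv (+ u) * recip (+ ξ) vs ≈ + x * inv (+ u) * (inv (+ ξ + + v) + recip (+ ξ) vs) - + x * inv (+ (y ℕ.+ u ℕ.* v))
      step = ≈-lin₁ (- + x) inverse (e (+ x) (inv (+ u)) (inv (+ ξ + + v)) (recip (+ ξ) vs) (inv (+ (y ℕ.+ u ℕ.* v))))
        where e : ∀ x i j R z → x * i * R - (x * i * (j + R) - x * z) ≡ - x * (i * j - z)
              e = solve-∀

    module _ (U T V k ξ : ℕ) .{{_ : NonZero U}} (U+U≤p : U ℕ.+ U ≤ p) (fits : T ℕ.+ (U ℕ.+ U) ℕ.* (k ℕ.* V) ≤ Q) where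

      InImage : ℕ → Set
      InImage s = 1 ≤ ImageFibres.fibre V k ξ s

      inImage? : ∀ s → Dec (InImage s)
      inImage? s = 1 ≤? ImageFibres.fibre V k ξ s

      fraction-unit′ : ∀ {u t} → (u , t) ∈ fractions U T → Unit (+ u)
      fraction-unit′ {u} {t} i = Unit-< (≤-trans (>-nonZero⁻¹ U) (proj₁ (fraction-∈ {U} {T} {u} {t} i)))
                                 (<-≤-trans (proj₁ (proj₂ (fraction-∈ {U} {T} {u} {t} i))) U+U≤p)

      image-Rep : ∀ {x u t s} → x ∈[ i₀ ,+ W ⟩ → (u , t) ∈ fractions U T → ratio b (u , t) ≡ ξ → InImage s → Rep k (+ x * inv (+ u) * + s)
      image-Rep {x} {u} {t} {s} x∈ i eq pos = conclude (fraction-∈ {U} {T} {u} {t} i) (∑-pos (tuples V k 0) _ pos)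
        where
        conclude : U ≤ u × u < U ℕ.+ U × t < T → (∃ λ vs → vs ∈ tuples V k 0 × 0 < 𝟙 (rs (recip (+ ξ) vs) ≟ s)) → Rep k (+ x * inv (+ u) * + s)
        conclude (U≤u , u<2U , t<T) (vs , vs∈ , q) = Rep-resp k (≈-*ˡ (+ x * inv (+ u))
            (≈-trans (≈-sym (rs-≈ (recip (+ ξ) vs))) (≈-reflexive (cong +_ (𝟙-pos (rs (recip (+ ξ) vs) ≟ s) q)))))
          (blocks-Rep (∈-tuples⁻ V k 0 vs∈) x∈ (fraction-unit′ {u} {t} i) eq (m≤m+n b t) (begin
            b ℕ.+ t ℕ.+ u ℕ.* (k ℕ.* V)                        ≤⟨ +-mono-≤ (+-monoʳ-≤ b (<⇒≤ t<T)) (*-monoˡ-≤ (k ℕ.* V) (<⇒≤ u<2U)) ⟩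
            b ℕ.+ T ℕ.+ (U ℕ.+ U) ℕ.* (k ℕ.* V)                ≡⟨ +-assoc b T _ ⟩
            b ℕ.+ (T ℕ.+ (U ℕ.+ U) ℕ.* (k ℕ.* V))              ≤⟨ +-monoʳ-≤ b fits ⟩
            b ℕ.+ Q                                            ∎) {{>-nonZero (<-≤-trans (>-nonZero⁻¹ U) U≤u)}})
          where open ≤-Reasoning

      -- Each index carries two numerators and two fractions (u, t), hence the form with
      -- coefficients x / u and x′ / u′. Both fractions represent the same ξ, so both coefficients
      -- multiply elements of one and the same set S.
      module Multipliers {A : Set} (xs : List A) (f g : A → ℕ × ℕ × ℕ)
        (f∈ : ∀ {x} → x ∈ xs → proj₁ (f x) ∈[ i₀ ,+ W ⟩ × proj₂ (f x) ∈ fractions U T × ratio b (proj₂ (f x)) ≡ ξ)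
        (g∈ : ∀ {x} → x ∈ xs → proj₁ (g x) ∈[ i₀ ,+ W ⟩ × proj₂ (g x) ∈ fractions U T × ratio b (proj₂ (g x)) ≡ ξ)
        (1≤i₀ : 1 ≤ i₀) (i₀+W≤p : i₀ ℕ.+ W ≤ p) where

        multiplier : ℕ × ℕ × ℕ → ℤ
        multiplier (x , u , _) = + x * inv (+ u)

        α β : A → ℤ
        α x = multiplier (f x)
        β x = multiplier (g x)

        x-unit : ∀ {x} → x ∈[ i₀ ,+ W ⟩ → Unit (+ x)
        x-unit (i₀≤x , x<) = Unit-< (≤-trans 1≤i₀ i₀≤x) (<-≤-trans x< i₀+W≤p)

        α-unit : ∀ {x} → x ∈ xs → Unit (α x)
        α-unit {x} i = Unit-* (x-unit (proj₁ (f∈ i))) (Unit-inv (fraction-unit′ {proj₁ (proj₂ (f x))} {proj₂ (proj₂ (f x))} (proj₁ (proj₂ (f∈ i)))))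

        module C = Cover p prime inImage? xs α β α-unit

        represent : ∀ {a} → C.Represented a → Rep (k ℕ.+ k) a
        represent (x , i , s , t , ps , pt , eq) = Rep-resp (k ℕ.+ k) eq (Rep-+ k k
          (image-Rep {proj₁ (f x)} {proj₁ (proj₂ (f x))} {proj₂ (proj₂ (f x))} {s} (proj₁ (f∈ i)) (proj₁ (proj₂ (f∈ i))) (proj₂ (proj₂ (f∈ i))) ps)
          (image-Rep {proj₁ (g x)} {proj₁ (proj₂ (g x))} {proj₂ (proj₂ (g x))} {t} (proj₁ (g∈ i)) (proj₁ (proj₂ (g∈ i))) (proj₂ (proj₂ (g∈ i))) pt))

        everything : C.Dense → ∀ a → Rep (4 ℕ.* k) a
        everything d a = conclude (C.cover d a)
          where
          e : ∀ k → k ℕ.+ k ℕ.+ (k ℕ.+ k) ≡ 4 ℕ.* k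
          e = ℕ-Solver.solve-∀
          e′ : ∀ a c → c + (a - c) ≡ a
          e′ = solve-∀
          conclude : (∃ λ c → C.Represented c × C.Represented (a - c)) → Rep (4 ℕ.* k) a
          conclude (c , r , r′) = subst (λ n → Rep n a) (e k) (Rep-resp (k ℕ.+ k ℕ.+ (k ℕ.+ k)) (≈-reflexive (e′ a c))
            (Rep-+ (k ℕ.+ k) (k ℕ.+ k) (represent r) (represent r′)))

-- Choice of sizes, and the two regimes with short numerator intervals

module Regimes where
  open Summation
  open Congruence
  open CrossRatios
  open RatioEnergy
  open RichRatios
  open FractionSums
  open import Data.Integer using (+_; _+_; _*_; _-_; -_)
  open import Data.Integer.Properties using (pos-+; pos-*)
  open import Data.Integer.Tactic.RingSolver using (solve-∀)
  open import Data.Nat using (ℕ; suc; NonZero; z≤n; s≤s; _^_; _≤?_; _≟_; _≤_; _<_; >-nonZero; >-nonZero⁻¹)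
  open import Data.Nat.Properties

  m*m≤n*n⇒m≤n : ∀ {m n} → m ℕ.* m ≤ n ℕ.* n → m ≤ n
  m*m≤n*n⇒m≤n {m} {n} h with m ≤? n
  ... | yes m≤n = m≤n
  ... | no  m≰n = ⊥-elim (<⇒≱ (*-mono-< (≰⇒> m≰n) (≰⇒> m≰n)) h)

  -- The sizes U and M of the fractions y / u with u ∈ [U, 2U), y in an interval of length r M.
  record Sizes (p k V r Q : ℕ) : Set where
    field
      U M     : ℕ
      U-pos   : 1 ≤ U
      4UM≤p   : 4 ℕ.* (U ℕ.* M) ≤ p
      U≤M     : U ≤ M
      2U≤p    : U ℕ.+ U ≤ p
      fits    : r ℕ.* M ℕ.+ (U ℕ.+ U) ℕ.* (k ℕ.* V) ≤ Q
      enough  : V ^ k ≤ 16 ℕ.* (U ℕ.* M)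

  -- The range r M of y takes about an eighth of the Q available denominators. U is the least
  -- integer with U Q > V^k r, which makes U M comparable with V^k, as many fractions as tuples. The
  -- last hypothesis is what lets the shifts fit: with w = 16 k V and u = U - 1 it gives w u Q ≤ w
  -- V^k r ≤ Q².
  chooseSizes : ∀ p k V r Q .{{_ : NonZero k}} .{{_ : NonZero V}} .{{_ : NonZero r}} → Q ≤ p → V ^ k ≤ p →
                r ℕ.* r ℕ.* (16 ℕ.* k ℕ.* V) ^ suc k ≤ Q ℕ.* Q → Sizes p k V r Q
  chooseSizes p k V r Q Q≤p V^k≤p small = record
    { U = suc u ; M = M ; U-pos = s≤s z≤n ; 4UM≤p = 4UM≤p ; U≤M = U≤M
    ; 2U≤p = ≤-trans (≤-trans (m≤m+n (suc u ℕ.+ suc u) (suc u ℕ.+ suc u)) (≤-trans (≤-reflexive (e₀ (suc u))) (*-monoʳ-≤ 4 (m≤m*n (suc u) M {{>-nonZero M>0}})))) 4UM≤p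
    ; fits = fits ; enough = enough }
    where
    open ≤-Reasoning
    w = 16 ℕ.* k ℕ.* V
    instance
      wnz : NonZero w
      wnz = m*n≢0 (16 ℕ.* k) V {{m*n≢0 16 k}}
      wknz : NonZero (w ^ k)
      wknz = m^n≢0 w k
      rwnz : NonZero (r ℕ.* w)
      rwnz = m*n≢0 r w
      8rnz : NonZero (8 ℕ.* r)
      8rnz = m*n≢0 8 r
    16≤w : 16 ≤ w
    16≤w = ≤-trans (m≤m*n 16 k) (m≤m*n (16 ℕ.* k) V)
    V^k≤w^k : V ^ k ≤ w ^ k
    V^k≤w^k = ^-monoˡ-≤ k (m≤n*m V (16 ℕ.* k) {{m*n≢0 16 k}})
    w≤w^k : w ≤ w ^ k
    w≤w^k = ≤-trans (≤-reflexive (sym (*-identityʳ w))) (^-monoʳ-≤ w (>-nonZero⁻¹ k))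
    rw≤Q : r ℕ.* w ≤ Q
    rw≤Q = m*m≤n*n⇒m≤n (≤-trans (≤-reflexive (e₁ r w)) (≤-trans (*-monoʳ-≤ (r ℕ.* r) (*-monoʳ-≤ w w≤w^k)) small))
      where e₁ : ∀ r w → r ℕ.* w ℕ.* (r ℕ.* w) ≡ r ℕ.* r ℕ.* (w ℕ.* w)
            e₁ = ℕ-Solver.solve-∀
    instance
      Qnz : NonZero Q
      Qnz = >-nonZero (<-≤-trans (>-nonZero⁻¹ (r ℕ.* w)) rw≤Q)
    u = V ^ k ℕ.* r ℕ./ Q
    M = Q ℕ./ (8 ℕ.* r)
    e₀ : ∀ u → u ℕ.+ u ℕ.+ (u ℕ.+ u) ≡ 4 ℕ.* u
    e₀ = ℕ-Solver.solve-∀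
    uQ≤ : u ℕ.* Q ≤ V ^ k ℕ.* r
    uQ≤ = ℕ.m/n*n≤m (V ^ k ℕ.* r) Q
    <UQ : V ^ k ℕ.* r < suc u ℕ.* Q
    <UQ = begin-strict
      V ^ k ℕ.* r                              ≡⟨ ℕ.m≡m%n+[m/n]*n (V ^ k ℕ.* r) Q ⟩
      V ^ k ℕ.* r ℕ.% Q ℕ.+ u ℕ.* Q            <⟨ +-monoˡ-< (u ℕ.* Q) (ℕ.m%n<n (V ^ k ℕ.* r) Q) ⟩
      Q ℕ.+ u ℕ.* Q                            ∎
    scaled : ∀ c → c ≤ r ℕ.* w → c ℕ.* u ≤ Q
    scaled c c≤rw = *-cancelʳ-≤ (c ℕ.* u) Q Q (begin
      c ℕ.* u ℕ.* Q                            ≡⟨ *-assoc c u Q ⟩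
      c ℕ.* (u ℕ.* Q)                          ≤⟨ *-mono-≤ c≤rw (≤-trans uQ≤ (*-monoˡ-≤ r V^k≤w^k)) ⟩
      r ℕ.* w ℕ.* (w ^ k ℕ.* r)                ≡⟨ e₁ r w (w ^ k) ⟩
      r ℕ.* r ℕ.* (w ℕ.* w ^ k)                ≤⟨ small ⟩
      Q ℕ.* Q                                  ∎)
      where e₁ : ∀ r w x → r ℕ.* w ℕ.* (x ℕ.* r) ≡ r ℕ.* r ℕ.* (w ℕ.* x)
            e₁ = ℕ-Solver.solve-∀
    16r≤Q : 16 ℕ.* r ≤ Q
    16r≤Q = ≤-trans (≤-trans (*-monoˡ-≤ r 16≤w) (≤-reflexive (*-comm w r))) rw≤Q
    U≤M : suc u ≤ M
    U≤M = m*n≤o⇒m≤o/n {suc u} {8 ℕ.* r} {Q} (*-cancelˡ-≤ 2 (begin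
      2 ℕ.* (suc u ℕ.* (8 ℕ.* r))              ≡⟨ e₁ u r ⟩
      16 ℕ.* r ℕ.+ 16 ℕ.* r ℕ.* u              ≤⟨ +-mono-≤ 16r≤Q (scaled (16 ℕ.* r) (≤-trans (*-monoˡ-≤ r 16≤w) (≤-reflexive (*-comm w r)))) ⟩
      Q ℕ.+ Q                                  ≡⟨ cong (Q ℕ.+_) (sym (+-identityʳ Q)) ⟩
      2 ℕ.* Q                                  ∎))
      where e₁ : ∀ u r → 2 ℕ.* (suc u ℕ.* (8 ℕ.* r)) ≡ 16 ℕ.* r ℕ.+ 16 ℕ.* r ℕ.* u
            e₁ = ℕ-Solver.solve-∀
    M>0 : 1 ≤ M
    M>0 = ≤-trans (s≤s z≤n) U≤M
    M8r≤Q : M ℕ.* (8 ℕ.* r) ≤ Q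
    M8r≤Q = ℕ.m/n*n≤m Q (8 ℕ.* r)
    Q≤16Mr : Q ≤ 16 ℕ.* (M ℕ.* r)
    Q≤16Mr = begin
      Q                                               ≡⟨ ℕ.m≡m%n+[m/n]*n Q (8 ℕ.* r) ⟩
      Q ℕ.% (8 ℕ.* r) ℕ.+ M ℕ.* (8 ℕ.* r)             ≤⟨ +-monoˡ-≤ _ (≤-trans (<⇒≤ (ℕ.m%n<n Q (8 ℕ.* r))) (m≤n*m (8 ℕ.* r) M {{>-nonZero M>0}})) ⟩
      M ℕ.* (8 ℕ.* r) ℕ.+ M ℕ.* (8 ℕ.* r)             ≡⟨ e₁ M r ⟩
      16 ℕ.* (M ℕ.* r)                                ∎
      where e₁ : ∀ M r → M ℕ.* (8 ℕ.* r) ℕ.+ M ℕ.* (8 ℕ.* r) ≡ 16 ℕ.* (M ℕ.* r)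
            e₁ = ℕ-Solver.solve-∀
    enough : V ^ k ≤ 16 ℕ.* (suc u ℕ.* M)
    enough = *-cancelʳ-≤ (V ^ k) _ r (begin
      V ^ k ℕ.* r                              ≤⟨ <⇒≤ <UQ ⟩
      suc u ℕ.* Q                              ≤⟨ *-monoʳ-≤ (suc u) Q≤16Mr ⟩
      suc u ℕ.* (16 ℕ.* (M ℕ.* r))             ≡⟨ e₁ (suc u) M r ⟩
      16 ℕ.* (suc u ℕ.* M) ℕ.* r               ∎)
      where e₁ : ∀ u M r → u ℕ.* (16 ℕ.* (M ℕ.* r)) ≡ 16 ℕ.* (u ℕ.* M) ℕ.* r
            e₁ = ℕ-Solver.solve-∀
    8uM≤p : 8 ℕ.* (u ℕ.* M) ≤ p
    8uM≤p = *-cancelʳ-≤ (8 ℕ.* (u ℕ.* M)) p r (begin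
      8 ℕ.* (u ℕ.* M) ℕ.* r                    ≡⟨ e₁ u M r ⟩
      u ℕ.* (M ℕ.* (8 ℕ.* r))                  ≤⟨ *-monoʳ-≤ u M8r≤Q ⟩
      u ℕ.* Q                                  ≤⟨ uQ≤ ⟩
      V ^ k ℕ.* r                              ≤⟨ *-monoˡ-≤ r V^k≤p ⟩
      p ℕ.* r                                  ∎)
      where e₁ : ∀ u M r → 8 ℕ.* (u ℕ.* M) ℕ.* r ≡ u ℕ.* (M ℕ.* (8 ℕ.* r))
            e₁ = ℕ-Solver.solve-∀
    8M≤p : 8 ℕ.* M ≤ p
    8M≤p = ≤-trans (≤-trans (m≤m*n (8 ℕ.* M) r) (≤-trans (≤-reflexive (e₁ M r)) M8r≤Q)) Q≤p
      where e₁ : ∀ M r → 8 ℕ.* M ℕ.* r ≡ M ℕ.* (8 ℕ.* r)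
            e₁ = ℕ-Solver.solve-∀
    4UM≤p : 4 ℕ.* (suc u ℕ.* M) ≤ p
    4UM≤p = *-cancelˡ-≤ 2 (begin
      2 ℕ.* (4 ℕ.* (suc u ℕ.* M))              ≡⟨ e₁ u M ⟩
      8 ℕ.* M ℕ.+ 8 ℕ.* (u ℕ.* M)              ≤⟨ +-mono-≤ 8M≤p 8uM≤p ⟩
      p ℕ.+ p                                  ≡⟨ cong (p ℕ.+_) (sym (+-identityʳ p)) ⟩
      2 ℕ.* p                                  ∎)
      where e₁ : ∀ u M → 2 ℕ.* (4 ℕ.* (suc u ℕ.* M)) ≡ 8 ℕ.* M ℕ.+ 8 ℕ.* (u ℕ.* M)
            e₁ = ℕ-Solver.solve-∀
    fits : r ℕ.* M ℕ.+ (suc u ℕ.+ suc u) ℕ.* (k ℕ.* V) ≤ Q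
    fits = *-cancelˡ-≤ 8 (begin
      8 ℕ.* (r ℕ.* M ℕ.+ (suc u ℕ.+ suc u) ℕ.* (k ℕ.* V))      ≡⟨ e₁ r M u k V ⟩
      M ℕ.* (8 ℕ.* r) ℕ.+ (w ℕ.+ w ℕ.* u)                      ≤⟨ +-mono-≤ M8r≤Q (+-mono-≤ (≤-trans (m≤n*m w r) rw≤Q) (scaled w (m≤n*m w r))) ⟩
      Q ℕ.+ (Q ℕ.+ Q)                                          ≤⟨ m≤m+n _ (5 ℕ.* Q) ⟩
      Q ℕ.+ (Q ℕ.+ Q) ℕ.+ 5 ℕ.* Q                              ≡⟨ e₂ Q ⟩
      8 ℕ.* Q                                                  ∎)
      where e₁ : ∀ r M u k V → 8 ℕ.* (r ℕ.* M ℕ.+ (suc u ℕ.+ suc u) ℕ.* (k ℕ.* V)) ≡ M ℕ.* (8 ℕ.* r) ℕ.+ (16 ℕ.* k ℕ.* V ℕ.+ 16 ℕ.* k ℕ.* V ℕ.* u)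
            e₁ = ℕ-Solver.solve-∀
            e₂ : ∀ Q → Q ℕ.+ (Q ℕ.+ Q) ℕ.+ 5 ℕ.* Q ≡ 8 ℕ.* Q
            e₂ = ℕ-Solver.solve-∀

  -- The factor by which S may fall short of V^k according to `richRatio`.
  imageLoss : ℕ → ℕ → ℕ
  imageLoss k L = 5124 ℕ.* (k ℕ.* L)

  module Regimes (p : ℕ) .{{_ : NonZero p}} (prime : Prime p) (L : ℕ) .{{_ : NonZero L}} (p<2^L : p < 2 ^ L)
                 (i₀ W b Q : ℕ) (1≤i₀ : 1 ≤ i₀) (i₀+W≤p : i₀ ℕ.+ W ≤ p) (1≤b : 1 ≤ b) (b+Q≤p : b ℕ.+ Q ≤ p)
                 (k V r : ℕ) .{{_ : NonZero k}} .{{_ : NonZero V}} .{{_ : NonZero r}}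
                 (V^k≤p : V ^ k ≤ p) (small : r ℕ.* r ℕ.* (16 ℕ.* k ℕ.* V) ^ suc k ≤ Q ℕ.* Q) where
    open Residues p prime
    open Energy p prime
    open Ratios p prime
    open Sums p prime i₀ W b Q 1≤b b+Q≤p

    open Sizes (chooseSizes p k V r Q (≤-trans (m≤n+m Q b) b+Q≤p) V^k≤p small)

    private instance
      Unz : NonZero U
      Unz = >-nonZero U-pos

    K : ℕ
    K = imageLoss k L

    Rich : ℕ → ℕ → Set
    Rich g ξ = suc g ≤ RatioFibres.fibre b U (r ℕ.* M) ξ ×
               V ^ k ≤ K ℕ.* ∑ (upTo p) (λ s → 𝟙 (1 ≤? ImageFibres.fibre V k ξ s))

    rich : ∀ g → 32 ℕ.* (p ℕ.* g) ≤ r ℕ.* V ^ k → ∃ λ ξ → Rich g ξ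
    rich g h = conclude (richRatio b U M r L V k g 4UM≤p (≤-<-trans 2U≤p p<2^L) U≤M 1≤b
      (≤-trans (≤-reflexive (+-assoc b (r ℕ.* M) _)) (≤-trans (+-monoʳ-≤ b fits) b+Q≤p)) popularity enough)
      where
      open ≤-Reasoning
      conclude : _ → ∃ λ ξ → Rich g ξ
      conclude (ξ , _ , q , q′) = ξ , q , q′
      popularity : 2 ℕ.* (p ℕ.* g) ≤ U ℕ.* (r ℕ.* M)
      popularity = *-cancelˡ-≤ 16 (begin
        16 ℕ.* (2 ℕ.* (p ℕ.* g))       ≡⟨ *-assoc 16 2 (p ℕ.* g) ⟨
        32 ℕ.* (p ℕ.* g)               ≤⟨ h ⟩
        r ℕ.* V ^ k                    ≤⟨ *-monoʳ-≤ r enough ⟩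
        r ℕ.* (16 ℕ.* (U ℕ.* M))       ≡⟨ e r U M ⟩
        16 ℕ.* (U ℕ.* (r ℕ.* M))       ∎)
        where e : ∀ r U M → r ℕ.* (16 ℕ.* (U ℕ.* M)) ≡ 16 ℕ.* (U ℕ.* (r ℕ.* M))
              e = ℕ-Solver.solve-∀

    image-large : ∀ {S X n} → V ^ k ≤ K ℕ.* S → K ℕ.* K ℕ.* X < V ^ k ℕ.* V ^ k ℕ.* n → X < S ℕ.* S ℕ.* n
    image-large {S} {X} {n} h lt = *-cancelˡ-< (K ℕ.* K) X (S ℕ.* S ℕ.* n) (begin-strict
      K ℕ.* K ℕ.* X                      <⟨ lt ⟩
      V ^ k ℕ.* V ^ k ℕ.* n              ≤⟨ *-monoˡ-≤ n (*-mono-≤ h h) ⟩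
      K ℕ.* S ℕ.* (K ℕ.* S) ℕ.* n        ≡⟨ e K S n ⟩
      K ℕ.* K ℕ.* (S ℕ.* S ℕ.* n)        ∎)
      where
      open ≤-Reasoning
      e : ∀ K S n → K ℕ.* S ℕ.* (K ℕ.* S) ℕ.* n ≡ K ℕ.* K ℕ.* (S ℕ.* S ℕ.* n)
      e = ℕ-Solver.solve-∀

    -- Many numerators: the multipliers x / u and (x + d) / u with u fixed.
    manyNumerators : ∀ D .{{_ : NonZero D}} → 3 ℕ.* D ≤ W → 4 ℕ.* (D ℕ.* D) ≤ p →
                     K ℕ.* K ℕ.* (20 ℕ.* (p ℕ.* p) ℕ.* L) < V ^ k ℕ.* V ^ k ℕ.* (D ℕ.* D) → ∀ a → Rep (4 ℕ.* k) a
    manyNumerators D 3D≤W 4DD≤p big = conclude (rich 0 (subst (_≤ r ℕ.* V ^ k) (sym (cong (32 ℕ.*_) (*-zeroʳ p))) z≤n))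
      where
      open ≤-Reasoning
      D+D≤p : D ℕ.+ D ≤ p
      D+D≤p = ≤-trans (≤-trans (≤-reflexive (cong (D ℕ.+_) (sym (+-identityʳ D)))) (*-mono-≤ (s≤s (s≤s (z≤n {2}))) (m≤m*n D D))) 4DD≤p
      -- Pairs (d, t) with D ≤ d < 2 D and t < D, for the numerators i₀ + t and i₀ + t + d; hence 3
      -- D ≤ W.
      xs = fractions D (1 ℕ.* D)
      conclude : (∃ λ ξ → Rich 0 ξ) → ∀ a → Rep (4 ℕ.* k) a
      conclude (ξ , ne , h) = withFraction (fibre-member {b} {U} {r ℕ.* M} {ξ} ne)
        where
        withFraction : (∃ λ x → x ∈ fractions U (r ℕ.* M) × ratio b x ≡ ξ) → ∀ a → Rep (4 ℕ.* k) a
        withFraction (ut , ut∈ , eq) = Mul.everything (Mul.C.dense dense)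
          where
          f g : ℕ × ℕ → ℕ × ℕ × ℕ
          f (d , t) = i₀ ℕ.+ t , ut
          g (d , t) = i₀ ℕ.+ t ℕ.+ d , ut
          f∈ : ∀ {x} → x ∈ xs → proj₁ (f x) ∈[ i₀ ,+ W ⟩ × proj₂ (f x) ∈ fractions U (r ℕ.* M) × ratio b (proj₂ (f x)) ≡ ξ
          f∈ {d , t} i = (m≤m+n i₀ t , <-≤-trans (+-monoʳ-< i₀ (proj₂ (proj₂ (fraction-∈ {D} {1 ℕ.* D} {d} {t} i))))
                           (+-monoʳ-≤ i₀ (≤-trans (*-monoˡ-≤ D (s≤s (z≤n {2}))) 3D≤W))) , ut∈ , eq
          g∈ : ∀ {x} → x ∈ xs → proj₁ (g x) ∈[ i₀ ,+ W ⟩ × proj₂ (g x) ∈ fractions U (r ℕ.* M) × ratio b (proj₂ (g x)) ≡ ξ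
          g∈ {d , t} i = (≤-trans (m≤m+n i₀ t) (m≤m+n (i₀ ℕ.+ t) d) , (begin-strict
              i₀ ℕ.+ t ℕ.+ d                        <⟨ +-mono-< (+-monoʳ-< i₀ (proj₂ (proj₂ (fraction-∈ {D} {1 ℕ.* D} {d} {t} i)))) (proj₁ (proj₂ (fraction-∈ {D} {1 ℕ.* D} {d} {t} i))) ⟩
              i₀ ℕ.+ 1 ℕ.* D ℕ.+ (D ℕ.+ D)          ≡⟨ e₁ i₀ D ⟩
              i₀ ℕ.+ 3 ℕ.* D                        ≤⟨ +-monoʳ-≤ i₀ 3D≤W ⟩
              i₀ ℕ.+ W                              ∎)) , ut∈ , eq
            where e₁ : ∀ i D → i ℕ.+ 1 ℕ.* D ℕ.+ (D ℕ.+ D) ≡ i ℕ.+ 3 ℕ.* D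
                  e₁ = ℕ-Solver.solve-∀
          module Mul = Multipliers U (r ℕ.* M) V k ξ 2U≤p fits xs f g f∈ g∈ 1≤i₀ i₀+W≤p
          -- The condition x (x′ + d′) = x′ (x + d) simplifies to x d′ = x′ d. So two forms are
          -- dependent exactly when the ratios x / d agree, and the energy bound is used a second
          -- time, with x in the role of y, d in the role of u, and U = M = D.
          energy≤ : Mul.C.energy ≤ 1 ℕ.* 1 ℕ.* (10 ℕ.* (D ℕ.* D ℕ.* L))
          energy≤ = ≤-trans (∑-mono xs (λ (d , t) → ∑-mono xs (λ (d′ , t′) →
              𝟙-mono (Mul.C.dependent (d , t) (d′ , t′)) (sameRatio (i₀ ℕ.+ t) d (i₀ ℕ.+ t′) d′) (same d t d′ t′))))
            (crossEnergy-≤ i₀ D D 1 L 4DD≤p (≤-<-trans D+D≤p p<2^L) ≤-refl D+D≤p)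
            where
            j = inv (+ proj₁ ut)
            j-unit : Unit j
            j-unit = Unit-inv (fraction-unit′ U (r ℕ.* M) V k ξ 2U≤p fits {proj₁ ut} {proj₂ ut} ut∈)
            e₂ : ∀ j x d x′ d′ → j * (j * (x * d′)) - j * (j * (x′ * d)) ≡ + 1 * (x * j * ((x′ + d′) * j) - x′ * j * ((x + d) * j))
            e₂ = solve-∀
            same : ∀ d t d′ t′ → Mul.α (d , t) * Mul.β (d′ , t′) ≈ Mul.α (d′ , t′) * Mul.β (d , t) → + ((i₀ ℕ.+ t) ℕ.* d′) ≈ + ((i₀ ℕ.+ t′) ℕ.* d)
            same d t d′ t′ h = subst₂ _≈_ (sym (pos-* x d′)) (sym (pos-* x′ d)) (≈-cancelˡ j-unit (≈-cancelˡ j-unit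
                (≈-lin₁ (+ 1) (subst₂ _≈_ (cong (λ v → + x * j * (v * j)) (pos-+ x′ d′)) (cong (λ v → + x′ * j * (v * j)) (pos-+ x d)) h)
                  (e₂ j (+ x) (+ d) (+ x′) (+ d′)))))
              where x = i₀ ℕ.+ t
                    x′ = i₀ ℕ.+ t′
          dense : 2 ℕ.* (p ℕ.* p) ℕ.* Mul.C.energy < Mul.C.size ℕ.* Mul.C.size ℕ.* (length xs ℕ.* length xs)
          dense = begin-strict
            2 ℕ.* (p ℕ.* p) ℕ.* Mul.C.energy                               ≤⟨ *-monoʳ-≤ (2 ℕ.* (p ℕ.* p)) energy≤ ⟩
            2 ℕ.* (p ℕ.* p) ℕ.* (1 ℕ.* 1 ℕ.* (10 ℕ.* (D ℕ.* D ℕ.* L)))     ≡⟨ e₃ (p ℕ.* p) D L ⟩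
            20 ℕ.* (p ℕ.* p) ℕ.* L ℕ.* (D ℕ.* D)                           <⟨ *-monoˡ-< (D ℕ.* D) {{m*n≢0 D D}} (image-large h big) ⟩
            Mul.C.size ℕ.* Mul.C.size ℕ.* (D ℕ.* D) ℕ.* (D ℕ.* D)          ≡⟨ e₄ (Mul.C.size ℕ.* Mul.C.size) D ⟩
            Mul.C.size ℕ.* Mul.C.size ℕ.* (D ℕ.* (1 ℕ.* D) ℕ.* (D ℕ.* (1 ℕ.* D))) ≡⟨ cong (λ v → Mul.C.size ℕ.* Mul.C.size ℕ.* (v ℕ.* v)) (sym (length-fractions D (1 ℕ.* D))) ⟩
            Mul.C.size ℕ.* Mul.C.size ℕ.* (length xs ℕ.* length xs)        ∎
            where
            e₃ : ∀ P D L → 2 ℕ.* P ℕ.* (1 ℕ.* 1 ℕ.* (10 ℕ.* (D ℕ.* D ℕ.* L))) ≡ 20 ℕ.* P ℕ.* L ℕ.* (D ℕ.* D)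
            e₃ = ℕ-Solver.solve-∀
            e₄ : ∀ S D → S ℕ.* (D ℕ.* D) ℕ.* (D ℕ.* D) ≡ S ℕ.* (D ℕ.* (1 ℕ.* D) ℕ.* (D ℕ.* (1 ℕ.* D)))
            e₄ = ℕ-Solver.solve-∀

    -- Few numerators: the multipliers i₀ / u and i₀ / u₀, with u varying over the many representations ξ = y / u.
    manyDenominators : ∀ g → 1 ≤ W → 32 ℕ.* (p ℕ.* g) ≤ r ℕ.* V ^ k →
                       K ℕ.* K ℕ.* (2 ℕ.* (p ℕ.* p)) < V ^ k ℕ.* V ^ k ℕ.* suc g → ∀ a → Rep (4 ℕ.* k) a
    manyDenominators g 1≤W popularity big = conclude (rich g popularity)
      where
      open ≤-Reasoning
      conclude : (∃ λ ξ → Rich g ξ) → ∀ a → Rep (4 ℕ.* k) a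
      conclude (ξ , many , h) = withFraction (fibre-member {b} {U} {r ℕ.* M} {ξ} (≤-trans (s≤s z≤n) many))
        where
        xs = filter (λ x → ratio b x ≟ ξ) (fractions U (r ℕ.* M))
        xs-unique : Unique xs
        xs-unique = filter⁺ (λ x → ratio b x ≟ ξ) (cartesianProduct⁺ (range-unique U U) (upTo⁺ (r ℕ.* M)))
        xs-length : length xs ≡ RatioFibres.fibre b U (r ℕ.* M) ξ
        xs-length = length-filter-∑ (λ x → ratio b x ≟ ξ) (fractions U (r ℕ.* M))
        withFraction : (∃ λ x → x ∈ fractions U (r ℕ.* M) × ratio b x ≡ ξ) → ∀ a → Rep (4 ℕ.* k) a
        withFraction (ut , ut∈ , eq) = Mul.everything (Mul.C.dense dense)
          where
          f g′ : ℕ × ℕ → ℕ × ℕ × ℕ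
          f x = i₀ , x
          g′ x = i₀ , ut
          i₀∈ : i₀ ∈[ i₀ ,+ W ⟩
          i₀∈ = ≤-refl , ≤-trans (≤-reflexive (+-comm 1 i₀)) (+-monoʳ-≤ i₀ 1≤W)
          f∈ : ∀ {x} → x ∈ xs → proj₁ (f x) ∈[ i₀ ,+ W ⟩ × proj₂ (f x) ∈ fractions U (r ℕ.* M) × ratio b (proj₂ (f x)) ≡ ξ
          f∈ i = i₀∈ , ∈-filter⁻ (λ x → ratio b x ≟ ξ) {xs = fractions U (r ℕ.* M)} i
          g∈ : ∀ {x} → x ∈ xs → proj₁ (g′ x) ∈[ i₀ ,+ W ⟩ × proj₂ (g′ x) ∈ fractions U (r ℕ.* M) × ratio b (proj₂ (g′ x)) ≡ ξ
          g∈ i = i₀∈ , ut∈ , eq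
          module Mul = Multipliers U (r ℕ.* M) V k ξ 2U≤p fits xs f g′ f∈ g∈ 1≤i₀ i₀+W≤p
          i₀-unit : Unit (+ i₀)
          i₀-unit = Mul.x-unit i₀∈
          unit : ∀ {u t} → (u , t) ∈ fractions U (r ℕ.* M) → Unit (+ u)
          unit {u} {t} = fraction-unit′ U (r ℕ.* M) V k ξ 2U≤p fits {u} {t}
          u<p : ∀ {u t} → (u , t) ∈ fractions U (r ℕ.* M) → u < p
          u<p {u} {t} i = <-≤-trans (proj₁ (proj₂ (fraction-∈ {U} {r ℕ.* M} {u} {t} i))) 2U≤p
          y<p : ∀ {u t} → (u , t) ∈ fractions U (r ℕ.* M) → b ℕ.+ t < p
          y<p {u} {t} i = <-≤-trans (+-monoʳ-< b (proj₂ (proj₂ (fraction-∈ {U} {r ℕ.* M} {u} {t} i))))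
                            (≤-trans (+-monoʳ-≤ b (≤-trans (m≤m+n (r ℕ.* M) _) fits)) b+Q≤p)
          recover : ∀ {u t} → (u , t) ∈ xs → + (b ℕ.+ t) ≈ + u * + ξ
          recover {u} {t} i = conclude₁ (∈-filter⁻ (λ x → ratio b x ≟ ξ) {xs = fractions U (r ℕ.* M)} i)
            where
            e₁ : ∀ y u v → y - u * (y * v) ≡ - y * (v * u - + 1)
            e₁ = solve-∀
            conclude₁ : (u , t) ∈ fractions U (r ℕ.* M) × ratio b (u , t) ≡ ξ → + (b ℕ.+ t) ≈ + u * + ξ
            conclude₁ (i′ , q) = ≈-trans (≈-lin₁ (- + (b ℕ.+ t)) (inv-* (unit {u} {t} i′)) (e₁ (+ (b ℕ.+ t)) (+ u) (inv (+ u))))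
              (≈-*ˡ (+ u) (≈-trans (≈-sym (rs-≈ (+ (b ℕ.+ t) * inv (+ u)))) (≈-reflexive (cong +_ q))))
          -- The two coefficients have ratio u₀ / u, so dependence forces u = u′; then y ≡ u ξ
          -- forces y = y′.
          same : ∀ {x y} → x ∈ xs → y ∈ xs → Mul.α x * Mul.β y ≈ Mul.α y * Mul.β x → x ≡ y
          same {u , t} {u′ , t′} i i′ h′ = conclude₂ (proj₁ (∈-filter⁻ (λ x → ratio b x ≟ ξ) {xs = fractions U (r ℕ.* M)} i))
                                                     (proj₁ (∈-filter⁻ (λ x → ratio b x ≟ ξ) {xs = fractions U (r ℕ.* M)} i′))
            where
            c = + i₀ * inv (+ proj₁ ut)
            c-unit : Unit c
            c-unit = Unit-* i₀-unit (Unit-inv (unit {proj₁ ut} {proj₂ ut} ut∈))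
            e₂ : ∀ c i j j′ → c * (i * j) - c * (i * j′) ≡ + 1 * (i * j * c - i * j′ * c)
            e₂ = solve-∀
            inverses : inv (+ u) ≈ inv (+ u′)
            inverses = ≈-cancelˡ i₀-unit (≈-cancelˡ c-unit (≈-lin₁ (+ 1) h′ (e₂ c (+ i₀) (inv (+ u)) (inv (+ u′)))))
            conclude₂ : (u , t) ∈ fractions U (r ℕ.* M) → (u′ , t′) ∈ fractions U (r ℕ.* M) → (u , t) ≡ (u′ , t′)
            conclude₂ k₁ k₂ = cong₂ _,_ u≡u′ (+-cancelˡ-≡ b t t′ (≈⇒≡ (y<p {u} {t} k₁) (y<p {u′} {t′} k₂)
                (≈-trans (recover {u} {t} i) (≈-trans (≈-reflexive (cong (λ v → + v * + ξ) u≡u′)) (≈-sym (recover {u′} {t′} i′))))))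
              where
              e₄ : ∀ u u′ j → u′ - u ≡ u′ * (- + 1) * (j * u - + 1) + u * (j * u′ - + 1)
              e₄ = solve-∀
              u≡u′ : u ≡ u′
              u≡u′ = sym (≈⇒≡ (u<p {u′} {t′} k₂) (u<p {u} {t} k₁)
                (≈-lin₂ (+ u′ * (- + 1)) (+ u) (inv-* (unit {u} {t} k₁))
                  (≈-trans (≈-* inverses (≈-refl {+ u′})) (inv-* (unit {u′} {t′} k₂))) (e₄ (+ u) (+ u′) (inv (+ u)))))
          energy≤ : Mul.C.energy ≤ length xs
          energy≤ = ≤-trans (∑-≤const xs 1 λ {x} i → ∑-≤1 xs (λ y → 𝟙 (Mul.C.dependent x y)) xs-unique (λ y → 𝟙-≤1 (Mul.C.dependent x y))
                      (λ {y} {z} j j′ q q′ → trans (sym (same i j (𝟙-pos (Mul.C.dependent x y) q))) (same i j′ (𝟙-pos (Mul.C.dependent x z) q′))))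
                    (≤-reflexive (*-identityʳ (length xs)))
          length>g : suc g ≤ length xs
          length>g = ≤-trans many (≤-reflexive (sym xs-length))
          dense : 2 ℕ.* (p ℕ.* p) ℕ.* Mul.C.energy < Mul.C.size ℕ.* Mul.C.size ℕ.* (length xs ℕ.* length xs)
          dense = begin-strict
            2 ℕ.* (p ℕ.* p) ℕ.* Mul.C.energy                        ≤⟨ *-monoʳ-≤ (2 ℕ.* (p ℕ.* p)) energy≤ ⟩
            2 ℕ.* (p ℕ.* p) ℕ.* length xs                           <⟨ *-monoˡ-< (length xs) {{>-nonZero (<-≤-trans (s≤s z≤n) length>g)}} (image-large h big) ⟩
            Mul.C.size ℕ.* Mul.C.size ℕ.* suc g ℕ.* length xs       ≤⟨ *-monoˡ-≤ (length xs) (*-monoʳ-≤ (Mul.C.size ℕ.* Mul.C.size) length>g) ⟩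
            Mul.C.size ℕ.* Mul.C.size ℕ.* length xs ℕ.* length xs   ≡⟨ *-assoc (Mul.C.size ℕ.* Mul.C.size) (length xs) (length xs) ⟩
            Mul.C.size ℕ.* Mul.C.size ℕ.* (length xs ℕ.* length xs) ∎

-- Chinese remainders and coprime progressions

module ChineseRemainder where
  open Congruence
  import Data.Fin.Properties as Fin
  open import Data.Fin as Fin using (Fin; toℕ; fromℕ<)
  open import Data.Integer using (+_; _+_; _*_; _-_; -_; +0)
  open import Data.Integer.DivMod using (_%ℕ_; _/ℕ_; n%ℕd<d; a≡a%ℕn+[a/ℕn]*n)
  open import Data.Integer.Divisibility.Signed
  open import Data.Integer.Properties using (pos-+; pos-*)
  open import Data.Integer.Tactic.RingSolver using (solve-∀)
  open import Data.List.Relation.Binary.Pointwise using (Pointwise; []; _∷_)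
  open import Data.Nat using (ℕ; suc; NonZero; z≤n; s≤s; _^_; _≟_; _≤_; _<_; s≤s⁻¹)
  open import Data.Nat.Coprimality using (Coprime; coprime-divisor) renaming (sym to coprime-sym)
  open import Data.Nat.ListAction using (product)
  open import Data.Nat.Primality using (prime?; prime[2]; prime⇒irreducible)
  open import Data.Nat.Properties

  -- Σᵢ xᵢ ∏_{j ≠ i} bⱼ, the numerator of Σᵢ xᵢ / bᵢ over the common denominator.
  weighted : List ℕ → List ℕ → ℕ
  weighted (b ∷ bs) (x ∷ xs) = x ℕ.* product bs ℕ.+ b ℕ.* weighted bs xs
  weighted _        _        = 0

  -- The value of `weighted` with all numerators 1, that is, the change caused by raising every
  -- numerator by one.
  ones : List ℕ → ℕ
  ones []       = 0
  ones (b ∷ bs) = product bs ℕ.+ b ℕ.* ones bs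

  weighted-shift : ∀ i {R : ℕ → ℕ → Set} {bs xs} → Pointwise R xs bs → weighted bs (map (i ℕ.+_) xs) ≡ i ℕ.* ones bs ℕ.+ weighted bs xs
  weighted-shift i [] = cong (ℕ._+ 0) (sym (*-zeroʳ i))
  weighted-shift i {bs = b ∷ bs} {x ∷ xs} (_ ∷ rs) =
    trans (cong (λ v → (i ℕ.+ x) ℕ.* product bs ℕ.+ b ℕ.* v) (weighted-shift i rs)) (e i x b (product bs) (ones bs) (weighted bs xs))
    where e : ∀ i x b P o w → (i ℕ.+ x) ℕ.* P ℕ.+ b ℕ.* (i ℕ.* o ℕ.+ w) ≡ i ℕ.* (P ℕ.+ b ℕ.* o) ℕ.+ (x ℕ.* P ℕ.+ b ℕ.* w)
          e = ℕ-Solver.solve-∀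

  weighted-≤ : ∀ {bs xs} → Pointwise _<_ xs bs → weighted bs xs ≤ length bs ℕ.* product bs
  weighted-≤ [] = z≤n
  weighted-≤ {b ∷ bs} {x ∷ xs} (x<b ∷ rs) = +-mono-≤ (*-monoˡ-≤ (product bs) (<⇒≤ x<b))
    (≤-trans (*-monoʳ-≤ b (weighted-≤ rs)) (≤-reflexive (e b (length bs) (product bs))))
    where e : ∀ b l P → b ℕ.* (l ℕ.* P) ≡ l ℕ.* (b ℕ.* P)
          e = ℕ-Solver.solve-∀

  coprime-* : ∀ {m a b} → Coprime m a → Coprime m b → Coprime m (a ℕ.* b)
  coprime-* {m} {a} {b} ca cb {d} (d∣m , d∣ab) = cb (d∣m , coprime-divisor {d} {a} {b} (λ (e∣d , e∣a) → ca (ℕ∣.∣-trans e∣d d∣m , e∣a)) d∣ab)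

  coprime-product : ∀ {b bs} → All (Coprime b) bs → Coprime b (product bs)
  coprime-product {b} [] (_ , d∣1) = ℕ∣.∣1⇒≡1 d∣1
  coprime-product (c ∷ cs) = coprime-* c (coprime-product cs)

  -- Induction on the moduli. If i inverts the product B of the others mod b, then x = m i mod b
  -- makes m - x B divisible by b, and the quotient m′ is the target for the remaining moduli.
  chinese : ∀ bs → All NonZero bs → AllPairs Coprime bs → ∀ m →
            ∃ λ xs → Pointwise _<_ xs bs × + product bs ∣ + weighted bs xs - m
  chinese [] _ _ m = [] , [] , divides (- m) (e m)
    where e : ∀ m → +0 - m ≡ - m * + 1
          e = solve-∀
  chinese (b ∷ bs) (nz ∷ nzs) (c ∷ cs) m with coprime⇒inverse (coprime-sym (coprime-product c))
  ... | i , divides q eq-i = step (chinese bs nzs cs m′)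
    where
    instance _ = nz
    B = product bs
    x = (m * i) %ℕ b
    q′ = (m * i) /ℕ b
    m′ = q′ * + B - m * q
    m≡ : m ≡ + x * + B + + b * m′
    m≡ = trans (e₁ m i (+ B)) (trans (cong₂ (λ v w → v * + B - m * w) (a≡a%ℕn+[a/ℕn]*n (m * i) b) eq-i) (e₂ (+ x) q′ (+ b) (+ B) m q))
      where
      e₁ : ∀ m i B → m ≡ m * i * B - m * (i * B - + 1)
      e₁ = solve-∀
      e₂ : ∀ x q′ b B m q → (x + q′ * b) * B - m * (q * b) ≡ x * B + b * (q′ * B - m * q)
      e₂ = solve-∀
    step : (∃ λ xs → Pointwise _<_ xs bs × + B ∣ + weighted bs xs - m′) →
           ∃ λ xs → Pointwise _<_ xs (b ∷ bs) × + (b ℕ.* B) ∣ + weighted (b ∷ bs) xs - m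
    step (xs , xs< , divides r eq) = x ∷ xs , n%ℕd<d (m * i) b ∷ xs< , divides r (trans
      (cong₂ _-_ (trans (pos-+ (x ℕ.* B) (b ℕ.* weighted bs xs)) (cong₂ _+_ (pos-* x B) (pos-* b (weighted bs xs)))) m≡)
      (trans (e₃ (+ x) (+ B) (+ b) (+ weighted bs xs) m′) (trans (cong (+ b *_) eq) (trans (e₄ (+ b) r (+ B)) (cong (r *_) (sym (pos-* b B)))))))
      where
      e₃ : ∀ x B b w m′ → x * B + b * w - (x * B + b * m′) ≡ b * (w - m′)
      e₃ = solve-∀
      e₄ : ∀ b r B → b * (r * B) ≡ r * (b * B)
      e₄ = solve-∀

  product-≥ : ∀ H bs → All (H ≤_) bs → H ^ length bs ≤ product bs
  product-≥ H [] [] = ≤-refl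
  product-≥ H (b ∷ bs) (h ∷ hs) = *-mono-≤ h (product-≥ H bs hs)

  private
    -- Each of the primes 2 and 3 forbids one class of shifts if it does not divide a, and none if
    -- it divides a but not b. A class is left over for either prime, hence one mod 6; the finitely
    -- many cases are checked by evaluation.
    residueShift : ∀ (a b : Fin 6) → ¬ (toℕ a ℕ.% 2 ≡ 0 × toℕ b ℕ.% 2 ≡ 0) → ¬ (toℕ a ℕ.% 3 ≡ 0 × toℕ b ℕ.% 3 ≡ 0) →
                   ∃ λ (w : Fin 6) → (toℕ b ℕ.+ suc (toℕ w) ℕ.* toℕ a) ℕ.% 2 ≢ 0 × (toℕ b ℕ.+ suc (toℕ w) ℕ.* toℕ a) ℕ.% 3 ≢ 0
    residueShift = toWitness {a? = Fin.all? λ a → Fin.all? λ b →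
      ¬? ((toℕ a ℕ.% 2 ≟ 0) ×-dec (toℕ b ℕ.% 2 ≟ 0)) →-dec (¬? ((toℕ a ℕ.% 3 ≟ 0) ×-dec (toℕ b ℕ.% 3 ≟ 0)) →-dec
      Fin.any? λ w → ¬? ((toℕ b ℕ.+ suc (toℕ w) ℕ.* toℕ a) ℕ.% 2 ≟ 0) ×-dec ¬? ((toℕ b ℕ.+ suc (toℕ w) ℕ.* toℕ a) ℕ.% 3 ≟ 0))} tt

  prime∤⇒coprime : ∀ {q m} → Prime q → ¬ (q ℕ∣.∣ m) → Coprime m q
  prime∤⇒coprime pr q∤m (d∣m , d∣q) with prime⇒irreducible pr d∣q
  ... | inj₁ d≡1  = d≡1
  ... | inj₂ refl = ⊥-elim (q∤m d∣m)

  prime[3] : Prime 3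
  prime[3] = toWitness {a? = prime? 3} tt

  -- The shift runs over a complete system mod 6 that starts at 1 instead of 0, so that β + w α is
  -- at least α as well as at least β.
  coprimeShift : ∀ {α β} → Coprime α β → ∃ λ w → 1 ≤ w × w ≤ 6 × Coprime (β ℕ.+ w ℕ.* α) 6
  coprimeShift {α} {β} c = conclude (residueShift a b (excluded 2 (λ ()) (ℕ∣.divides-refl 3)) (excluded 3 (λ ()) (ℕ∣.divides-refl 2)))
    where
    a = fromℕ< (ℕ.m%n<n α 6)
    b = fromℕ< (ℕ.m%n<n β 6)
    split : ∀ x → x ≡ toℕ (fromℕ< (ℕ.m%n<n x 6)) ℕ.+ x ℕ./ 6 ℕ.* 6
    split x = trans (ℕ.m≡m%n+[m/n]*n x 6) (cong (ℕ._+ x ℕ./ 6 ℕ.* 6) (sym (Fin.toℕ-fromℕ< (ℕ.m%n<n x 6))))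
    excluded : ∀ q .{{_ : NonZero q}} → q ≢ 1 → q ℕ∣.∣ 6 → ¬ (toℕ a ℕ.% q ≡ 0 × toℕ b ℕ.% q ≡ 0)
    excluded q q≢1 q∣6 (ha , hb) = q≢1 (c (div α ha , div β hb))
      where div : ∀ x → toℕ (fromℕ< (ℕ.m%n<n x 6)) ℕ.% q ≡ 0 → q ℕ∣.∣ x
            div x h = subst (q ℕ∣.∣_) (sym (split x)) (ℕ∣.∣m∣n⇒∣m+n (ℕ∣.m%n≡0⇒n∣m _ q h) (ℕ∣.∣n⇒∣m*n (x ℕ./ 6) q∣6))
    conclude : (∃ λ (w : Fin 6) → (toℕ b ℕ.+ suc (toℕ w) ℕ.* toℕ a) ℕ.% 2 ≢ 0 × (toℕ b ℕ.+ suc (toℕ w) ℕ.* toℕ a) ℕ.% 3 ≢ 0) →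
               ∃ λ w → 1 ≤ w × w ≤ 6 × Coprime (β ℕ.+ w ℕ.* α) 6
    conclude (w , h₂ , h₃) = suc (toℕ w) , s≤s z≤n , Fin.toℕ<n w ,
      coprime-* {β ℕ.+ v ℕ.* α} {2} {3} (prime∤⇒coprime prime[2] (undiv 2 (ℕ∣.divides-refl 3) h₂)) (prime∤⇒coprime prime[3] (undiv 3 (ℕ∣.divides-refl 2) h₃))
      where
      v = suc (toℕ w)
      e : ∀ v a b a′ b′ → b ℕ.+ b′ ℕ.* 6 ℕ.+ v ℕ.* (a ℕ.+ a′ ℕ.* 6) ≡ (b′ ℕ.+ v ℕ.* a′) ℕ.* 6 ℕ.+ (b ℕ.+ v ℕ.* a)
      e = ℕ-Solver.solve-∀
      undiv : ∀ q .{{_ : NonZero q}} → q ℕ∣.∣ 6 → (toℕ b ℕ.+ v ℕ.* toℕ a) ℕ.% q ≢ 0 → ¬ (q ℕ∣.∣ β ℕ.+ v ℕ.* α)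
      undiv q q∣6 h d = h (ℕ∣.n∣m⇒m%n≡0 _ q (ℕ∣.∣m+n∣m⇒∣n
        (subst (q ℕ∣.∣_) (trans (cong₂ (λ x y → y ℕ.+ v ℕ.* x) (split α) (split β)) (e v (toℕ a) (toℕ b) (α ℕ./ 6) (β ℕ./ 6))) d)
        (ℕ∣.∣n⇒∣m*n (β ℕ./ 6 ℕ.+ v ℕ.* (α ℕ./ 6)) q∣6)))

  -- Steps of 6 preserve coprimality to 6. At most five terms are used, with shifts v = w + 6 i ≤ 6
  -- + 24 = 30; this is the origin of the margin 30 and of the bound 31 s for the denominators.
  progression : ℕ → ℕ → ℕ → ℕ → ℕ
  progression α β w i = β ℕ.+ (w ℕ.+ 6 ℕ.* i) ℕ.* α

  -- A common divisor of two terms divides their difference 6 (j - i) α, hence 72 α.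
  progression-coprime : ∀ {α β w} → Coprime α β → Coprime (β ℕ.+ w ℕ.* α) 6 → ∀ n → n ≤ 5 → AllPairs Coprime (applyUpTo (progression α β w) n)
  progression-coprime {α} {β} {w} c c₆ n n≤5 = AllPairs.applyUpTo⁺₁ (progression α β w) n pair
    where
    f = progression α β w
    coprime-6 : ∀ i → Coprime (f i) 6
    coprime-6 i {d} (d∣f , d∣6) = c₆ (ℕ∣.∣m+n∣m⇒∣n (subst (d ℕ∣.∣_) (e α β w i) d∣f) (ℕ∣.∣m⇒∣m*n (i ℕ.* α) d∣6) , d∣6)
      where e : ∀ α β w i → β ℕ.+ (w ℕ.+ 6 ℕ.* i) ℕ.* α ≡ 6 ℕ.* (i ℕ.* α) ℕ.+ (β ℕ.+ w ℕ.* α)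
            e = ℕ-Solver.solve-∀
    coprime-72 : ∀ i → Coprime (f i) 72
    coprime-72 i = coprime-* {f i} {6} {12} (coprime-6 i) (coprime-* {f i} {6} {2} (coprime-6 i) (λ (d∣f , d∣2) → coprime-6 i (d∣f , ℕ∣.∣-trans d∣2 (ℕ∣.divides-refl 3))))
    divides-12 : ∀ o → o < 4 → suc o ℕ∣.∣ 12
    divides-12 0 _ = ℕ∣.divides-refl 12
    divides-12 1 _ = ℕ∣.divides-refl 6
    divides-12 2 _ = ℕ∣.divides-refl 4
    divides-12 3 _ = ℕ∣.divides-refl 3
    divides-12 (suc (suc (suc (suc o)))) (s≤s (s≤s (s≤s (s≤s ()))))
    pair : ∀ {i j} → i < j → j < n → Coprime (f i) (f j)
    pair {i} {j} i<j j<n {d} (d∣fi , d∣fj) with m≤n⇒∃[o]m+o≡n i<j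
    ... | o , refl = coprime-72 i (d∣fi , d∣72)
      where
      eq : ∀ α β w i o → β ℕ.+ (w ℕ.+ 6 ℕ.* (suc i ℕ.+ o)) ℕ.* α ≡ β ℕ.+ (w ℕ.+ 6 ℕ.* i) ℕ.* α ℕ.+ α ℕ.* (6 ℕ.* suc o)
      eq = ℕ-Solver.solve-∀
      d⊥α : Coprime d α
      d⊥α {e} (e∣d , e∣α) = c (e∣α , ℕ∣.∣m+n∣m⇒∣n (subst (e ℕ∣.∣_) (+-comm β ((w ℕ.+ 6 ℕ.* i) ℕ.* α)) (ℕ∣.∣-trans e∣d d∣fi)) (ℕ∣.∣n⇒∣m*n (w ℕ.+ 6 ℕ.* i) e∣α))
      d∣6[j-i] : d ℕ∣.∣ 6 ℕ.* suc o
      d∣6[j-i] = coprime-divisor {d} {α} d⊥α (ℕ∣.∣m+n∣m⇒∣n (subst (d ℕ∣.∣_) (eq α β w i o) d∣fj) d∣fi)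
      o<4 : o < 4
      o<4 = s≤s⁻¹ (≤-trans (s≤s (s≤s (m≤n+m o i))) (≤-trans j<n n≤5))
      d∣72 : d ℕ∣.∣ 72
      d∣72 = ℕ∣.∣-trans d∣6[j-i] (ℕ∣.*-monoʳ-∣ 6 (divides-12 o o<4))

-- Thue's lemma and long numerator intervals

module LongIntervals where
  open Congruence
  open CrossRatios
  open RatioEnergy
  open FractionSums
  open ChineseRemainder
  import Data.Fin.Properties as Fin
  open import Data.Fin as Fin using (Fin; toℕ; fromℕ<; combine; remQuot)
  open import Data.Integer using (ℤ; +_; -[1+_]; _+_; _*_; _-_; -_; +0) renaming (∣_∣ to abs)
  open import Data.Integer.Divisibility.Signed
  open import Data.Integer.Properties using (pos-+; pos-*)
  open import Data.Integer.Tactic.RingSolver using (solve-∀)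
  open import Data.List.Relation.Binary.Pointwise using (Pointwise; []; _∷_)
  open import Data.Nat using (ℕ; zero; suc; NonZero; z≤n; s≤s; _^_; _≤?_; _≤_; _<_; s≤s⁻¹; >-nonZero; >-nonZero⁻¹)
  open import Data.Nat.Coprimality using (Coprime) renaming (sym to coprime-sym)
  open import Data.Nat.ListAction using (product)
  open import Data.Nat.Properties

  sgn : Bool → ℤ
  sgn true  = + 1
  sgn false = - + 1

  signed : ∀ x → ∃ λ σ → x ≡ sgn σ * + abs x
  signed (+ n)     = true , sym (ℤ.*-identityˡ (+ n))
  signed -[1+ n ]  = false , sym (ℤ.-1*i≡-i (+ suc n))

  sgn-product : ∀ σ τ → ∃ λ ρ → sgn σ * sgn τ ≡ sgn ρ
  sgn-product true  true  = true , refl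
  sgn-product true  false = false , refl
  sgn-product false true  = false , refl
  sgn-product false false = true , refl

  sgn² : ∀ σ → sgn σ * sgn σ ≡ + 1
  sgn² true  = refl
  sgn² false = refl

  module Thue (p : ℕ) .{{_ : NonZero p}} (prime : Prime p) (s : ℕ) (2≤s : 2 ≤ s) (s²≤p : s ℕ.* s ≤ p) (p<[1+s]² : p < suc s ℕ.* suc s) where
    open Residues p prime

    s<p : s < p
    s<p = <-≤-trans (m<m*n s s {{>-nonZero (≤-trans (s≤s z≤n) 2≤s)}} 2≤s) s²≤p

    record Slope (y : ℕ) : Set where
      constructor slope
      field
        σ       : Bool
        α β     : ℕ
        1≤α     : 1 ≤ α
        α≤s     : α ≤ s
        1≤β     : 1 ≤ β
        β≤s     : β ≤ s
        coprime : Coprime α β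
        slope-≈ : + α * + y ≈ sgn σ * + β

    α-unit : ∀ {α} → 1 ≤ α → α ≤ s → Unit (+ α)
    α-unit 1≤α α≤s = Unit-< 1≤α (≤-<-trans α≤s s<p)

    reduce : ∀ y σ {m n} → 1 ≤ m → m ≤ s → 1 ≤ n → n ≤ s → + m * + y ≈ sgn σ * + n → Slope y
    reduce y σ {m} {n} 1≤m m≤s 1≤n n≤s h = conclude (coprimeParts m n {{>-nonZero 1≤m}}) 1≤m m≤s 1≤n n≤s h
      where
      conclude : ∀ {m n} → (∃ λ c → CoprimeParts c m n) → 1 ≤ m → m ≤ s → 1 ≤ n → n ≤ s → + m * + y ≈ sgn σ * + n → Slope y
      conclude (c , parts α β cop) 1≤m m≤s 1≤n n≤s h = slope σ α β
        (>-nonZero⁻¹ α {{m*n≢0⇒m≢0 α {{>-nonZero 1≤m}}}}) (≤-trans (m≤m*n α c) m≤s)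
        (>-nonZero⁻¹ β {{m*n≢0⇒m≢0 β {{>-nonZero 1≤n}}}}) (≤-trans (m≤m*n β c) n≤s) cop
        (≈-cancelˡ (α-unit (>-nonZero⁻¹ c) (≤-trans (m≤n*m c α {{m*n≢0⇒m≢0 α {{>-nonZero 1≤m}}}}) m≤s))
          (≈-lin₁ (+ 1) h (trans (e (+ c) (+ α) (+ y) (sgn σ) (+ β)) (cong₂ (λ v w → + 1 * (v * + y - sgn σ * w)) (sym (pos-* α c)) (sym (pos-* β c))))))
        where
        instance
          cnz : NonZero c
          cnz = m*n≢0⇒n≢0 α {{>-nonZero 1≤m}}
        e : ∀ c α y σ β → c * (α * y) - c * (σ * β) ≡ + 1 * (α * c * y - σ * (β * c))
        e = solve-∀

    abstract
      -- Pigeonhole for a y - c mod p on the (s + 1)² > p pairs (a, c) with entries at most s. The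
      -- colliding pair comes out of a search, so the result is abstract and is never evaluated.
      thue : ∀ y → 1 ≤ y → y < p → Slope y
      thue y 1≤y y<p = conclude (Fin.pigeonhole p<[1+s]² f)
        where
        pair : Fin (suc s ℕ.* suc s) → Fin (suc s) × Fin (suc s)
        pair = remQuot {suc s} (suc s)
        a c : Fin (suc s ℕ.* suc s) → ℕ
        a i = toℕ (proj₁ (pair i))
        c i = toℕ (proj₂ (pair i))
        value : Fin (suc s ℕ.* suc s) → ℤ
        value i = + a i * + y - + c i
        f : Fin (suc s ℕ.* suc s) → Fin p
        f i = fromℕ< (rs<p (value i))
        conclude : (∃ λ i → ∃ λ j → i Fin.< j × f i ≡ f j) → Slope y
        conclude (i , j , i<j , fi≡fj) = signs (signed A) (signed C)
          where
          A C : ℤ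
          A = + a i - + a j
          C = + c i - + c j
          e : ∀ a a′ y c c′ → (a - a′) * y - (c - c′) ≡ + 1 * (a * y - c - (a′ * y - c′))
          e = solve-∀
          Ay≈C : A * + y ≈ C
          Ay≈C = ≈-lin₁ (+ 1) (rs-inj {value i} {value j} (trans (sym (Fin.toℕ-fromℕ< (rs<p (value i)))) (trans (cong toℕ fi≡fj) (Fin.toℕ-fromℕ< (rs<p (value j))))))
                   (e (+ a i) (+ a j) (+ y) (+ c i) (+ c j))
          A≤s : abs A ≤ s
          A≤s = s≤s⁻¹ (absdiff-< (Fin.toℕ<n (proj₁ (pair i))) (Fin.toℕ<n (proj₁ (pair j))))
          C≤s : abs C ≤ s
          C≤s = s≤s⁻¹ (absdiff-< (Fin.toℕ<n (proj₂ (pair i))) (Fin.toℕ<n (proj₂ (pair j))))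
          same : ∀ u v → + u - + v ≡ +0 → u ≡ v
          same u v h = ℤ.+-injective (ℤ.i-j≡0⇒i≡j (+ u) (+ v) h)
          A≢0 : A ≢ +0
          A≢0 A≡0 = Fin.<⇒≢ i<j (begin
            i                                                       ≡⟨ Fin.combine-remQuot {suc s} (suc s) i ⟨
            combine (proj₁ (pair i)) (proj₂ (pair i))               ≡⟨ cong₂ combine (Fin.toℕ-injective (same (a i) (a j) A≡0)) (Fin.toℕ-injective (same (c i) (c j) C≡0)) ⟩
            combine (proj₁ (pair j)) (proj₂ (pair j))               ≡⟨ Fin.combine-remQuot {suc s} (suc s) j ⟩
            j                                                       ∎)
            where
            open ≡-Reasoning
            e₀ : ∀ C y → C ≡ - + 1 * (+0 * y - C)
            e₀ = solve-∀
            C≡0 : C ≡ +0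
            C≡0 = ∣∧<⇒≡0 (∣-lin₁ (- + 1) (subst (λ v → + p ∣ v * + y - C) A≡0 (≈⁻ Ay≈C)) (e₀ C (+ y))) (≤-<-trans C≤s s<p)
          C≢0 : C ≢ +0
          C≢0 C≡0 = cases (euclid A (+ y) (∣-lin₁ (+ 1) (subst (λ v → + p ∣ A * + y - v) C≡0 (≈⁻ Ay≈C)) (e₀ (A * + y))))
            where
            e₀ : ∀ x → x ≡ + 1 * (x - +0)
            e₀ = solve-∀
            cases : + p ∣ A ⊎ (+ p ∣ + y) → ⊥
            cases (inj₁ d) = A≢0 (∣∧<⇒≡0 d (≤-<-trans A≤s s<p))
            cases (inj₂ d) = Unit-< 1≤y y<p d
          pos : ∀ {x} → x ≢ +0 → 1 ≤ abs x
          pos x≢0 = n≢0⇒n>0 (λ h → x≢0 (ℤ.∣i∣≡0⇒i≡0 h))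
          signs : (∃ λ σ → A ≡ sgn σ * + abs A) → (∃ λ τ → C ≡ sgn τ * + abs C) → Slope y
          signs (σ , hA) (τ , hC) = reduce y (proj₁ (sgn-product σ τ)) (pos A≢0) A≤s (pos C≢0) C≤s
            (≈-lin₁ (sgn σ) Ay≈C (trans (cong₂ _-_ (sym (trans (cong (_* (+ abs A * + y)) (sgn² σ)) (ℤ.*-identityˡ (+ abs A * + y)))) (cong (_* + abs C) (sym (proj₂ (sgn-product σ τ)))))
              (trans (e₁ (sgn σ) (sgn τ) (+ abs A) (+ abs C) (+ y)) (cong₂ (λ v w → sgn σ * (v * + y - w)) (sym hA) (sym hC)))))
            where
            e₁ : ∀ σ τ a c y → σ * σ * (a * y) - σ * τ * c ≡ σ * (σ * a * y - τ * c)
            e₁ = solve-∀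

    -- One large coordinate is enough: β + v α ≥ H for every v ≥ 1.
    Steep : ℕ → ∀ {y} → Slope y → Set
    Steep H S = H ≤ Slope.α S ⊎ H ≤ Slope.β S

    -- There are only 2 H² residues ± β / α with α, β < H.
    steepSlope : ∀ H N y₀ → 1 ≤ y₀ → y₀ ℕ.+ N ≤ p → 2 ℕ.* (H ℕ.* H) < N →
                 ∃ λ y → y ∈[ y₀ ,+ N ⟩ × Σ (Slope y) (Steep H)
    steepSlope H N y₀ 1≤y₀ y₀+N≤p many = conclude (Fin.any? λ j → (H ≤? Slope.α (sl j)) ⊎-dec (H ≤? Slope.β (sl j)))
      where
      y<p : ∀ j → y₀ ℕ.+ toℕ {N} j < p
      y<p j = <-≤-trans (+-monoʳ-< y₀ (Fin.toℕ<n j)) y₀+N≤p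
      sl : ∀ (j : Fin N) → Slope (y₀ ℕ.+ toℕ j)
      sl j = thue (y₀ ℕ.+ toℕ j) (≤-trans 1≤y₀ (m≤m+n y₀ (toℕ j))) (y<p j)
      conclude : Dec (∃ λ j → Steep H (sl j)) → ∃ λ y → y ∈[ y₀ ,+ N ⟩ × Σ (Slope y) (Steep H)
      conclude (yes (j , st)) = y₀ ℕ.+ toℕ j , (m≤m+n y₀ (toℕ j) , +-monoʳ-< y₀ (Fin.toℕ<n j)) , sl j , st
      conclude (no none) = ⊥-elim (clash (Fin.pigeonhole many code))
        where
        α<H : ∀ j → Slope.α (sl j) < H
        α<H j = ≰⇒> (λ h → none (j , inj₁ h))
        β<H : ∀ j → Slope.β (sl j) < H
        β<H j = ≰⇒> (λ h → none (j , inj₂ h))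
        bit : Bool → Fin 2
        bit true  = Fin.zero
        bit false = Fin.suc Fin.zero
        bit-injective : ∀ {σ τ} → bit σ ≡ bit τ → σ ≡ τ
        bit-injective {true}  {true}  _ = refl
        bit-injective {false} {false} _ = refl
        code₂ : Fin N → Fin (H ℕ.* H)
        code₂ j = combine (fromℕ< (α<H j)) (fromℕ< (β<H j))
        code : Fin N → Fin (2 ℕ.* (H ℕ.* H))
        code j = combine (bit (Slope.σ (sl j))) (code₂ j)
        clash : (∃ λ i → ∃ λ j → i Fin.< j × code i ≡ code j) → ⊥
        clash (i , j , i<j , h) = <⇒≢ i<j (+-cancelˡ-≡ y₀ (toℕ i) (toℕ j) (≈⇒≡ (y<p i) (y<p j)
            (≈-cancelˡ (α-unit (Slope.1≤α (sl i)) (Slope.α≤s (sl i))) (≈-trans (Slope.slope-≈ (sl i)) (≈-trans (≈-reflexive (cong₂ (λ v w → sgn v * + w) σ≡ β≡))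
              (≈-trans (≈-sym (Slope.slope-≈ (sl j))) (≈-reflexive (cong (λ v → + v * + (y₀ ℕ.+ toℕ j)) (sym α≡)))))))))
          where
          σ≡ : Slope.σ (sl i) ≡ Slope.σ (sl j)
          σ≡ = bit-injective (Fin.combine-injectiveˡ (bit (Slope.σ (sl i))) (code₂ i) (bit (Slope.σ (sl j))) (code₂ j) h)
          h₂ : code₂ i ≡ code₂ j
          h₂ = Fin.combine-injectiveʳ (bit (Slope.σ (sl i))) (code₂ i) (bit (Slope.σ (sl j))) (code₂ j) h
          from : ∀ {m n} (m< : m < H) (n< : n < H) → fromℕ< m< ≡ fromℕ< n< → m ≡ n
          from m< n< q = trans (sym (Fin.toℕ-fromℕ< m<)) (trans (cong toℕ q) (Fin.toℕ-fromℕ< n<))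
          α≡ : Slope.α (sl i) ≡ Slope.α (sl j)
          α≡ = from (α<H i) (α<H j) (Fin.combine-injectiveˡ (fromℕ< (α<H i)) (fromℕ< (β<H i)) (fromℕ< (α<H j)) (fromℕ< (β<H j)) h₂)
          β≡ : Slope.β (sl i) ≡ Slope.β (sl j)
          β≡ = from (β<H i) (β<H j) (Fin.combine-injectiveʳ (fromℕ< (α<H i)) (fromℕ< (β<H i)) (fromℕ< (α<H j)) (fromℕ< (β<H j)) h₂)

  module LongNumerators (p : ℕ) .{{_ : NonZero p}} (prime : Prime p)
                        (i₀ W b Q : ℕ) (i₀+W≤p : i₀ ℕ.+ W ≤ p) (1≤b : 1 ≤ b) (b+Q≤p : b ℕ.+ Q ≤ p)
                        (s : ℕ) (2≤s : 2 ≤ s) (s²≤p : s ℕ.* s ≤ p) (p<[1+s]² : p < suc s ℕ.* suc s)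
                        (s-small : 310 ℕ.* s ≤ W) where
    open Residues p prime
    open Thue p prime s 2≤s s²≤p p<[1+s]²
    open Sums p prime i₀ W b Q 1≤b b+Q≤p

    -- The congruence turns 1 / y into σ α / c. The factor σ α is common to all fractions, and only
    -- the small integers c enter the product of the denominators.
    Denominator : Bool → ℕ → ℕ → Set
    Denominator σ α c = 1 ≤ c × c < p × ∃ λ y → y ∈[ b ,+ Q ⟩ × + α * + y ≈ sgn σ * + c

    product-unit : ∀ {σ α bs} → All (Denominator σ α) bs → Unit (+ product bs)
    product-unit [] = Unit-1
    product-unit {σ} {α} {c ∷ bs} ((1≤c , c<p , _) ∷ ds) = λ d → Unit-* (Unit-< 1≤c c<p) (product-unit {σ} {α} {bs} ds) (∣-resp (pos-* c (product bs)) d)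

    -- After 1 / y = σ α / c for each denominator c, this is the sum of the x / c over the common
    -- denominator, multiplied by σ α.
    weighted-Rep : ∀ {σ α bs xs} → Unit (+ α) → All (Denominator σ α) bs → Pointwise (λ x _ → x ∈[ i₀ ,+ W ⟩) xs bs →
                   Rep (length bs) (sgn σ * + α * inv (+ product bs) * + weighted bs xs)
    weighted-Rep {σ} {α} uα [] [] = ≈-reflexive (ℤ.*-zeroʳ (sgn σ * + α * inv (+ 1)))
    weighted-Rep {σ} {α} {c ∷ bs} {x ∷ xs} uα ((1≤c , c<p , y , y∈ , h) ∷ ds) (x∈ ∷ rs) =
      x , y , x∈ , y∈ , Rep-resp (length bs) step (weighted-Rep {σ} {α} {bs} {xs} uα ds rs)
      where
      P = product bs
      uc : Unit (+ c)
      uc = Unit-< 1≤c c<p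
      uP : Unit (+ P)
      uP = product-unit {σ} {α} {bs} ds
      ucP : Unit (+ (c ℕ.* P))
      ucP d = Unit-* uc uP (∣-resp (pos-* c P) d)
      uy : Unit (+ y)
      uy = y-unit y∈
      inv-product : inv (+ c) * inv (+ P) ≈ inv (+ (c ℕ.* P))
      inv-product = inv-unique ucP (≈-trans (≈-reflexive (cong (inv (+ c) * inv (+ P) *_) (pos-* c P)))
        (≈-lin₂ (inv (+ P) * + P) (+ 1) (inv-* uc) (inv-* uP) (e (inv (+ c)) (inv (+ P)) (+ c) (+ P))))
        where e : ∀ i j c P → i * j * (c * P) - + 1 ≡ j * P * (i * c - + 1) + + 1 * (j * P - + 1)
              e = solve-∀
      inv-y : sgn σ * + α * inv (+ c) ≈ inv (+ y)
      inv-y = inv-unique uy (≈-lin₂ (sgn σ * inv (+ c)) (+ 1) h (inv-* uc)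
        (trans (e (sgn σ) (+ α) (inv (+ c)) (+ y) (+ c)) (trans (cong (λ v → X + v * (inv (+ c) * + c) - + 1) (sgn² σ)) (e₁ X (inv (+ c) * + c)))))
        where
        X = sgn σ * inv (+ c) * (+ α * + y - sgn σ * + c)
        e : ∀ σ α i y c → σ * α * i * y - + 1 ≡ σ * i * (α * y - σ * c) + σ * σ * (i * c) - + 1
        e = solve-∀
        e₁ : ∀ X v → X + + 1 * v - + 1 ≡ X + + 1 * (v - + 1)
        e₁ = solve-∀
      w = weighted bs xs
      i = inv (+ c)
      j = inv (+ P)
      σα = sgn σ * + α
      step : σα * j * + w ≈ σα * inv (+ (c ℕ.* P)) * + weighted (c ∷ bs) (x ∷ xs) - + x * inv (+ y)
      step = ≈-trans (≈-lin₂ (- (σα * i * + x)) (- (σα * j * + w)) (inv-* uP) (inv-* uc) (e₁ σα i j (+ x) (+ c) (+ P) (+ w)))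
        (≈-trans (≈-lin₂ (σα * (+ x * + P + + c * + w)) (- + x) inv-product inv-y (e₂ σα i j (+ x) (+ c) (+ P) (+ w) (inv (+ (c ℕ.* P))) (inv (+ y))))
          (≈-reflexive (cong (λ v → σα * inv (+ (c ℕ.* P)) * v - + x * inv (+ y))
            (sym (trans (pos-+ (x ℕ.* P) (c ℕ.* w)) (cong₂ _+_ (pos-* x P) (pos-* c w)))))))
        where
        e₁ : ∀ a i j x c P w → a * j * w - (a * (i * j) * (x * P + c * w) - x * (a * i)) ≡ - (a * i * x) * (j * P - + 1) + - (a * j * w) * (i * c - + 1)
        e₁ = solve-∀
        e₂ : ∀ a i j x c P w K Y → a * (i * j) * (x * P + c * w) - x * (a * i) - (a * K * (x * P + c * w) - x * Y) ≡
             a * (x * P + c * w) * (i * j - K) + - x * (a * i - Y)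
        e₂ = solve-∀

    -- From α y ≡ σ β follows α (y + σ v) ≡ σ (β + v α). The sign decides whether y moves up or
    -- down, so y has to keep a distance of 30 from both ends.
    shiftedDenominator : ∀ {y σ α β v} → (b ℕ.+ 30) ≤ y → y ℕ.+ 30 < b ℕ.+ Q → v ≤ 30 → + α * + y ≈ sgn σ * + β →
                         ∃ λ y′ → y′ ∈[ b ,+ Q ⟩ × + α * + y′ ≈ sgn σ * + (β ℕ.+ v ℕ.* α)
    shiftedDenominator {y} {true} {α} {β} {v} b+30≤y y+30< v≤30 h = y ℕ.+ v ,
      (≤-trans (m≤m+n b 30) (≤-trans b+30≤y (m≤m+n y v)) , ≤-<-trans (+-monoʳ-≤ y v≤30) y+30<) ,
      ≈-lin₁ (+ 1) h (trans (cong₂ (λ u u′ → + α * u - + 1 * u′) (pos-+ y v) (trans (pos-+ β (v ℕ.* α)) (cong (λ u → + β + u) (pos-* v α)))) (e (+ α) (+ y) (+ v) (+ β)))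
      where e : ∀ α y v β → α * (y + v) - + 1 * (β + v * α) ≡ + 1 * (α * y - + 1 * β)
            e = solve-∀
    shiftedDenominator {y} {false} {α} {β} {v} b+30≤y y+30< v≤30 h = conclude (m≤n⇒∃[o]m+o≡n (≤-trans v≤30 (≤-trans (m≤n+m 30 b) b+30≤y)))
      where
      e : ∀ α y v β → α * y - - + 1 * (β + v * α) ≡ + 1 * (α * (v + y) - - + 1 * β)
      e = solve-∀
      conclude : (∃ λ y′ → v ℕ.+ y′ ≡ y) → ∃ λ y′ → y′ ∈[ b ,+ Q ⟩ × + α * + y′ ≈ sgn false * + (β ℕ.+ v ℕ.* α)
      conclude (y′ , eq) = y′ ,
        (+-cancelʳ-≤ 30 b y′ (≤-trans b+30≤y (≤-trans (≤-reflexive (sym eq)) (≤-trans (+-monoˡ-≤ y′ v≤30) (≤-reflexive (+-comm 30 y′))))) ,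
         ≤-<-trans (≤-trans (≤-trans (m≤n+m y′ v) (≤-reflexive eq)) (m≤m+n y 30)) y+30<) ,
        ≈-lin₁ (+ 1) h (trans (cong (λ u → + α * + y′ - - + 1 * u) (trans (pos-+ β (v ℕ.* α)) (cong (λ u → + β + u) (pos-* v α))))
          (trans (e (+ α) (+ y′) (+ v) (+ β)) (cong (λ u → + 1 * (+ α * u - - + 1 * + β)) (trans (sym (pos-+ v y′)) (cong +_ eq)))))

    W≤p : W ≤ p
    W≤p = ≤-trans (m≤n+m W i₀) i₀+W≤p

    -- In t₀ B + b₀ w the residue of w mod B is prescribed by the Chinese remainder theorem, and t₀ makes up the rest mod p.
    fullRange : ∀ b₀ bs → All NonZero (b₀ ∷ bs) → AllPairs Coprime (b₀ ∷ bs) → 2 ℕ.* (length bs ℕ.* b₀) ≤ W → 2 ℕ.* p ≤ W ℕ.* product bs →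
                All (_≤ W) bs → ∀ m → ∃ λ ts → Pointwise (λ t _ → t < W) ts (b₀ ∷ bs) × + weighted (b₀ ∷ bs) ts ≈ m
    fullRange b₀ bs (nz₀ ∷ nzs) (c ∷ cs) short long bs≤W m = conclude (coprime⇒inverse (coprime-product c))
      where
      open ≤-Reasoning
      B = product bs
      h = length bs
      base = h ℕ.* b₀ ℕ.* B
      -- The representative of m in the p integers starting at `base`, an upper bound for b₀ w
      -- whatever the remainders are. So t₀ = (m′ - b₀ w) / B is a natural number, and it is below W
      -- because 2 base ≤ W B and 2 p ≤ W B.
      m′ = base ℕ.+ rs (m - + base)
      m′≈m : + m′ ≈ m
      m′≈m = ≈-trans (≈-reflexive (pos-+ base (rs (m - + base)))) (≈-lin₁ (+ 1) (rs-≈ (m - + base)) (e (+ base) (+ rs (m - + base)) m))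
        where e : ∀ x r m → x + r - m ≡ + 1 * (r - (m - x))
              e = solve-∀
      conclude : (∃ λ x → + B ∣ x * + b₀ - + 1) → ∃ λ ts → Pointwise (λ t _ → t < W) ts (b₀ ∷ bs) × + weighted (b₀ ∷ bs) ts ≈ m
      conclude (x , B∣) = finish (chinese bs nzs cs (+ m′ * x))
        where
        finish : (∃ λ ts → Pointwise _<_ ts bs × + B ∣ + weighted bs ts - + m′ * x) →
                 ∃ λ ts → Pointwise (λ t _ → t < W) ts (b₀ ∷ bs) × + weighted (b₀ ∷ bs) ts ≈ m
        finish (ts , ts< , d) = quotient′ (∣⇒∣ᵤ B∣m′-b₀w)
          where
          w = weighted bs ts
          b₀w≤m′ : b₀ ℕ.* w ≤ m′
          b₀w≤m′ = begin
            b₀ ℕ.* w               ≤⟨ *-monoʳ-≤ b₀ (weighted-≤ ts<) ⟩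
            b₀ ℕ.* (h ℕ.* B)       ≡⟨ e b₀ h B ⟩
            base                   ≤⟨ m≤m+n base _ ⟩
            m′                     ∎
            where e : ∀ b h B → b ℕ.* (h ℕ.* B) ≡ h ℕ.* b ℕ.* B
                  e = ℕ-Solver.solve-∀
          B∣m′-b₀w : + B ∣ + m′ - + b₀ * + w
          B∣m′-b₀w = ∣-lin₂ (- + b₀) (- + m′) d B∣ (e (+ m′) (+ b₀) (+ w) x)
            where e : ∀ m b w x → m - b * w ≡ - b * (w - m * x) + - m * (x * b - + 1)
                  e = solve-∀
          difference : abs (+ m′ - + b₀ * + w) ≡ m′ ℕ.∸ b₀ ℕ.* w
          difference = trans (cong (λ v → abs (+ m′ - v)) (sym (pos-* b₀ w))) (absdiff-≥ b₀w≤m′)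
          quotient′ : B ℕ∣.∣ abs (+ m′ - + b₀ * + w) → ∃ λ ts → Pointwise (λ t _ → t < W) ts (b₀ ∷ bs) × + weighted (b₀ ∷ bs) ts ≈ m
          quotient′ (ℕ∣.divides t₀ eq) = t₀ ∷ ts , t₀<W ∷ weaken ts< bs≤W , ≈-trans (≈-reflexive (cong +_ total)) m′≈m
            where
            t₀B≡ : m′ ℕ.∸ b₀ ℕ.* w ≡ t₀ ℕ.* B
            t₀B≡ = trans (sym difference) eq
            total : t₀ ℕ.* B ℕ.+ b₀ ℕ.* w ≡ m′
            total = trans (cong (ℕ._+ b₀ ℕ.* w) (sym t₀B≡)) (m∸n+n≡m b₀w≤m′)
            t₀<W : t₀ < W
            t₀<W = *-cancelʳ-< B t₀ W (begin-strict
              t₀ ℕ.* B                 ≤⟨ m≤m+n (t₀ ℕ.* B) (b₀ ℕ.* w) ⟩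
              t₀ ℕ.* B ℕ.+ b₀ ℕ.* w    ≡⟨ total ⟩
              m′                       <⟨ +-monoʳ-< base (rs<p (m - + base)) ⟩
              base ℕ.+ p               ≤⟨ *-cancelˡ-≤ 2 (begin
                2 ℕ.* (base ℕ.+ p)                                      ≡⟨ e₁ (h ℕ.* b₀) B p ⟩
                2 ℕ.* (h ℕ.* b₀) ℕ.* B ℕ.+ 2 ℕ.* p                      ≤⟨ +-mono-≤ (*-monoˡ-≤ B short) long ⟩
                W ℕ.* B ℕ.+ W ℕ.* B                                     ≡⟨ cong (W ℕ.* B ℕ.+_) (sym (+-identityʳ (W ℕ.* B))) ⟩
                2 ℕ.* (W ℕ.* B)                                         ∎) ⟩
              W ℕ.* B                  ∎)
              where e₁ : ∀ x B p → 2 ℕ.* (x ℕ.* B ℕ.+ p) ≡ 2 ℕ.* x ℕ.* B ℕ.+ 2 ℕ.* p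
                    e₁ = ℕ-Solver.solve-∀
            weaken : ∀ {ts bs} → Pointwise _<_ ts bs → All (_≤ W) bs → Pointwise (λ t _ → t < W) ts bs
            weaken [] [] = []
            weaken (r ∷ rs) (l ∷ ls) = <-≤-trans r l ∷ weaken rs ls

    -- Of the h + 1 denominators the first receives the free numerator t₀, and the product of the
    -- other h is at least H^h ≥ 2 p / W. The interval of length N > 2 H² contains a y with steep
    -- slope; the extra 60 is a margin of 30 at each end.
    longNumerators : ∀ h H N → h ≤ 4 → 1 ≤ H → N ℕ.+ 60 ≤ Q → 2 ℕ.* (H ℕ.* H) < N → 2 ℕ.* p ≤ W ℕ.* H ^ h → ∀ a → Rep (suc h) a
    longNumerators h H N h≤4 1≤H N+60≤Q many steep a = conclude (steepSlope H N (b ℕ.+ 30) (≤-trans 1≤b (m≤m+n b 30)) fits many)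
      where
      open ≤-Reasoning
      e₀ : ∀ b N → b ℕ.+ 30 ℕ.+ N ℕ.+ 30 ≡ b ℕ.+ (N ℕ.+ 60)
      e₀ = ℕ-Solver.solve-∀
      fits : b ℕ.+ 30 ℕ.+ N ≤ p
      fits = ≤-trans (m≤m+n (b ℕ.+ 30 ℕ.+ N) 30) (≤-trans (≤-reflexive (e₀ b N)) (≤-trans (+-monoʳ-≤ b N+60≤Q) b+Q≤p))
      conclude : (∃ λ y → y ∈[ b ℕ.+ 30 ,+ N ⟩ × Σ (Slope y) (Steep H)) → Rep (suc h) a
      conclude (y , (b+30≤y , y<) , S , st) = withShift (coprimeShift (Slope.coprime S))
        where
        open Slope S
        withShift : (∃ λ w → 1 ≤ w × w ≤ 6 × Coprime (β ℕ.+ w ℕ.* α) 6) → Rep (suc h) a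
        withShift (w , 1≤w , w≤6 , c₆) = finish (fullRange (f 0) bs nonzeros (progression-coprime {α} {β} {w} coprime c₆ (suc h) (s≤s h≤4)) short long bounded τ)
          where
          f = progression α β w
          bs = applyUpTo (λ i → f (suc i)) h
          all = applyUpTo f (suc h)
          length-bs : length bs ≡ h
          length-bs = length-applyUpTo (λ i → f (suc i)) h
          v≤30 : ∀ {i} → i ≤ 4 → w ℕ.+ 6 ℕ.* i ≤ 30
          v≤30 i≤4 = +-mono-≤ w≤6 (*-monoʳ-≤ 6 i≤4)
          f≤31s : ∀ {i} → i ≤ 4 → f i ≤ 31 ℕ.* s
          f≤31s i≤4 = +-mono-≤ β≤s (*-mono-≤ (v≤30 i≤4) α≤s)
          f≥β : ∀ i → β ≤ f i
          f≥β i = m≤m+n β _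
          f≥α : ∀ i → α ≤ f i
          f≥α i = ≤-trans (≤-trans (≤-reflexive (sym (*-identityˡ α))) (*-monoˡ-≤ α (≤-trans 1≤w (m≤m+n w (6 ℕ.* i))))) (m≤n+m _ β)
          f≥H : ∀ i → H ≤ f i
          f≥H i = cases st
            where cases : H ≤ α ⊎ H ≤ β → H ≤ f i
                  cases (inj₁ q) = ≤-trans q (f≥α i)
                  cases (inj₂ q) = ≤-trans q (f≥β i)
          nonzeros : All NonZero all
          nonzeros = All.applyUpTo⁺₂ f (suc h) (λ i → >-nonZero (≤-trans 1≤β (f≥β i)))
          31s≤W : 31 ℕ.* s ≤ W
          31s≤W = ≤-trans (*-monoˡ-≤ s (m≤m+n 31 279)) s-small
          31s<W : 31 ℕ.* s < W
          31s<W = <-≤-trans (*-monoˡ-< s {{>-nonZero (≤-trans (s≤s z≤n) 2≤s)}} (m≤m+n 32 278)) s-small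
          bounded : All (_≤ W) bs
          bounded = All.applyUpTo⁺₁ (λ i → f (suc i)) h (λ {i} i<h → ≤-trans (f≤31s (≤-trans i<h h≤4)) 31s≤W)
          -- At most four further denominators, and f 0 ≤ 31 s: 2 · 4 · 31 = 248, within the factor
          -- 310 assumed for W.
          short : 2 ℕ.* (length bs ℕ.* f 0) ≤ W
          short = begin
            2 ℕ.* (length bs ℕ.* f 0)       ≤⟨ *-monoʳ-≤ 2 (*-mono-≤ (≤-trans (≤-reflexive length-bs) h≤4) (f≤31s {0} z≤n)) ⟩
            2 ℕ.* (4 ℕ.* (31 ℕ.* s))        ≡⟨ e₁ s ⟩
            248 ℕ.* s                       ≤⟨ *-monoˡ-≤ s (m≤m+n 248 62) ⟩
            310 ℕ.* s                       ≤⟨ s-small ⟩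
            W                               ∎
            where e₁ : ∀ s → 2 ℕ.* (4 ℕ.* (31 ℕ.* s)) ≡ 248 ℕ.* s
                  e₁ = ℕ-Solver.solve-∀
          long : 2 ℕ.* p ≤ W ℕ.* product bs
          long = ≤-trans steep (*-monoʳ-≤ W (subst (λ l → H ^ l ≤ product bs) length-bs (product-≥ H bs (All.applyUpTo⁺₂ (λ i → f (suc i)) h (λ i → f≥H (suc i))))))
          y+30< : y ℕ.+ 30 < b ℕ.+ Q
          y+30< = <-≤-trans (+-monoˡ-< 30 y<) (≤-trans (≤-reflexive (e₀ b N)) (+-monoʳ-≤ b N+60≤Q))
          denominators : All (Denominator σ α) all
          denominators = All.applyUpTo⁺₁ f (suc h) (λ {i} i≤h → ≤-trans 1≤β (f≥β i) ,
            ≤-<-trans (f≤31s (≤-trans (s≤s⁻¹ i≤h) h≤4)) (<-≤-trans 31s<W W≤p) ,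
            shiftedDenominator {y} {σ} {α} {β} {w ℕ.+ 6 ℕ.* i} b+30≤y y+30< (v≤30 (≤-trans (s≤s⁻¹ i≤h) h≤4)) slope-≈)
          P = product all
          uP : Unit (+ P)
          uP = product-unit {σ} {α} {all} denominators
          uα : Unit (+ α)
          uα = α-unit 1≤α α≤s
          -- Solving a = σ α · weighted / P for the weighted sum, and moving the contribution of the
          -- offset i₀ in every numerator to the other side.
          τ : ℤ
          τ = a * + P * sgn σ * inv (+ α) - + i₀ * + ones all
          finish : (∃ λ ts → Pointwise (λ t _ → t < W) ts all × + weighted all ts ≈ τ) → Rep (suc h) a
          finish (ts , ts< , eq) = subst (λ n → Rep n a) (length-applyUpTo f (suc h))
            (Rep-resp (length all) value (weighted-Rep {σ} {α} {all} {map (i₀ ℕ.+_) ts} uα denominators (inI ts<)))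
            where
            inI : ∀ {ts bs} → Pointwise (λ t _ → t < W) ts bs → Pointwise (λ x _ → x ∈[ i₀ ,+ W ⟩) (map (i₀ ℕ.+_) ts) bs
            inI [] = []
            inI {t ∷ _} (r ∷ rs) = (m≤m+n i₀ t , +-monoʳ-< i₀ r) ∷ inI rs
            weighted≈ : + weighted all (map (i₀ ℕ.+_) ts) ≈ a * + P * sgn σ * inv (+ α)
            weighted≈ = ≈-trans (≈-reflexive (trans (cong +_ (weighted-shift i₀ ts<)) (trans (pos-+ (i₀ ℕ.* ones all) (weighted all ts)) (cong (_+ + weighted all ts) (pos-* i₀ (ones all))))))
              (≈-lin₁ (+ 1) eq (e (+ i₀ * + ones all) (+ weighted all ts) (a * + P * sgn σ * inv (+ α))))
              where e : ∀ x w z → x + w - z ≡ + 1 * (w - (z - x))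
                    e = solve-∀
            value : sgn σ * + α * inv (+ P) * + weighted all (map (i₀ ℕ.+_) ts) ≈ a
            value = ≈-trans (≈-*ˡ (sgn σ * + α * inv (+ P)) weighted≈)
              (≈-trans (≈-reflexive (trans (e (sgn σ) (+ α) (inv (+ P)) a (+ P) (inv (+ α))) (cong (_* (a * (inv (+ P) * + P) * (inv (+ α) * + α))) (sgn² σ))))
                (≈-lin₂ (a * (inv (+ α) * + α)) a (inv-* uP) (inv-* uα) (e′ a (inv (+ P) * + P) (inv (+ α) * + α))))
              where
              e : ∀ σ α j a P i → σ * α * j * (a * P * σ * i) ≡ σ * σ * (a * (j * P) * (i * α))
              e = solve-∀
              e′ : ∀ a u v → + 1 * (a * u * v) - a ≡ a * v * (u - + 1) + a * (v - + 1)
              e′ = solve-∀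

-- Growth estimates and comparison of fractional powers

module Growth where
  open import Data.Nat
  open import Data.Nat.DivMod
  open import Data.Nat.Properties
  open import Data.Nat.Tactic.RingSolver using (solve-∀)

  -- `P` need not be monotone: the search returns the last value before the first failure above `a`.
  greatest : {P : ℕ → Set} (P? : ∀ n → Dec (P n)) → ∀ a n → P a → ¬ P (a + n) → ∃ λ v → a ≤ v × P v × ¬ P (suc v)
  greatest {P} P? a zero    pa ¬p = ⊥-elim (¬p (subst P (sym (+-identityʳ a)) pa))
  greatest {P} P? a (suc n) pa ¬p with P? (suc a)
  ... | no  ¬q = a , ≤-refl , pa , ¬q
  ... | yes q with greatest P? (suc a) n q (λ r → ¬p (subst P (sym (+-suc a n)) r))
  ...   | v , a<v , pv , ¬pv = v , <⇒≤ a<v , pv , ¬pv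

  n<2^n : ∀ n → n < 2 ^ n
  n<2^n zero    = s≤s z≤n
  n<2^n (suc n) = ≤-trans (+-mono-≤ (m^n>0 2 n) (n<2^n n)) (≤-reflexive (cong (2 ^ n +_) (sym (+-identityʳ (2 ^ n)))))

  *-^ : ∀ a b n → (a * b) ^ n ≡ a ^ n * b ^ n
  *-^ a b zero    = refl
  *-^ a b (suc n) = trans (cong (a * b *_) (*-^ a b n)) (e a b (a ^ n) (b ^ n))
    where e : ∀ a b x y → a * b * (x * y) ≡ a * x * (b * y)
          e = solve-∀

  PolyBounded : (ℕ → ℕ) → Set
  PolyBounded f = ∃ λ c → ∃ λ n → ∀ L → 1 ≤ L → f L ≤ c * L ^ n

  bounded-const : ∀ c → PolyBounded (λ _ → c)
  bounded-const c = c , 0 , λ L _ → ≤-reflexive (sym (*-identityʳ c))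

  bounded-id : PolyBounded (λ L → L)
  bounded-id = 1 , 1 , λ L _ → ≤-reflexive (sym (trans (*-identityˡ (L ^ 1)) (*-identityʳ L)))

  bounded-+ : ∀ {f g} → PolyBounded f → PolyBounded g → PolyBounded (λ L → f L + g L)
  bounded-+ {f} {g} (c , m , hf) (d , n , hg) = c + d , m + n , λ L 1≤L →
    ≤-trans (+-mono-≤ (≤-trans (hf L 1≤L) (*-monoʳ-≤ c (^-monoʳ-≤ L {{>-nonZero 1≤L}} (m≤m+n m n))))
                      (≤-trans (hg L 1≤L) (*-monoʳ-≤ d (^-monoʳ-≤ L {{>-nonZero 1≤L}} (m≤n+m n m)))))
            (≤-reflexive (sym (*-distribʳ-+ (L ^ (m + n)) c d)))

  bounded-* : ∀ {f g} → PolyBounded f → PolyBounded g → PolyBounded (λ L → f L * g L)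
  bounded-* {f} {g} (c , m , hf) (d , n , hg) = c * d , m + n , λ L 1≤L →
    ≤-trans (*-mono-≤ (hf L 1≤L) (hg L 1≤L)) (≤-reflexive (trans (e c (L ^ m) d (L ^ n)) (cong (c * d *_) (sym (^-distribˡ-+-* L m n)))))
    where e : ∀ c x d y → c * x * (d * y) ≡ c * d * (x * y)
          e = solve-∀

  bounded-^ : ∀ {f} → PolyBounded f → ∀ n → PolyBounded (λ L → f L ^ n)
  bounded-^ h zero    = bounded-const 1
  bounded-^ h (suc n) = bounded-* h (bounded-^ h n)

  -- With a = ⌊L / (n + 1)⌋ one has L ≤ (n + 1) 2^a and 2^L ≥ 2^(a n) 2^a.
  polynomial≤exponential : ∀ {f} → PolyBounded f → ∃ λ L₀ → ∀ L → L₀ ≤ L → f L ≤ 2 ^ L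
  polynomial≤exponential {f} (c , n , h) = suc (A * suc n) , λ L L₀≤L → bound L L₀≤L
    where
    A = c * suc n ^ n
    bound : ∀ L → suc (A * suc n) ≤ L → f L ≤ 2 ^ L
    bound L L₀≤L = begin
      f L                               ≤⟨ h L (≤-trans (s≤s z≤n) L₀≤L) ⟩
      c * L ^ n                         ≤⟨ *-monoʳ-≤ c (^-monoˡ-≤ n L≤) ⟩
      c * (suc n * 2 ^ a) ^ n           ≡⟨ cong (c *_) (*-^ (suc n) (2 ^ a) n) ⟩
      c * (suc n ^ n * (2 ^ a) ^ n)     ≡⟨ *-assoc c (suc n ^ n) _ ⟨
      A * (2 ^ a) ^ n                   ≤⟨ *-monoˡ-≤ ((2 ^ a) ^ n) (≤-trans A≤a (<⇒≤ (n<2^n a))) ⟩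
      2 ^ a * (2 ^ a) ^ n               ≡⟨ ^-*-assoc 2 a (suc n) ⟩
      2 ^ (a * suc n)                   ≤⟨ ^-monoʳ-≤ 2 (m/n*n≤m L (suc n)) ⟩
      2 ^ L                             ∎
      where
      open ≤-Reasoning
      a = L / suc n
      A≤a : A ≤ a
      A≤a = ≤-trans (≤-reflexive (sym (m*n/n≡m A (suc n)))) (/-monoˡ-≤ (suc n) (<⇒≤ L₀≤L))
      L≤ : L ≤ suc n * 2 ^ a
      L≤ = begin
        L                               ≡⟨ m≡m%n+[m/n]*n L (suc n) ⟩
        L % suc n + a * suc n           ≤⟨ +-monoˡ-≤ (a * suc n) (<⇒≤ (m%n<n L (suc n))) ⟩
        suc a * suc n                   ≡⟨ *-comm (suc a) (suc n) ⟩
        suc n * suc a                   ≤⟨ *-monoʳ-≤ (suc n) (n<2^n a) ⟩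
        suc n * 2 ^ a                   ∎

  m^2≡m*m : ∀ m → m ^ 2 ≡ m * m
  m^2≡m*m m = cong (m *_) (*-identityʳ m)

  -- Convexity of the cube at a and 1. With `fourth-suc` it carries an upper bound at H over to H +
  -- 1 at the cost of a constant.
  cube-suc : ∀ a → suc a ^ 3 ≤ 4 * (a ^ 3) + 4
  cube-suc zero    = s≤s z≤n
  cube-suc (suc b) = ≤-trans (m≤m+n _ (3 * (b * b * b) + 6 * (b * b))) (≤-reflexive (e b))
    where e : ∀ b → suc (suc b) * (suc (suc b) * (suc (suc b) * 1)) + (3 * (b * b * b) + 6 * (b * b)) ≡ 4 * (suc b * (suc b * (suc b * 1))) + 4
          e = solve-∀

  fourth-suc : ∀ a → suc a ^ 4 ≤ 8 * (a ^ 4) + 8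
  fourth-suc zero    = s≤s z≤n
  fourth-suc (suc b) = ≤-trans (m≤m+n _ (7 * (b * b * b * b) + 24 * (b * b * b) + 24 * (b * b))) (≤-reflexive (e b))
    where e : ∀ b → suc (suc b) * (suc (suc b) * (suc (suc b) * (suc (suc b) * 1))) + (7 * (b * b * b * b) + 24 * (b * b * b) + 24 * (b * b))
                  ≡ 8 * (suc b * (suc b * (suc b * (suc b * 1)))) + 8
          e = solve-∀

  module Exponents (k d : ℕ) .{{_ : NonZero k}} .{{_ : NonZero d}} where
    m l : ℕ
    m = d * (k + 1)
    l = 2 * k * d

    private instance
      mnz : NonZero m
      mnz = m*n≢0 d (k + 1) {{it′}} {{>-nonZero (≤-trans (s≤s z≤n) (m≤n+m 1 k))}}
        where it′ : NonZero d
              it′ = >-nonZero (>-nonZero⁻¹ d)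

    l≤2m : l ≤ 2 * m
    l≤2m = ≤-trans (*-monoˡ-≤ d (*-monoʳ-≤ 2 (m≤m+n k 1))) (≤-reflexive (e d (k + 1)))
      where e : ∀ d x → 2 * x * d ≡ 2 * (d * x)
            e = solve-∀

    -- The surplus p^(e(k+1)) is at least X^m, since X^d ≤ p ≤ p^e: this is where ε is exchanged for
    -- X. Keeping only thirds of the two intervals costs 3^m and 3^l ≤ 9^m, together 27^m.
    separated : ∀ {e p N J W Q X} .{{_ : NonZero p}} → 1 ≤ e → p ^ ((d + e) * (k + 1)) < N ^ m * J ^ l → N ≤ 3 * W → J ≤ 3 * Q → X ^ d ≤ p →
                (X * p) ^ m < (27 * W) ^ m * Q ^ l
    separated {e} {p} {N} {J} {W} {Q} {X} 1≤e hyp N≤ J≤ X^d≤p = begin-strict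
      (X * p) ^ m                                ≡⟨ *-^ X p m ⟩
      X ^ m * p ^ m                              ≡⟨ cong (_* p ^ m) (sym (^-*-assoc X d (k + 1))) ⟩
      (X ^ d) ^ (k + 1) * p ^ m                  ≤⟨ *-monoˡ-≤ (p ^ m) (^-monoˡ-≤ (k + 1) (≤-trans X^d≤p (≤-trans (≤-reflexive (sym (*-identityʳ p))) (^-monoʳ-≤ p 1≤e)))) ⟩
      (p ^ e) ^ (k + 1) * p ^ m                  ≡⟨ cong (_* p ^ m) (^-*-assoc p e (k + 1)) ⟩
      p ^ (e * (k + 1)) * p ^ m                  ≡⟨ ^-distribˡ-+-* p (e * (k + 1)) m ⟨
      p ^ (e * (k + 1) + m)                      ≡⟨ cong (p ^_) (e₁ e d (k + 1)) ⟩
      p ^ ((d + e) * (k + 1))                    <⟨ hyp ⟩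
      N ^ m * J ^ l                              ≤⟨ *-mono-≤ (^-monoˡ-≤ m N≤) (^-monoˡ-≤ l J≤) ⟩
      (3 * W) ^ m * (3 * Q) ^ l                  ≡⟨ cong ((3 * W) ^ m *_) (*-^ 3 Q l) ⟩
      (3 * W) ^ m * (3 ^ l * Q ^ l)              ≤⟨ *-monoʳ-≤ ((3 * W) ^ m) (*-monoˡ-≤ (Q ^ l) (≤-trans (^-monoʳ-≤ 3 l≤2m) (≤-reflexive (sym (^-*-assoc 3 2 m))))) ⟩
      (3 * W) ^ m * (9 ^ m * Q ^ l)              ≡⟨ *-assoc ((3 * W) ^ m) (9 ^ m) (Q ^ l) ⟨
      (3 * W) ^ m * 9 ^ m * Q ^ l                ≡⟨ cong (_* Q ^ l) (trans (sym (*-^ (3 * W) 9 m)) (cong (_^ m) (e₂ W))) ⟩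
      (27 * W) ^ m * Q ^ l                       ∎
      where
      open ≤-Reasoning
      e₁ : ∀ e d x → e * x + d * x ≡ (d + e) * x
      e₁ = solve-∀
      e₂ : ∀ W → 3 * W * 9 ≡ 27 * W
      e₂ = solve-∀

    module _ {p W Q X : ℕ} (star : (X * p) ^ m < (27 * W) ^ m * Q ^ l) where

      -- In real numbers `star` reads X p < 27 W Q^(2k/(k+1)), as l / m = 2k/(k+1). Z is an integer
      -- that majorizes W Q^(2k/(k+1)), so the fractional exponent never appears.
      exceeds : ∀ Z → W ^ m * Q ^ l ≤ Z ^ m → X * p < 27 * Z
      exceeds Z h = ≰⇒> λ 27Z≤Xp → <⇒≱ star (begin
        (27 * W) ^ m * Q ^ l          ≡⟨ cong (_* Q ^ l) (*-^ 27 W m) ⟩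
        27 ^ m * W ^ m * Q ^ l        ≡⟨ *-assoc (27 ^ m) (W ^ m) (Q ^ l) ⟩
        27 ^ m * (W ^ m * Q ^ l)      ≤⟨ *-monoʳ-≤ (27 ^ m) h ⟩
        27 ^ m * Z ^ m                ≡⟨ *-^ 27 Z m ⟨
        (27 * Z) ^ m                  ≤⟨ ^-monoˡ-≤ m 27Z≤Xp ⟩
        (X * p) ^ m                   ∎)
        where open ≤-Reasoning

      exceeds-square : 1 ≤ Q → X * p < 27 * (W * (Q * Q))
      exceeds-square 1≤Q = exceeds (W * (Q * Q)) (begin
        W ^ m * Q ^ l                 ≤⟨ *-monoʳ-≤ (W ^ m) (^-monoʳ-≤ Q {{>-nonZero 1≤Q}} l≤2m) ⟩
        W ^ m * Q ^ (2 * m)           ≡⟨ cong (W ^ m *_) (trans (sym (^-*-assoc Q 2 m)) (cong (_^ m) (m^2≡m*m Q))) ⟩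
        W ^ m * (Q * Q) ^ m           ≡⟨ *-^ W (Q * Q) m ⟨
        (W * (Q * Q)) ^ m             ∎)
        where open ≤-Reasoning

      -- The majorant Q^(2k/(k+1)) ≤ T^k. It is applied when a candidate V is too large for Q, to
      -- conclude that V^k W is large.
      exceeds-power : ∀ T → Q * Q ≤ T ^ suc k → X * p < 27 * (W * T ^ k)
      exceeds-power T h = exceeds (W * T ^ k) (begin
        W ^ m * Q ^ l                      ≡⟨ cong (W ^ m *_) (trans (cong (Q ^_) (*-assoc 2 k d)) (trans (sym (^-*-assoc Q 2 (k * d))) (cong (_^ (k * d)) (m^2≡m*m Q)))) ⟩
        W ^ m * (Q * Q) ^ (k * d)          ≤⟨ *-monoʳ-≤ (W ^ m) (^-monoˡ-≤ (k * d) h) ⟩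
        W ^ m * (T ^ suc k) ^ (k * d)      ≡⟨ cong (W ^ m *_) (trans (^-*-assoc T (suc k) (k * d)) (trans (cong (T ^_) (e k d)) (sym (^-*-assoc T k m)))) ⟩
        W ^ m * (T ^ k) ^ m                ≡⟨ *-^ W (T ^ k) m ⟨
        (W * T ^ k) ^ m                    ∎)
        where
        open ≤-Reasoning
        e : ∀ k d → suc k * (k * d) ≡ k * (d * (k + 1))
        e = solve-∀

-- The three ranges of the numerator interval

module CaseAnalysis where
  open Congruence
  open FractionSums
  open Regimes
  open LongIntervals
  open Growth
  open import Data.Integer using (ℤ)
  open import Data.Integer.Tactic.RingSolver renaming (solve-∀ to ℤ-solve-∀)
  open import Data.Nat
  open import Data.Nat.DivMod
  open import Data.Nat.Properties
  open import Data.Nat.Tactic.RingSolver using (solve-∀)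

  -- 6200 = 1240 · 5, from W ≤ 1240 D and the target 5 K L p ≤ V^k D in `Middle`. The 5 is there
  -- because 5² exceeds the 20 of `manyNumerators`.
  marginLoss : ℕ → ℕ → ℕ
  marginLoss k L = 6200 * (imageLoss k L * L)

  module Assembly (p : ℕ) .{{_ : NonZero p}} (prime : Prime p) (4≤p : 4 ≤ p) (L : ℕ) .{{_ : NonZero L}} (p<2^L : p < 2 ^ L)
                  (i₀ W b Q : ℕ) (1≤i₀ : 1 ≤ i₀) (i₀+W≤p : i₀ + W ≤ p) (1≤W : 1 ≤ W) (1≤b : 1 ≤ b) (1≤Q : 1 ≤ Q) (b+Q≤p : b + Q ≤ p)
                  (k d : ℕ) .{{_ : NonZero k}} .{{_ : NonZero d}} where
    open Exponents k d
    open Sums p prime i₀ W b Q 1≤b b+Q≤p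

    open ≤-Reasoning

    K Y : ℕ
    K = imageLoss k L
    Y = marginLoss k L

    W≤p : W ≤ p
    W≤p = ≤-trans (m≤n+m W i₀) i₀+W≤p

    -- `X-C` is spent on long I, `X-V` and `X-A` on the middle range, `X-B` on short I. Θ is the
    -- length at which the last two ranges meet; g and r are the popularity and the lengthening used
    -- for short I.
    module _ (X Θ g r : ℕ) .{{_ : NonZero r}} (star : (X * p) ^ m < (27 * W) ^ m * Q ^ l)
             (X-C : 27 * (63 * 63) * 24 ≤ X) (X-V : 27 * (16 * k) ^ k ≤ X) (X-A : 27 * ((32 * k) ^ k * Y) ≤ X)
             (X-B : 27 * (Θ * (r * r * (16 * k)) ^ k) ≤ X) (Θ-A : 2 ^ k * Y ≤ Θ)
             (g-large : K * K * 2 * 4 ^ k < suc g) (r-large : 32 * (2 ^ k * g) ≤ r) where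

      -- Copies of i₀ / b. Exactly 4 k fractions are required, while long numerator intervals need
      -- at most five; the surplus is subtracted from the target beforehand.
      pad : ∀ n → ∃ λ c → Rep n c
      pad zero    = ℤ.+ 0 , Residues.≈-refl p prime
      pad (suc n) = extend (pad n)
        where
        e : ∀ c q → c ≡ q ℤ.+ c ℤ.- q
        e = ℤ-solve-∀
        extend : (∃ λ c → Rep n c) → ∃ λ c → Rep (suc n) c
        extend (c , r) = ℤ.+ i₀ ℤ.* Residues.inv p prime (ℤ.+ b) ℤ.+ c , i₀ , b ,
          (≤-refl , ≤-trans (≤-reflexive (+-comm 1 i₀)) (+-monoʳ-≤ i₀ 1≤W)) , (≤-refl , ≤-trans (≤-reflexive (+-comm 1 b)) (+-monoʳ-≤ b 1≤Q)) ,
          Rep-resp n (Residues.≈-reflexive p prime (e c (ℤ.+ i₀ ℤ.* Residues.inv p prime (ℤ.+ b)))) r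

      padded : ∀ m n → (∀ a → Rep m a) → ∀ a → Rep (m + n) a
      padded m n h a = extend (pad n)
        where
        e : ∀ a c → a ℤ.- c ℤ.+ c ≡ a
        e = ℤ-solve-∀
        extend : (∃ λ c → Rep n c) → Rep (m + n) a
        extend (c , r) = Rep-resp (m + n) (Residues.≈-reflexive p prime (e a c)) (Rep-+ m n (h (a ℤ.- c)) r)

      square-bracket : ∃ λ s → 2 ≤ s × s * s ≤ p × ¬ (suc s * suc s ≤ p)
      square-bracket = greatest (λ s → s * s ≤? p) 2 p 4≤p (<⇒≱ (≤-trans (n≤1+n (suc p)) (m≤m*n (2 + p) (2 + p))))

      -- The value H + 1 serves as lower bound for the denominators. That H itself is too small
      -- keeps W (H + 1)^(h+1) of order p, and this is what shows J to be long enough to contain a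
      -- steep slope.
      bracket : ∀ h → ∃ λ H → W * H ^ suc h < 2 * p × 2 * p ≤ W * suc H ^ suc h
      bracket h = conclude (greatest (λ H → W * H ^ suc h <? 2 * p) 0 (2 * p) (subst (_< 2 * p) (sym (*-zeroʳ W)) (>-nonZero⁻¹ (2 * p) {{m*n≢0 2 p}})) (≤⇒≯ big))
        where
        big : 2 * p ≤ W * (2 * p) ^ suc h
        big = ≤-trans (m≤m*n (2 * p) ((2 * p) ^ h) {{m^n≢0 (2 * p) h {{m*n≢0 2 p}}}}) (m≤n*m ((2 * p) ^ suc h) W {{>-nonZero 1≤W}})
        conclude : (∃ λ H → 0 ≤ H × W * H ^ suc h < 2 * p × ¬ (W * suc H ^ suc h < 2 * p)) → ∃ λ H → W * H ^ suc h < 2 * p × 2 * p ≤ W * suc H ^ suc h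
        conclude (H , _ , lt , nlt) = H , lt , ≮⇒≥ nlt

      -- 63 = 2 + 61, where N = 2 (H + 1)² + 1 is the least length exceeding twice the square and 60
      -- is the two margins.
      short⇒ : ∀ H → ¬ (2 * (suc H * suc H) + 1 + 60 ≤ Q) → Q ≤ 63 * (suc H * suc H)
      short⇒ H h = ≤-trans (<⇒≤ (≰⇒> h)) (≤-trans (≤-reflexive (+-assoc (2 * (suc H * suc H)) 1 60))
        (≤-trans (+-monoʳ-≤ (2 * (suc H * suc H)) (m≤m*n 61 (suc H * suc H))) (≤-reflexive (e (suc H * suc H)))))
        where e : ∀ x → 2 * x + 61 * x ≡ 63 * x
              e = solve-∀

      -- For k = 1 only four fractions are allowed, hence only the cube of H. But then the exponent
      -- 2k/(k+1) is 1 and X p < 27 W Q, whereas a short J would make W Q at most of order W (H +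
      -- 1)³, that is, of order p.
      long₁ : ∀ H → W * H ^ 3 < 2 * p → k ≡ 1 → 2 * (suc H * suc H) + 1 + 60 ≤ Q
      long₁ H lt k≡1 = ≮⇒≥ λ short → <⇒≱ (exceeds {p} {W} {Q} {X} star (W * Q) (≤-reflexive (trans (cong (λ v → W ^ m * Q ^ v) l≡m) (sym (*-^ W Q m))))) (begin
        27 * (W * Q)                              ≤⟨ *-monoʳ-≤ 27 (*-monoʳ-≤ W (short⇒ H (<⇒≱ short))) ⟩
        27 * (W * (63 * (suc H * suc H)))         ≤⟨ *-monoʳ-≤ 27 (*-monoʳ-≤ W (*-monoʳ-≤ 63 (≤-trans (m≤m*n (suc H * suc H) (suc H)) (≤-reflexive (e₁ (suc H)))))) ⟩
        27 * (W * (63 * suc H ^ 3))               ≤⟨ *-monoʳ-≤ 27 (*-monoʳ-≤ W (*-monoʳ-≤ 63 (cube-suc H))) ⟩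
        27 * (W * (63 * (4 * H ^ 3 + 4)))         ≡⟨ e₂ 27 63 W (H ^ 3) ⟩
        27 * 63 * (4 * (W * H ^ 3) + 4 * W)       ≤⟨ *-monoʳ-≤ (27 * 63) (+-mono-≤ (*-monoʳ-≤ 4 (<⇒≤ lt)) (*-monoʳ-≤ 4 W≤p)) ⟩
        27 * 63 * (4 * (2 * p) + 4 * p)           ≡⟨ e₃ (27 * 63) p ⟩
        20412 * p                                 ≤⟨ *-monoˡ-≤ p (≤-trans (m≤m+n 20412 (27 * (63 * 63) * 24 ∸ 20412)) X-C) ⟩
        X * p                                     ∎)
        where
        l≡m : l ≡ m
        l≡m = trans (cong (λ v → 2 * v * d) k≡1) (trans (*-comm 2 d) (cong (λ v → d * (v + 1)) (sym k≡1)))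
        e₁ : ∀ h → h * h * h ≡ h * (h * (h * 1))
        e₁ = solve-∀
        e₂ : ∀ c c′ W x → c * (W * (c′ * (4 * x + 4))) ≡ c * c′ * (4 * (W * x) + 4 * W)
        e₂ = solve-∀
        e₃ : ∀ c p → c * (4 * (2 * p) + 4 * p) ≡ c * 12 * p
        e₃ = solve-∀

      square-long : ∀ c c′ H → W * H ^ 4 < 2 * p → Q ≤ c′ * (suc H * suc H) → c * (W * (Q * Q)) ≤ c * (c′ * c′) * 24 * p
      square-long c c′ H lt short = begin
        c * (W * (Q * Q))                                              ≤⟨ *-monoʳ-≤ c (*-monoʳ-≤ W (*-mono-≤ short short)) ⟩
        c * (W * (c′ * (suc H * suc H) * (c′ * (suc H * suc H))))      ≡⟨ e₁ c c′ W (suc H) ⟩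
        c * (c′ * c′) * (W * suc H ^ 4)                                ≤⟨ *-monoʳ-≤ (c * (c′ * c′)) (*-monoʳ-≤ W (fourth-suc H)) ⟩
        c * (c′ * c′) * (W * (8 * H ^ 4 + 8))                          ≡⟨ e₂ (c * (c′ * c′)) W (H ^ 4) ⟩
        c * (c′ * c′) * (8 * (W * H ^ 4) + 8 * W)                      ≤⟨ *-monoʳ-≤ (c * (c′ * c′)) (+-mono-≤ (*-monoʳ-≤ 8 (<⇒≤ lt)) (*-monoʳ-≤ 8 W≤p)) ⟩
        c * (c′ * c′) * (8 * (2 * p) + 8 * p)                          ≡⟨ e₃ (c * (c′ * c′)) p ⟩
        c * (c′ * c′) * 24 * p                                         ∎
        where
        e₁ : ∀ c c′ W h → c * (W * (c′ * (h * h) * (c′ * (h * h)))) ≡ c * (c′ * c′) * (W * (h * (h * (h * (h * 1)))))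
        e₁ = solve-∀
        e₂ : ∀ c W x → c * (W * (8 * x + 8)) ≡ c * (8 * (W * x) + 8 * W)
        e₂ = solve-∀
        e₃ : ∀ c p → c * (8 * (2 * p) + 8 * p) ≡ c * 24 * p
        e₃ = solve-∀

      -- From k = 2 on five fractions are available, so H⁴ is of order p / W. A short J would make W
      -- Q² of that order times W, that is, of order p, against the exponent 2k/(k+1) ≤ 2.
      long₂ : ∀ H → W * H ^ 4 < 2 * p → 2 * (suc H * suc H) + 1 + 60 ≤ Q
      long₂ H lt = ≮⇒≥ λ short → <⇒≱ (exceeds-square {p} {W} {Q} {X} star 1≤Q)
        (≤-trans (square-long 27 63 H lt (short⇒ H (<⇒≱ short))) (*-monoˡ-≤ p X-C))

      module Long (s : ℕ) (2≤s : 2 ≤ s) (s²≤p : s * s ≤ p) (p<[1+s]² : p < suc s * suc s) (s-small : 310 * s ≤ W) where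
        open LongNumerators p prime i₀ W b Q i₀+W≤p 1≤b b+Q≤p s 2≤s s²≤p p<[1+s]² s-small using (longNumerators)

        run : ∀ h → h ≤ 3 → (∀ H → W * H ^ suc h < 2 * p → 2 * (suc H * suc H) + 1 + 60 ≤ Q) → ∀ a → Rep (suc (suc h)) a
        run h h≤3 long = conclude (bracket h)
          where
          conclude : (∃ λ H → W * H ^ suc h < 2 * p × 2 * p ≤ W * suc H ^ suc h) → ∀ a → Rep (suc (suc h)) a
          conclude (H , lt , ge) = longNumerators (suc h) (suc H) (2 * (suc H * suc H) + 1) (s≤s h≤3) (s≤s z≤n) (long H lt)
            (≤-reflexive (+-comm 1 (2 * (suc H * suc H)))) ge

        all : ∀ n → suc n ≡ k → ∀ a → Rep (4 * k) a
        all zero    1≡k = subst (λ v → ∀ a → Rep (4 * v) a) 1≡k (run 2 (s≤s (s≤s z≤n)) (λ H lt → long₁ H lt (sym 1≡k)))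
        all (suc n) k≡  = subst (λ v → ∀ a → Rep v a) (trans (e n) (cong (4 *_) k≡)) (padded 5 (3 + 4 * n) (run 3 ≤-refl long₂))
          where e : ∀ n → 5 + (3 + 4 * n) ≡ 4 * suc (suc n)
                e = solve-∀

      V-pos : ∀ {V} → 1 ≤ V → NonZero V
      V-pos = >-nonZero

      double : ∀ {V} → 1 ≤ V → suc V ≤ 2 * V
      double {V} 1≤V = ≤-trans (+-monoˡ-≤ V 1≤V) (≤-reflexive (cong (V +_) (sym (+-identityʳ V))))

      p<[1+p]^k : p < suc p ^ k
      p<[1+p]^k = ≤-trans (≤-reflexive (sym (*-identityʳ (suc p)))) (^-monoʳ-≤ (suc p) (>-nonZero⁻¹ k))

      halve : ∀ {V} → 1 ≤ V → p < suc V ^ k → p < 2 ^ k * V ^ k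
      halve {V} 1≤V h = <-≤-trans h (≤-trans (^-monoˡ-≤ k (double 1≤V)) (≤-reflexive (*-^ 2 V k)))

      instance
        Knz : NonZero K
        Knz = m*n≢0 5124 (k * L) {{_}} {{m*n≢0 k L}}

      module Middle (s : ℕ) (s²≤p : s * s ≤ p) (W<310s : W < 310 * s) (Θ≤W : Θ ≤ W) where

        -- 620 = 2 · 310: since W < 310 s this gives 2 D ≤ s, hence 4 D² ≤ p, as the energy bound
        -- for the numerators demands.
        D : ℕ
        D = W / 620

        620≤W : 620 ≤ W
        620≤W = ≤-trans (≤-trans (m≤m*n 620 10) (≤-trans (m≤m*n 6200 (K * L) {{m*n≢0 K L}}) (m≤n*m Y (2 ^ k) {{m^n≢0 2 k}}))) (≤-trans Θ-A Θ≤W)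

        1≤D : 1 ≤ D
        1≤D = /-monoˡ-≤ 620 620≤W

        instance
          Dnz : NonZero D
          Dnz = >-nonZero 1≤D

        D620≤W : D * 620 ≤ W
        D620≤W = m/n*n≤m W 620

        W≤1240D : W ≤ 1240 * D
        W≤1240D = begin
          W                       ≡⟨ m≡m%n+[m/n]*n W 620 ⟩
          W % 620 + D * 620       ≤⟨ +-monoˡ-≤ (D * 620) (≤-trans (<⇒≤ (m%n<n W 620)) (m≤n*m 620 D)) ⟩
          D * 620 + D * 620       ≡⟨ e 620 D ⟩
          1240 * D                ∎
          where e : ∀ c D → D * c + D * c ≡ 2 * c * D
                e = solve-∀

        3D≤W : 3 * D ≤ W
        3D≤W = ≤-trans (≤-trans (*-monoˡ-≤ D (m≤m+n 3 617)) (≤-reflexive (*-comm 620 D))) D620≤W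

        4DD≤p : 4 * (D * D) ≤ p
        4DD≤p = begin
          4 * (D * D)             ≡⟨ e₁ D ⟩
          2 * D * (2 * D)         ≤⟨ *-mono-≤ 2D≤s 2D≤s ⟩
          s * s                   ≤⟨ s²≤p ⟩
          p                       ∎
          where
          e₁ : ∀ D → 4 * (D * D) ≡ 2 * D * (2 * D)
          e₁ = solve-∀
          e₂ : ∀ c D → c * (2 * D) ≡ D * (c * 2)
          e₂ = solve-∀
          2D≤s : 2 * D ≤ s
          2D≤s = *-cancelˡ-≤ 310 (≤-trans (≤-reflexive (e₂ 310 D)) (≤-trans D620≤W (<⇒≤ W<310s)))

        Admissible : ℕ → Set
        Admissible V = V ^ k ≤ p × (16 * k * V) ^ suc k ≤ Q * Q

        admissible? : ∀ V → Dec (Admissible V)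
        admissible? V = (V ^ k ≤? p) ×-dec ((16 * k * V) ^ suc k ≤? Q * Q)

        admissible-1 : Admissible 1
        admissible-1 = ≤-trans (≤-reflexive (^-zeroˡ k)) (≤-trans (s≤s z≤n) 4≤p) ,
          ≮⇒≥ λ lt → <⇒≱ (exceeds-power {p} {W} {Q} {X} star (16 * k * 1) (<⇒≤ lt)) (begin
            27 * (W * (16 * k * 1) ^ k)     ≡⟨ cong (λ v → 27 * (W * v ^ k)) (*-identityʳ (16 * k)) ⟩
            27 * (W * (16 * k) ^ k)         ≤⟨ *-monoʳ-≤ 27 (*-monoˡ-≤ ((16 * k) ^ k) W≤p) ⟩
            27 * (p * (16 * k) ^ k)         ≡⟨ e p ((16 * k) ^ k) ⟩
            27 * (16 * k) ^ k * p           ≤⟨ *-monoˡ-≤ p X-V ⟩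
            X * p                           ∎)
          where e : ∀ p x → 27 * (p * x) ≡ 27 * x * p
                e = solve-∀

        -- V + 1 violates one of the two conditions. If (V + 1)^k > p, then V^k > p / 2^k and W ≥ Θ
        -- suffices. If it is too large for Q, then Q² < (32 k V)^(k+1), and `star` bounds V^k W
        -- from below.
        enough : ∀ V → 1 ≤ V → ¬ Admissible (suc V) → 5 * (K * L * p) ≤ V ^ k * D
        enough V 1≤V ¬adm = ≮⇒≥ λ lt → ¬adm (≮⇒≥ (λ big → <⇒≱ (first lt big) ≤-refl) , ≮⇒≥ (λ big → <⇒≱ (second lt big) ≤-refl))
          where
          V^kW< : V ^ k * D < 5 * (K * L * p) → V ^ k * W < Y * p
          V^kW< lt = begin-strict
            V ^ k * W                     ≤⟨ *-monoʳ-≤ (V ^ k) W≤1240D ⟩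
            V ^ k * (1240 * D)            ≡⟨ e₁ 1240 (V ^ k) D ⟩
            1240 * (V ^ k * D)            <⟨ *-monoʳ-< 1240 lt ⟩
            1240 * (5 * (K * L * p))      ≡⟨ e₂ 1240 (K * L) p ⟩
            6200 * (K * L) * p            ∎
            where
            e₁ : ∀ c v D → v * (c * D) ≡ c * (v * D)
            e₁ = solve-∀
            e₂ : ∀ c x p → c * (5 * (x * p)) ≡ c * 5 * x * p
            e₂ = solve-∀
          first : V ^ k * D < 5 * (K * L * p) → p < suc V ^ k → p * Θ < p * Θ
          first lt big = begin-strict
            p * Θ                         ≤⟨ *-mono-≤ (<⇒≤ (halve 1≤V big)) Θ≤W ⟩
            2 ^ k * V ^ k * W             ≡⟨ *-assoc (2 ^ k) (V ^ k) W ⟩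
            2 ^ k * (V ^ k * W)           <⟨ *-monoʳ-< (2 ^ k) {{m^n≢0 2 k}} (V^kW< lt) ⟩
            2 ^ k * (Y * p)               ≡⟨ *-assoc (2 ^ k) Y p ⟨
            2 ^ k * Y * p                 ≤⟨ *-monoˡ-≤ p Θ-A ⟩
            Θ * p                         ≡⟨ *-comm Θ p ⟩
            p * Θ                         ∎
          second : V ^ k * D < 5 * (K * L * p) → Q * Q < (16 * k * suc V) ^ suc k → X * p < X * p
          second lt big = begin-strict
            X * p                                     <⟨ exceeds-power {p} {W} {Q} {X} star (32 * k * V) (≤-trans (<⇒≤ big) (^-monoˡ-≤ (suc k) (≤-trans (*-monoʳ-≤ (16 * k) (double 1≤V)) (≤-reflexive (e₁ k V))))) ⟩
            27 * (W * (32 * k * V) ^ k)               ≡⟨ cong (λ v → 27 * (W * v)) (*-^ (32 * k) V k) ⟩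
            27 * (W * ((32 * k) ^ k * V ^ k))         ≡⟨ e₂ W ((32 * k) ^ k) (V ^ k) ⟩
            27 * ((32 * k) ^ k * (V ^ k * W))         ≤⟨ *-monoʳ-≤ 27 (*-monoʳ-≤ ((32 * k) ^ k) (<⇒≤ (V^kW< lt))) ⟩
            27 * ((32 * k) ^ k * (Y * p))             ≡⟨ e₃ ((32 * k) ^ k) Y p ⟩
            27 * ((32 * k) ^ k * Y) * p               ≤⟨ *-monoˡ-≤ p X-A ⟩
            X * p                                     ∎
            where
            e₁ : ∀ k V → 16 * k * (2 * V) ≡ 32 * k * V
            e₁ = solve-∀
            e₂ : ∀ W x v → 27 * (W * (x * v)) ≡ 27 * (x * (v * W))
            e₂ = solve-∀
            e₃ : ∀ x Y p → 27 * (x * (Y * p)) ≡ 27 * (x * Y) * p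
            e₃ = solve-∀

        all : ∀ a → Rep (4 * k) a
        all = conclude (greatest admissible? 1 p admissible-1 (λ adm → <⇒≱ p<[1+p]^k (proj₁ adm)))
          where
          conclude : (∃ λ V → 1 ≤ V × Admissible V × ¬ Admissible (suc V)) → ∀ a → Rep (4 * k) a
          conclude (V , 1≤V , (V^k≤p , small) , ¬adm) =
            Regimes.manyNumerators p prime L p<2^L i₀ W b Q 1≤i₀ i₀+W≤p 1≤b b+Q≤p k V 1 {{it₁}} {{V-pos 1≤V}} V^k≤p (≤-trans (≤-reflexive (*-identityˡ ((16 * k * V) ^ suc k))) small)
              D 3D≤W 4DD≤p big
            where
            it₁ : NonZero k
            it₁ = >-nonZero (>-nonZero⁻¹ k)
            big : K * K * (20 * (p * p) * L) < V ^ k * V ^ k * (D * D)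
            big = begin-strict
              K * K * (20 * (p * p) * L)              ≡⟨ e₁ K p L ⟩
              20 * (K * K * (p * p) * L)              <⟨ *-monoˡ-< (K * K * (p * p) * L) {{m*n≢0 (K * K * (p * p)) L {{m*n≢0 (K * K) (p * p) {{m*n≢0 K K}} {{m*n≢0 p p}}}}}} (≤-trans (m≤m+n 21 4) (m≤m*n 25 L)) ⟩
              25 * L * (K * K * (p * p) * L)          ≡⟨ e₂ K p L ⟩
              5 * (K * L * p) * (5 * (K * L * p))     ≤⟨ *-mono-≤ (enough V 1≤V ¬adm) (enough V 1≤V ¬adm) ⟩
              V ^ k * D * (V ^ k * D)                 ≡⟨ e₃ (V ^ k) D ⟩
              V ^ k * V ^ k * (D * D)                 ∎
              where
              e₁ : ∀ K p L → K * K * (20 * (p * p) * L) ≡ 20 * (K * K * (p * p) * L)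
              e₁ = solve-∀
              e₂ : ∀ K p L → 25 * L * (K * K * (p * p) * L) ≡ 5 * (K * L * p) * (5 * (K * L * p))
              e₂ = solve-∀
              e₃ : ∀ v D → v * D * (v * D) ≡ v * v * (D * D)
              e₃ = solve-∀

      module Short (W<Θ : W < Θ) where

        all : ∀ a → Rep (4 * k) a
        all = conclude (greatest (λ V → V ^ k ≤? p) 1 p (≤-trans (≤-reflexive (^-zeroˡ k)) (≤-trans (s≤s z≤n) 4≤p)) (<⇒≱ p<[1+p]^k))
          where
          conclude : (∃ λ V → 1 ≤ V × V ^ k ≤ p × ¬ (suc V ^ k ≤ p)) → ∀ a → Rep (4 * k) a
          conclude (V , 1≤V , V^k≤p , nle) =
            Regimes.manyDenominators p prime L p<2^L i₀ W b Q 1≤i₀ i₀+W≤p 1≤b b+Q≤p k V r {{it₁}} {{V-pos 1≤V}} V^k≤p small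
              g 1≤W popularity big
            where
            it₁ : NonZero k
            it₁ = >-nonZero (>-nonZero⁻¹ k)
            p<2^kV^k : p < 2 ^ k * V ^ k
            p<2^kV^k = halve 1≤V (≰⇒> nle)
            -- In `small` the factor r² is enlarged to (r²)^(k+1), to obtain the perfect power
            -- T^(k+1) that `exceeds-power` expects; the loss is again polynomial in L. There W < Θ
            -- and V^k ≤ p turn a small Q into X p < X p.
            T = r * r * (16 * k) * V
            instance
              rrnz : NonZero (r * r)
              rrnz = m*n≢0 r r
            small : r * r * (16 * k * V) ^ suc k ≤ Q * Q
            small = ≮⇒≥ λ lt → <⇒≱ (exceeds-power {p} {W} {Q} {X} star T (≤-trans (<⇒≤ lt) (begin
                r * r * (16 * k * V) ^ suc k                 ≤⟨ *-monoˡ-≤ ((16 * k * V) ^ suc k) (m≤m*n (r * r) ((r * r) ^ k) {{m^n≢0 (r * r) k}}) ⟩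
                (r * r) ^ suc k * (16 * k * V) ^ suc k       ≡⟨ *-^ (r * r) (16 * k * V) (suc k) ⟨
                (r * r * (16 * k * V)) ^ suc k               ≡⟨ cong (_^ suc k) (sym (*-assoc (r * r) (16 * k) V)) ⟩
                T ^ suc k                                    ∎))) (begin
              27 * (W * T ^ k)                               ≡⟨ cong (λ v → 27 * (W * v)) (*-^ (r * r * (16 * k)) V k) ⟩
              27 * (W * ((r * r * (16 * k)) ^ k * V ^ k))    ≤⟨ *-monoʳ-≤ 27 (*-mono-≤ (<⇒≤ W<Θ) (*-monoʳ-≤ ((r * r * (16 * k)) ^ k) V^k≤p)) ⟩
              27 * (Θ * ((r * r * (16 * k)) ^ k * p))        ≡⟨ e₁ Θ ((r * r * (16 * k)) ^ k) p ⟩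
              27 * (Θ * (r * r * (16 * k)) ^ k) * p          ≤⟨ *-monoˡ-≤ p X-B ⟩
              X * p                                          ∎)
              where e₁ : ∀ Θ x p → 27 * (Θ * (x * p)) ≡ 27 * (Θ * x) * p
                    e₁ = solve-∀
            popularity : 32 * (p * g) ≤ r * V ^ k
            popularity = begin
              32 * (p * g)                      ≤⟨ *-monoʳ-≤ 32 (*-monoˡ-≤ g (<⇒≤ p<2^kV^k)) ⟩
              32 * (2 ^ k * V ^ k * g)          ≡⟨ e₁ (2 ^ k) (V ^ k) g ⟩
              32 * (2 ^ k * g) * V ^ k          ≤⟨ *-monoˡ-≤ (V ^ k) r-large ⟩
              r * V ^ k                         ∎
              where e₁ : ∀ t v g → 32 * (t * v * g) ≡ 32 * (t * g) * v
                    e₁ = solve-∀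
            big : K * K * (2 * (p * p)) < V ^ k * V ^ k * suc g
            big = begin-strict
              K * K * (2 * (p * p))                                    ≤⟨ *-monoʳ-≤ (K * K) (*-monoʳ-≤ 2 (*-mono-≤ (<⇒≤ p<2^kV^k) (<⇒≤ p<2^kV^k))) ⟩
              K * K * (2 * (2 ^ k * V ^ k * (2 ^ k * V ^ k)))          ≡⟨ e₁ K (2 ^ k) (V ^ k) ⟩
              V ^ k * V ^ k * (K * K * 2 * (2 ^ k * 2 ^ k))            ≡⟨ cong (λ v → V ^ k * V ^ k * (K * K * 2 * v)) (sym (*-^ 2 2 k)) ⟩
              V ^ k * V ^ k * (K * K * 2 * 4 ^ k)                      <⟨ *-monoʳ-< (V ^ k * V ^ k) {{m*n≢0 (V ^ k) (V ^ k) {{Vknz}} {{Vknz}}}} g-large ⟩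
              V ^ k * V ^ k * suc g                                    ∎
              where
              Vknz : NonZero (V ^ k)
              Vknz = m^n≢0 V k {{V-pos 1≤V}}
              e₁ : ∀ K t v → K * K * (2 * (t * v * (t * v))) ≡ v * v * (K * K * 2 * (t * t))
              e₁ = solve-∀

      everyResidue : ∀ a → Rep (4 * k) a
      everyResidue = withRoot square-bracket
        where
        withRoot : (∃ λ s → 2 ≤ s × s * s ≤ p × ¬ (suc s * suc s ≤ p)) → ∀ a → Rep (4 * k) a
        withRoot (s , 2≤s , s²≤p , nle) = cases (310 * s ≤? W) (Θ ≤? W)
          where
          cases : Dec (310 * s ≤ W) → Dec (Θ ≤ W) → ∀ a → Rep (4 * k) a
          cases (yes s-small) _         = Long.all s 2≤s s²≤p (≰⇒> nle) s-small (pred k) (suc-pred k)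
          cases (no large)  (yes Θ≤W)   = Middle.all s s²≤p (≰⇒> large) Θ≤W
          cases (no _)      (no Θ≰W)    = Short.all (≰⇒> Θ≰W)

-- Polylogarithmic losses

module Losses where
  open CaseAnalysis using (marginLoss)
  open Growth
  open Regimes using (imageLoss)
  open import Data.Nat using (ℕ; suc; _+_; _*_; _^_; _≤_; _<_; NonZero)
  open import Data.Nat.Properties

  -- X(L) bounds every loss incurred in the argument; it is a polynomial in L = O(log p).
  module Constants (k : ℕ) where
    Θ g r X : ℕ → ℕ
    Θ L = 2 ^ k * marginLoss k L
    -- S may be smaller than p by the factors 2^k (rounding V) and `imageLoss`; both enter squared,
    -- and 2 is the factor in the density condition.
    g L = imageLoss k L * imageLoss k L * 2 * 4 ^ k
    r L = 32 * (2 ^ k * g L)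
    X L = 27 * (16 * k) ^ k + (27 * ((32 * k) ^ k * marginLoss k L) + (27 * (Θ L * (r L * r L * (16 * k)) ^ k) + 27 * (63 * 63) * 24))

    private
      imageLoss-bounded : PolyBounded (imageLoss k)
      imageLoss-bounded = bounded-* {λ _ → 5124} {λ L → k * L} (bounded-const 5124) (bounded-* {λ _ → k} {λ L → L} (bounded-const k) bounded-id)

      marginLoss-bounded : PolyBounded (marginLoss k)
      marginLoss-bounded = bounded-* {λ _ → 6200} {λ L → imageLoss k L * L} (bounded-const 6200) (bounded-* {imageLoss k} {λ L → L} imageLoss-bounded bounded-id)

      Θ-bounded : PolyBounded Θ
      Θ-bounded = bounded-* {λ _ → 2 ^ k} {marginLoss k} (bounded-const (2 ^ k)) marginLoss-bounded

      g-bounded : PolyBounded g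
      g-bounded = bounded-* {λ L → imageLoss k L * imageLoss k L * 2} {λ _ → 4 ^ k}
        (bounded-* {λ L → imageLoss k L * imageLoss k L} {λ _ → 2} (bounded-* {imageLoss k} {imageLoss k} imageLoss-bounded imageLoss-bounded) (bounded-const 2))
        (bounded-const (4 ^ k))

      r-bounded : PolyBounded r
      r-bounded = bounded-* {λ _ → 32} {λ L → 2 ^ k * g L} (bounded-const 32) (bounded-* {λ _ → 2 ^ k} {g} (bounded-const (2 ^ k)) g-bounded)

    X-bounded : PolyBounded X
    X-bounded = bounded-+ {λ _ → 27 * (16 * k) ^ k} {λ L → 27 * ((32 * k) ^ k * marginLoss k L) + (27 * (Θ L * (r L * r L * (16 * k)) ^ k) + 27 * (63 * 63) * 24)}
      (bounded-const (27 * (16 * k) ^ k))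
      (bounded-+ {λ L → 27 * ((32 * k) ^ k * marginLoss k L)} {λ L → 27 * (Θ L * (r L * r L * (16 * k)) ^ k) + 27 * (63 * 63) * 24}
        (bounded-* {λ _ → 27} {λ L → (32 * k) ^ k * marginLoss k L} (bounded-const 27) (bounded-* {λ _ → (32 * k) ^ k} {marginLoss k} (bounded-const ((32 * k) ^ k)) marginLoss-bounded))
      (bounded-+ {λ L → 27 * (Θ L * (r L * r L * (16 * k)) ^ k)} {λ _ → 27 * (63 * 63) * 24}
        (bounded-* {λ _ → 27} {λ L → Θ L * (r L * r L * (16 * k)) ^ k} (bounded-const 27) (bounded-* {Θ} {λ L → (r L * r L * (16 * k)) ^ k} Θ-bounded
          (bounded-^ {λ L → r L * r L * (16 * k)} (bounded-* {λ L → r L * r L} {λ _ → 16 * k} (bounded-* {r} {r} r-bounded r-bounded) (bounded-const (16 * k))) k)))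
        (bounded-const (27 * (63 * 63) * 24))))

    private
      part₁ : ∀ a b c d → a ≤ a + (b + (c + d))
      part₁ a b c d = m≤m+n a (b + (c + d))
      part₂ : ∀ a b c d → b ≤ a + (b + (c + d))
      part₂ a b c d = ≤-trans (m≤m+n b (c + d)) (m≤n+m (b + (c + d)) a)
      part₃ : ∀ a b c d → c ≤ a + (b + (c + d))
      part₃ a b c d = ≤-trans (m≤m+n c d) (≤-trans (m≤n+m (c + d) b) (m≤n+m (b + (c + d)) a))
      part₄ : ∀ a b c d → d ≤ a + (b + (c + d))
      part₄ a b c d = ≤-trans (m≤n+m d c) (≤-trans (m≤n+m (c + d) b) (m≤n+m (b + (c + d)) a))

    X-V : ∀ L → 27 * (16 * k) ^ k ≤ X L
    X-V L = part₁ (27 * (16 * k) ^ k) (27 * ((32 * k) ^ k * marginLoss k L)) (27 * (Θ L * (r L * r L * (16 * k)) ^ k)) (27 * (63 * 63) * 24)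
    X-A : ∀ L → 27 * ((32 * k) ^ k * marginLoss k L) ≤ X L
    X-A L = part₂ (27 * (16 * k) ^ k) (27 * ((32 * k) ^ k * marginLoss k L)) (27 * (Θ L * (r L * r L * (16 * k)) ^ k)) (27 * (63 * 63) * 24)
    X-B : ∀ L → 27 * (Θ L * (r L * r L * (16 * k)) ^ k) ≤ X L
    X-B L = part₃ (27 * (16 * k) ^ k) (27 * ((32 * k) ^ k * marginLoss k L)) (27 * (Θ L * (r L * r L * (16 * k)) ^ k)) (27 * (63 * 63) * 24)
    Θ-A : ∀ L → 2 ^ k * marginLoss k L ≤ Θ L
    Θ-A L = ≤-refl {2 ^ k * marginLoss k L}
    g-large : ∀ L → imageLoss k L * imageLoss k L * 2 * 4 ^ k < suc (g L)
    g-large L = n<1+n (imageLoss k L * imageLoss k L * 2 * 4 ^ k)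
    r-large : ∀ L → 32 * (2 ^ k * g L) ≤ r L
    r-large L = ≤-refl {32 * (2 ^ k * g L)}
    X-C : ∀ L → 27 * (63 * 63) * 24 ≤ X L
    X-C L = part₄ (27 * (16 * k) ^ k) (27 * ((32 * k) ^ k * marginLoss k L)) (27 * (Θ L * (r L * r L * (16 * k)) ^ k)) (27 * (63 * 63) * 24)

    r-nonZero : ∀ L .{{_ : NonZero k}} .{{_ : NonZero L}} → NonZero (r L)
    r-nonZero L = m*n≢0 32 (2 ^ k * g L) {{_}} {{m*n≢0 (2 ^ k) (g L) {{m^n≢0 2 k}} {{g-nonZero}}}}
      where
      K = imageLoss k L
      Knz : NonZero K
      Knz = m*n≢0 5124 (k * L) {{_}} {{m*n≢0 k L}}
      g-nonZero : NonZero (g L)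
      g-nonZero = m*n≢0 (K * K * 2) (4 ^ k) {{m*n≢0 (K * K) 2 {{m*n≢0 K K {{Knz}} {{Knz}}}}}} {{m^n≢0 4 k}}

-- Assembling the bounds for large p

open import Defs
open import Data.Nat using (ℕ; zero; suc; _+_; _*_; _^_; _≤_; _<_; _≤?_; NonZero; z≤n; s≤s; >-nonZero)
open import Data.Nat.Properties
open CaseAnalysis using (module Assembly)
open FractionSums using (_∈[_,+_⟩; integerInterval; module Sums)
open Growth
open Losses

theorem3 : (k : ℕ) → 1 ≤ k → (e d : ℕ) → 1 ≤ e → 1 ≤ d →
    Σ ℕ λ p₀ → (p : ℕ) → .{{_ : NonZero p}} → Prime p → p₀ < p →
    (aI NI aJ NJ : ℕ) →
    ValidInterval p aI NI → NonzeroInterval aI NI →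
    ValidInterval p aJ NJ → NonzeroInterval aJ NJ →
    p ^ ((d + e) * (k + 1)) < NI ^ (d * (k + 1)) * NJ ^ (2 * k * d) →
    (lam : ℕ) → lam < p →
    HasSolution p (4 * k) aI NI aJ NJ lam
-- L will be the bit length of p, so 2^(L-1) ≤ p < 2^L; the factor 2 yields X(L)^d ≤ 2^(L-1) ≤ p.
theorem3 k 1≤k e d 1≤e 1≤d = threshold (polynomial≤exponential (bounded-* {λ _ → 2} {λ L → X L ^ d} (bounded-const 2) (bounded-^ {X} X-bounded d)))
  where
  open Constants k
  threshold : (∃ λ L₀ → ∀ L → L₀ ≤ L → 2 * X L ^ d ≤ 2 ^ L) →
    Σ ℕ λ p₀ → (p : ℕ) → .{{_ : NonZero p}} → Prime p → p₀ < p →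
    (aI NI aJ NJ : ℕ) →
    ValidInterval p aI NI → NonzeroInterval aI NI →
    ValidInterval p aJ NJ → NonzeroInterval aJ NJ →
    p ^ ((d + e) * (k + 1)) < NI ^ (d * (k + 1)) * NJ ^ (2 * k * d) →
    (lam : ℕ) → lam < p →
    HasSolution p (4 * k) aI NI aJ NJ lam
  -- The summand 2^L₀ forces L ≥ L₀, and 4 ensures that the integer square root of p is at least 2.
  threshold (L₀ , large) = 4 + 2 ^ L₀ , λ p {{nz}} p-prime p₀<p aI NI aJ NJ vI nzI vJ nzJ hyp lam lam<p →
    solve p p-prime p₀<p aI NI aJ NJ hyp lam lam<p
      (greatest (λ j → 2 ^ j ≤? p) 0 p (≤-trans (s≤s z≤n) p₀<p) (<⇒≱ (n<2^n p)))
      (integerInterval p aI NI vI nzI) (integerInterval p aJ NJ vJ nzJ) (proj₁ (proj₂ vI)) (proj₁ (proj₂ vJ))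
    where
    SubInterval : (p : ℕ) → .{{NonZero p}} → ℕ → ℕ → Set
    SubInterval p a N = ∃ λ a′ → ∃ λ n → 1 ≤ a′ × a′ + n ≤ p × N ≤ 3 * n × (∀ {x} → x ∈[ a′ ,+ n ⟩ → InInterval p a N x)
    solve : ∀ p .{{_ : NonZero p}} → Prime p → 4 + 2 ^ L₀ < p → ∀ aI NI aJ NJ →
            p ^ ((d + e) * (k + 1)) < NI ^ (d * (k + 1)) * NJ ^ (2 * k * d) → ∀ lam → lam < p →
            (∃ λ j → 0 ≤ j × 2 ^ j ≤ p × ¬ (2 ^ suc j ≤ p)) → SubInterval p aI NI → SubInterval p aJ NJ → 1 ≤ NI → 1 ≤ NJ →
            HasSolution p (4 * k) aI NI aJ NJ lam
    solve p p-prime p₀<p aI NI aJ NJ hyp lam lam<p (j , _ , 2^j≤p , nle) (i₀ , W , 1≤i₀ , i₀+W≤p , NI≤3W , I⊆) (b , Q , 1≤b , b+Q≤p , NJ≤3Q , J⊆) 1≤NI 1≤NJ =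
      Sums.Rep⇒HasSolution p p-prime i₀ W b Q 1≤b b+Q≤p (λ {x} → I⊆ {x}) (λ {y} → J⊆ {y}) (4 * k) lam lam<p
        (Assembly.everyResidue p p-prime 4≤p L p<2^L i₀ W b Q 1≤i₀ i₀+W≤p (third 1≤NI NI≤3W) 1≤b (third 1≤NJ NJ≤3Q) b+Q≤p k d
          (X L) (Θ L) (g L) (r L) {{r-nonZero L}} star
          (X-C L) (X-V L) (X-A L) (X-B L)
          (Θ-A L) (g-large L) (r-large L) (ℤ.+ lam))
      where
      L = suc j
      instance
        knz : NonZero k
        knz = >-nonZero 1≤k
        dnz : NonZero d
        dnz = >-nonZero 1≤d
      4≤p : 4 ≤ p
      4≤p = ≤-trans (m≤m+n 4 (2 ^ L₀)) (<⇒≤ p₀<p)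
      p<2^L : p < 2 ^ L
      p<2^L = ≰⇒> nle
      L₀≤L : L₀ ≤ L
      L₀≤L = ≮⇒≥ λ L<L₀ → <⇒≱ p<2^L (≤-trans (^-monoʳ-≤ 2 (<⇒≤ L<L₀)) (≤-trans (m≤n+m (2 ^ L₀) 4) (<⇒≤ p₀<p)))
      X^d≤p : X L ^ d ≤ p
      X^d≤p = *-cancelˡ-≤ 2 (≤-trans (large L L₀≤L) (*-monoʳ-≤ 2 2^j≤p))
      third : ∀ {N n} → 1 ≤ N → N ≤ 3 * n → 1 ≤ n
      third {N} {zero}  1≤N h = ≤-trans 1≤N h
      third {N} {suc n} 1≤N h = s≤s z≤n
      star : (X L * p) ^ (d * (k + 1)) < (27 * W) ^ (d * (k + 1)) * Q ^ (2 * k * d)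
      star = Exponents.separated k d {e} {p} {NI} {NJ} {W} {Q} {X L} 1≤e hyp NI≤3W NJ≤3Q X^d≤p
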